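{- Let $w\in\mathfrak S_n$. There is a poset isomorphism $\Phi:R(w)\to\mathrm{SBT}(w)$ such that $\Phi(\rho)=R$ if and only if $\mathrm{perm}(\rho)=\mathrm{perm}(R)$. In particular, $\Phi$ preserves the rank.
   Context: $s_i$ is the simple transposition of $\mathfrak S_n$; acting on a permutation in one-line notation it exchanges the entries in positions $i$ and $i+1$. $\ell(u)$ is the number of inversions (pairs $i<j$ with $u_i>u_j$) of a permutation $u$. A reduced word for $w$ is $\rho=(\rho_\ell,\ldots,\rho_1)$, $\ell=\ell(w)$, with $w=s_{\rho_\ell}\cdots s_{\rho_1}\cdot\mathrm{id}$; $R(w)$ is the set of reduced words. Runs of $\rho$: maximal consecutive segments strictly increasing read left to right, $(\rho^{(k)}\mid\cdots\mid\rho^{(1)})$ from left to right; $\rho$ is super-Yamanouchi if every run consists of consecutive integers and $\min(\rho^{(k)})>\cdots>\min(\rho^{(1)})$; let $\pi=(\pi_\ell,\ldots,\pi_1)$ be the unique super-Yamanouchi reduced word for $w$. $\mathrm{perm}(\rho)=v_1\cdots v_\ell\in\mathfrak S_\ell$: positions of $\rho$ start unpaired; for $i=\ell,\ldots,1$: set $k:=\pi_i$, scan $j=\ell,\ldots,1$; if position $j$ is unpaired and $\rho_j=k$, pair $j$ with $i$, set $v_i:=j$, stop the scan; else if position $j$ is unpaired and $\rho_j=k-1$, set $k:=k-1$ and continue. $\mathrm{inv}(\rho)=\ell(\mathrm{perm}(\rho))-\sum_i(\pi_i-\rho_i)$. Coxeter moves on words: $\mathfrak c_i$ exchanges $\rho_i,\rho_{i+1}$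 if $|\rho_i-\rho_{i+1}|>1$, else identity; if $\rho_{i-1}=\rho_{i+1}=a$ and $\rho_i=a\pm1$, $\mathfrak b_i$ replaces the letters in positions $i+1,i,i-1$ by $a\pm1,a,a\pm1$, else identity. Rothe diagram $\mathbb D(w)=\{(i,w_j)\mid i<j,\ w_i>w_j\}$, cell $(i,w_j)$ in row $i$ (bottom to top) and column $w_j$. $\mathrm{SBT}(w)$: bijective fillings of $\mathbb D(w)$ with $\{1,\ldots,\ell\}$ such that for each cell, the number of larger entries to its right in its row equals the number of smaller entries above it in its column. Coxeter moves on tableaux: $\mathfrak c_i$ exchanges entries $i,i+1$ if they share neither row nor column, else identity; $\mathfrak b_i$ exchanges entries $i-1,i+1$ if one lies in the column of $i$ above it and the other in the row of $i$ to its right, else identity. $\mathrm{inv}(R)$ is the number of pairs of entries $i<j$ with $i$ in a strictly higher row and a different column than $j$. $\mathrm{perm}(R)$: sort each row of $R$ into decreasing order left to right, then read rows from bottom to top, each right to left, as a one-line permutation. Posets: on $R(w)$ (resp. $\mathrm{SBT}(w)$), the partial order is the transitive closure of $X>\mathfrak c_iX$ whenever $\mathrm{inv}(\mathfrak c_iX)=\mathrm{inv}(X)+1$ and $X>\mathfrak b_iX$ whenever $\mathrm{inv}(\mathfrak b_iX)=\mathrm{inv}(X)+1$; these are ranked posets with unique maximal element (the super-Yamanouchi element, of inversion number $0$), ranked by inversion number. -}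

module Defs where

open import Data.Bool.Base using (Bool; true; false; _∧_; _∨_; not; if_then_else_)
open import Data.Nat.Base using (ℕ; zero; suc; _+_; _∸_; _≤_; _<_; _≡ᵇ_; _<ᵇ_; _≤ᵇ_; ∣_-_∣)
open import Data.Nat.Properties using (_<?_)
open import Data.Bool.ListAction using (any)
open import Data.Nat.ListAction using (sum)
open import Data.Integer.Base as ℤ using (ℤ; +_)
open import Data.List.Base using (List; []; _∷_; _++_; map; length; filter; filterᵇ; upTo; downFrom; zip; reverse; concatMap)
open import Data.List.Relation.Unary.All using (All)
open import Data.List.Relation.Unary.Linked using (Linked)
open import Data.List.Relation.Binary.Permutation.Propositional using (_↭_)
open import Data.Maybe.Base using (Maybe; just; nothing)
open import Data.Product.Base using (Σ; ∃; _×_; _,_; proj₁; proj₂)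
open import Data.Sum.Base using (_⊎_)
open import Data.Unit.Base using (⊤)
open import Relation.Binary.PropositionalEquality using (_≡_)
open import Relation.Binary.Construct.Closure.ReflexiveTransitive using (Star)
open import Function.Bundles using (_⇔_)

range1 : ℕ → List ℕ
range1 n = map suc (upTo n)

rangeDown : ℕ → List ℕ
rangeDown n = map suc (downFrom n)

atD : {A : Set} → A → List A → ℕ → A
atD d []       _       = d
atD d (x ∷ xs) zero    = x
atD d (x ∷ xs) (suc i) = atD d xs i

setAt : {A : Set} → List A → ℕ → A → List A
setAt []       _       a = []
setAt (x ∷ xs) zero    a = a ∷ xs
setAt (x ∷ xs) (suc i) a = x ∷ setAt xs i a

numbered : {A : Set} → List A → List (ℕ × A)
numbered xs = zip (range1 (length xs)) xs

-- Permutations in one-line notation (values 1..n), as lists of ℕ.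

IsPerm : ℕ → List ℕ → Set
IsPerm n u = u ↭ range1 n

invs : List ℕ → ℕ
invs []       = 0
invs (x ∷ xs) = length (filter (_<? x) xs) + invs xs

-- s_i acting on one-line notation: exchange the entries in positions i, i+1
-- (positions 1-based; identity if out of range)
swapAt : ℕ → List ℕ → List ℕ
swapAt (suc zero)    (x ∷ y ∷ xs) = y ∷ x ∷ xs
swapAt (suc (suc i)) (x ∷ xs)     = x ∷ swapAt (suc i) xs
swapAt _             xs           = xs

-- Words.  A word ρ = (ρ_ℓ, …, ρ_1) is stored as the list [ρ_ℓ, …, ρ_1]
-- (the paper's left-to-right display order).  ρ_i is `letter ρ i`.

letter : List ℕ → ℕ → ℕ
letter ρ i = atD 0 ρ (length ρ ∸ i)

setLetter : List ℕ → ℕ → ℕ → List ℕ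
setLetter ρ i a = setAt ρ (length ρ ∸ i) a

evalWord : ℕ → List ℕ → List ℕ
evalWord n ρ = Data.List.Base.foldr swapAt (range1 n) ρ

IsReduced : ℕ → List ℕ → List ℕ → Set
IsReduced n w ρ =
  All (λ a → 1 ≤ a × a < n) ρ × length ρ ≡ invs w × evalWord n ρ ≡ w

consRun : ℕ → List (List ℕ) → List (List ℕ)
consRun x []               = (x ∷ []) ∷ []
consRun x ([] ∷ rs)        = (x ∷ []) ∷ rs
consRun x ((y ∷ r) ∷ rs)   =
  if x <ᵇ y then (x ∷ y ∷ r) ∷ rs else (x ∷ []) ∷ (y ∷ r) ∷ rs

runs : List ℕ → List (List ℕ)
runs []       = []
runs (x ∷ xs) = consRun x (runs xs)

Consecutive : List ℕ → Set
Consecutive []           = ⊤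
Consecutive (x ∷ [])     = ⊤
Consecutive (x ∷ y ∷ r)  = y ≡ suc x × Consecutive (y ∷ r)

minList : List ℕ → ℕ
minList []       = 0
minList (x ∷ xs) = Data.List.Base.foldr Data.Nat.Base._⊓_ x xs

_>ℕ_ : ℕ → ℕ → Set
a >ℕ b = b < a

SuperYamanouchi : List ℕ → Set
SuperYamanouchi ρ = All Consecutive (runs ρ) × Linked _>ℕ_ (map minList (runs ρ))

-- perm(ρ) relative to π (the super-Yamanouchi word)

elemᵇ : ℕ → List ℕ → Bool
elemᵇ j P = any (j ≡ᵇ_) P

scan : List ℕ → List ℕ → ℕ → List ℕ → Maybe ℕ
scan ρ P k []       = nothing
scan ρ P k (j ∷ js) =
  if not (elemᵇ j P) ∧ (letter ρ j ≡ᵇ k) then just j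
  else (if not (elemᵇ j P) ∧ (letter ρ j ≡ᵇ (k ∸ 1))
        then scan ρ P (k ∸ 1) js
        else scan ρ P k js)

-- for i = ℓ, …, 1 (the list is): produces v_ℓ, …, v_1
-- (an index i for which the scan finds nothing gets v_i := 0; this does
-- not happen for reduced words)
pairLoop : List ℕ → List ℕ → List ℕ → List ℕ → List ℕ
pairLoop π ρ P []       = []
pairLoop π ρ P (i ∷ is) with scan ρ P (letter π i) (rangeDown (length ρ))
... | just j  = j ∷ pairLoop π ρ (j ∷ P) is
... | nothing = 0 ∷ pairLoop π ρ P is

permW : List ℕ → List ℕ → List ℕ
permW π ρ = reverse (pairLoop π ρ [] (rangeDown (length ρ)))

invW : List ℕ → List ℕ → ℤ
invW π ρ = (+ invs (permW π ρ)) ℤ.- ((+ sum π) ℤ.- (+ sum ρ))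

-- Coxeter moves on words (i is the paper's 1-based index)
cW : ℕ → List ℕ → List ℕ
cW i ρ =
  if (1 ≤ᵇ i) ∧ (i <ᵇ length ρ) ∧ (1 <ᵇ ∣ letter ρ i - letter ρ (suc i) ∣)
  then setLetter (setLetter ρ i (letter ρ (suc i))) (suc i) (letter ρ i)
  else ρ

bW : ℕ → List ℕ → List ℕ
bW i ρ =
  if (2 ≤ᵇ i) ∧ (i <ᵇ length ρ) ∧ (letter ρ (suc i) ≡ᵇ a)
     ∧ ((letter ρ i ≡ᵇ suc a) ∨ (suc (letter ρ i) ≡ᵇ a))
  then setLetter (setLetter (setLetter ρ (suc i) (letter ρ i)) i a) (i ∸ 1) (letter ρ i)
  else ρ
  where a = letter ρ (i ∸ 1)

Cell : Set
Cell = ℕ × ℕ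

row col : Cell → ℕ
row = proj₁
col = proj₂

diagramFrom : ℕ → List ℕ → List Cell
diagramFrom i []       = []
diagramFrom i (x ∷ xs) = map (λ y → (i , y)) (filter (_<? x) xs) ++ diagramFrom (suc i) xs

diagram : List ℕ → List Cell
diagram w = diagramFrom 1 w

-- A filling is stored as the list T = [cell of 1, cell of 2, …, cell of ℓ];
-- it is a bijective filling of 𝔻(w) with {1,…,ℓ} iff T ↭ 𝔻(w).
cellOf : List Cell → ℕ → Cell
cellOf T k = atD (0 , 0) T (k ∸ 1)

rightLarger : List Cell → ℕ → Cell → ℕ
rightLarger T k (r , c) =
  length (filterᵇ (λ e → (row (proj₂ e) ≡ᵇ r) ∧ (c <ᵇ col (proj₂ e)) ∧ (k <ᵇ proj₁ e)) (numbered T))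

-- number of smaller entries above it in its column (rows numbered bottom to top)
aboveSmaller : List Cell → ℕ → Cell → ℕ
aboveSmaller T k (r , c) =
  length (filterᵇ (λ e → (col (proj₂ e) ≡ᵇ c) ∧ (r <ᵇ row (proj₂ e)) ∧ (proj₁ e <ᵇ k)) (numbered T))

Balanced : List Cell → Set
Balanced T = All (λ e → rightLarger T (proj₁ e) (proj₂ e) ≡ aboveSmaller T (proj₁ e) (proj₂ e)) (numbered T)

IsSBT : List ℕ → List Cell → Set
IsSBT w T = T ↭ diagram w × Balanced T

invT : List Cell → ℕ
invT []       = 0
invT (x ∷ xs) =
  length (filterᵇ (λ y → (row y <ᵇ row x) ∧ not (col x ≡ᵇ col y)) xs) + invT xs

-- entries of row r, in increasing order (= row sorted decreasingly, read right to left)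
rowEntries : List Cell → ℕ → List ℕ
rowEntries T r = map proj₁ (filterᵇ (λ e → row (proj₂ e) ≡ᵇ r) (numbered T))

permT : ℕ → List Cell → List ℕ
permT n T = concatMap (rowEntries T) (range1 n)

cT : ℕ → List Cell → List Cell
cT i T =
  if (1 ≤ᵇ i) ∧ (i <ᵇ length T) ∧ not (row x ≡ᵇ row y) ∧ not (col x ≡ᵇ col y)
  then setAt (setAt T (i ∸ 1) y) i x
  else T
  where x = cellOf T i
        y = cellOf T (suc i)

aboveᵇ : Cell → Cell → Bool
aboveᵇ x p = (col p ≡ᵇ col x) ∧ (row x <ᵇ row p)

rightᵇ : Cell → Cell → Bool
rightᵇ x q = (row q ≡ᵇ row x) ∧ (col x <ᵇ col q)

bT : ℕ → List Cell → List Cell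
bT i T =
  if (2 ≤ᵇ i) ∧ (i <ᵇ length T)
     ∧ ((aboveᵇ x p ∧ rightᵇ x q) ∨ (aboveᵇ x q ∧ rightᵇ x p))
  then setAt (setAt T (i ∸ 2) q) i p
  else T
  where x = cellOf T i
        p = cellOf T (i ∸ 1)
        q = cellOf T (suc i)

-- The posets.  `CoverW π n w X Y` means X > Y is a generating relation
-- (both in R(w)); the order X ≥ Y is its reflexive-transitive closure.

CoverW : List ℕ → ℕ → List ℕ → List ℕ → List ℕ → Set
CoverW π n w X Y =
  IsReduced n w X × IsReduced n w Y ×
  Σ ℕ (λ i → (Y ≡ cW i X ⊎ Y ≡ bW i X) × invW π Y ≡ invW π X ℤ.+ ℤ.1ℤ)

_≤R[_,_,_]_ : List ℕ → List ℕ → ℕ → List ℕ → List ℕ → Set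
X ≤R[ π , n , w ] Y = Star (CoverW π n w) Y X

CoverT : List ℕ → List Cell → List Cell → Set
CoverT w X Y =
  IsSBT w X × IsSBT w Y ×
  Σ ℕ (λ i → (Y ≡ cT i X ⊎ Y ≡ bT i X) × invT Y ≡ suc (invT X))

_≤S[_]_ : List Cell → List ℕ → List Cell → Set
X ≤S[ w ] Y = Star (CoverT w) Y X

record IsPosetIso {A B : Set} (P : A → Set) (Q : B → Set)
                  (_≤A_ : A → A → Set) (_≤B_ : B → B → Set) (Φ : A → B) : Set where
  field
    into  : ∀ {a} → P a → Q (Φ a)
    inj   : ∀ {a a′} → P a → P a′ → Φ a ≡ Φ a′ → a ≡ a′
    surj  : ∀ {b} → Q b → ∃ λ a → P a × Φ a ≡ b
    order : ∀ {a a′} → P a → P a′ → (a ≤A a′) ⇔ (Φ a ≤B Φ a′)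

{-# OPTIONS --safe #-}
-- Read from right to left, each letter a of a reduced word exchanges an ascent p < q in positions a, a + 1.
-- The tableau of the word puts the entry k of the k-th letter into column p and into the row where q finally
-- stands.  Adding a letter a on the left adds the largest entry in cell (a , p) and exchanges the rows a and
-- a + 1; this preserves balance in both directions because in a balanced filling the entries of these two rows
-- are ordered columnwise (a violation forces another one with a larger entry).  Conversely the largest entry of a
-- balanced filling of w sits at a descent of w, so every balanced filling is obtained, and since its row is the
-- first letter of the word, the word is determined by the rows of the entries, hence by perm(R).
--
-- The super-Yamanouchi word is the concatenation, for r = n, …, 1, of the intervals r, …, r + c_r - 1 with c the
-- Lehmer code of w.  The scan for the letter r + m - 1 follows the m-th leftmost of the values that end up in
-- rows ≥ r, so it stops at the m-th largest entry of row r; hence perm(ρ) = perm(Φ ρ).  Both Σ (π_i - ρ_i) and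
-- the number of inversions of perm(R) inside the columns grow by the Lehmer code entry of p when a letter
-- is added, so the inversion numbers agree; and Φ visibly commutes with the Coxeter moves.
module Submission where

open import Defs
open import Data.Bool.Base using (Bool; true; false; T; _∧_; _∨_; not; if_then_else_)
open import Data.Bool.Properties using (T-≡; T-∧; T-∨; ∧-identityʳ; ∧-zeroʳ; ∨-zeroʳ)
open import Data.Empty using (⊥; ⊥-elim)
open import Data.List.Base hiding (find; sum)
open import Data.List.Properties hiding (≡-dec; sum-++)
open import Data.List.Membership.Propositional using (_∈_; _∉_; find; lose)
open import Data.List.Membership.Propositional.Properties
import Data.List.Membership.DecPropositional as DecMembership
open import Data.List.Relation.Unary.All.Properties as All using (all-filter; concat⁻)
open import Data.List.Relation.Unary.All as All using (All; []; _∷_)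
open import Data.List.Relation.Unary.AllPairs as AllPairs using (AllPairs; []; _∷_)
import Data.List.Relation.Unary.AllPairs.Properties as AllPairs
open import Data.List.Relation.Unary.Any using (here; there; any?)
open import Data.List.Relation.Unary.Unique.Propositional using (Unique)
open import Data.List.Relation.Unary.Unique.Propositional.Properties as Unique using (Unique[x∷xs]⇒x∉xs)
open import Data.List.Relation.Binary.Permutation.Propositional using (_↭_; ↭-refl; ↭-sym; ↭-trans; ↭-reflexive; ↭⇒↭ₛ; prep; swap; module PermutationReasoning)
import Data.List.Relation.Binary.Permutation.Setoid.Properties as ↭ₛ
open import Data.List.Relation.Binary.Pointwise using (Pointwise-≡⇒≡)
open import Data.List.Relation.Unary.Linked as Linked using (Linked; []; [-]; _∷_)
open import Data.List.Relation.Unary.Sorted.TotalOrder.Properties using (↗↭↗⇒≋)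
open import Data.List.Relation.Binary.Permutation.Propositional.Properties as ↭ using (∈-resp-↭; ↭-length)
open import Data.Maybe.Base using (just)
open import Data.Nat.Base
open import Data.Nat.Properties
open import Data.Nat.Induction using (<-wellFounded)
open import Induction.WellFounded using (Acc; acc)
open import Data.Product.Properties using (≡-dec)
open import Data.Product.Base using (Σ; ∃; _×_; _,_; proj₁; proj₂)
open import Data.Sum.Base as Sum using (_⊎_; inj₁; inj₂)
open import Algebra.Properties.CommutativeSemigroup +-commutativeSemigroup using (interchange; x∙yz≈y∙xz)
open import Data.Nat.ListAction using (sum)
open import Data.Nat.ListAction.Properties using (sum-++)
open import Data.Nat.Tactic.RingSolver using (solve-∀)
open import Relation.Binary.Construct.Closure.ReflexiveTransitive as Star using (Star; ε; _◅_)
open import Data.Unit.Base using (⊤)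
open import Function.Base using (_∘_; id)
open import Function.Bundles using (_⇔_; mk⇔; Equivalence)
open import Relation.Nullary.Decidable using (Dec; yes; no; ¬?; T?)
open import Relation.Nullary.Negation using (¬_)
open import Relation.Binary.Definitions using (Tri; tri<; tri≈; tri>)
open import Relation.Binary.PropositionalEquality as ≡ using (_≡_; _≢_; refl; sym; trans; cong; cong₂; subst; module ≡-Reasoning; setoid)

-- Booleans and counting

-- Columns are values and rows are positions, so a letter moves rows only; every induction strips
-- the leftmost letter, that is, the largest entry. The delicate point is balance. Let x < y be the
-- exchanged values. The new cell (a , x) holds the largest entry, so it raises the right count by
-- one exactly for the old cells of row a + 1 in columns left of x. These cells descend to row a
-- while the cells of row a in the same columns rise past them, so their above count also grows by
-- one, provided that the risen entry is the smaller of the two; the same proviso keeps the above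
-- count of the risen cell unchanged. Everything therefore hinges on the columnwise order of the two
-- rows. At a violation of that order one strict inequality between right counts starts the
-- pigeonhole argument, and this inequality follows from balance before the step just as well as
-- from balance after it. That is why both directions are available although the order is assumed in
-- neither.

T⇒true : ∀ {b} → T b → b ≡ true
T⇒true = Equivalence.to T-≡

bool-ext : ∀ {a b} → (T a → T b) → (T b → T a) → a ≡ b
bool-ext {false} {false} f g = refl
bool-ext {false} {true}  f g = ⊥-elim (g _)
bool-ext {true}  {false} f g = ⊥-elim (f _)
bool-ext {true}  {true}  f g = refl

¬T⇒false : ∀ {b} → ¬ T b → b ≡ false
¬T⇒false {false} _ = refl
¬T⇒false {true}  h = ⊥-elim (h _)

≡ᵇ-refl : ∀ m → (m ≡ᵇ m) ≡ true
≡ᵇ-refl m = T⇒true (≡⇒≡ᵇ m m refl)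

≢⇒≡ᵇ : ∀ {m n} → m ≢ n → (m ≡ᵇ n) ≡ false
≢⇒≡ᵇ {m} {n} m≢n = ¬T⇒false (m≢n ∘ ≡ᵇ⇒≡ m n)

indicator : Bool → ℕ
indicator b = if b then 1 else 0

count : {A : Set} → (A → Bool) → List A → ℕ
count p []       = 0
count p (x ∷ xs) = indicator (p x) + count p xs

module _ {A : Set} where

  count≡length-filterᵇ : ∀ (p : A → Bool) xs → length (filterᵇ p xs) ≡ count p xs
  count≡length-filterᵇ p [] = refl
  count≡length-filterᵇ p (x ∷ xs) with p x
  ... | true  = cong suc (count≡length-filterᵇ p xs)
  ... | false = count≡length-filterᵇ p xs

  count-++ : ∀ (p : A → Bool) xs ys → count p (xs ++ ys) ≡ count p xs + count p ys
  count-++ p [] ys = refl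
  count-++ p (x ∷ xs) ys =
    trans (cong (indicator (p x) +_) (count-++ p xs ys)) (sym (+-assoc (indicator (p x)) _ _))

  count-cong : ∀ {p q : A → Bool} xs → (∀ {x} → x ∈ xs → p x ≡ q x) → count p xs ≡ count q xs
  count-cong [] h = refl
  count-cong (x ∷ xs) h =
    cong₂ (λ b k → indicator b + k) (h (here refl)) (count-cong xs (h ∘ there))

  count-+ : ∀ {p q r : A → Bool} xs →
    (∀ {x} → x ∈ xs → indicator (p x) ≡ indicator (q x) + indicator (r x)) → count p xs ≡ count q xs + count r xs
  count-+ [] h = refl
  count-+ {p} {q} {r} (x ∷ xs) h = begin
    indicator (p x) + count p xs                                       ≡⟨ cong₂ _+_ (h (here refl)) (count-+ xs (h ∘ there)) ⟩
    (indicator (q x) + indicator (r x)) + (count q xs + count r xs)    ≡⟨ interchange (indicator (q x)) _ _ _ ⟩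
    (indicator (q x) + count q xs) + (indicator (r x) + count r xs)    ∎
    where open ≡-Reasoning

  count-mono : ∀ {p q : A → Bool} xs → (∀ {x} → x ∈ xs → T (p x) → T (q x)) → count p xs ≤ count q xs
  count-mono [] h = z≤n
  count-mono {p} {q} (x ∷ xs) h = +-mono-≤ (ind≤ (h (here refl))) (count-mono xs (h ∘ there))
    where
    ind≤ : ∀ {a b} → (T a → T b) → indicator a ≤ indicator b
    ind≤ {false} f = z≤n
    ind≤ {true} {true} f = ≤-refl
    ind≤ {true} {false} f = ⊥-elim (f _)

  count-↭ : ∀ (p : A → Bool) {xs ys} → xs ↭ ys → count p xs ≡ count p ys
  count-↭ p _↭_.refl = refl
  count-↭ p (prep x r) = cong (indicator (p x) +_) (count-↭ p r)
  count-↭ p (swap {xs} {ys} x y r) = begin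
    i + (j + count p xs) ≡⟨ +-assoc i j _ ⟨
    (i + j) + count p xs ≡⟨ cong₂ _+_ (+-comm i j) (count-↭ p r) ⟩
    (j + i) + count p ys ≡⟨ +-assoc j i _ ⟩
    j + (i + count p ys) ∎
    where
    open ≡-Reasoning
    i j : ℕ
    i = indicator (p x)
    j = indicator (p y)
  count-↭ p (_↭_.trans r s) = trans (count-↭ p r) (count-↭ p s)

  count-none : ∀ (p : A → Bool) xs → (∀ {x} → x ∈ xs → ¬ T (p x)) → count p xs ≡ 0
  count-none p [] h = refl
  count-none p (x ∷ xs) h rewrite ¬T⇒false (h (here refl)) = count-none p xs (h ∘ there)

  count-∈ : ∀ (p : A → Bool) {x xs} → x ∈ xs → T (p x) → 1 ≤ count p xs
  count-∈ p {x} (here refl) t rewrite T⇒true t = s≤s z≤n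
  count-∈ p (there x∈xs) t = ≤-trans (count-∈ p x∈xs t) (m≤n+m _ _)

  count>0 : ∀ (p : A → Bool) xs → 1 ≤ count p xs → ∃ λ x → x ∈ xs × T (p x)
  count>0 p (x ∷ xs) h with p x in eq
  ... | true  = x , here refl , subst T (sym eq) _
  ... | false = let (y , y∈ , t) = count>0 p xs h in y , there y∈ , t

  count-unique : ∀ (p : A → Bool) {x xs} → Unique xs → x ∈ xs → T (p x) →
    (∀ {y} → y ∈ xs → T (p y) → y ≡ x) → count p xs ≡ 1
  count-unique p {xs = y ∷ ys} u@(_ ∷ us) (here refl) t h rewrite T⇒true t =
    cong suc (count-none p ys λ {z} z∈ tz →
      Unique[x∷xs]⇒x∉xs u (subst (_∈ ys) (h (there z∈) tz) z∈))
  count-unique p {x} {y ∷ ys} u@(_ ∷ us) (there x∈) t h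
    rewrite ¬T⇒false {p y} (λ ty → Unique[x∷xs]⇒x∉xs u (subst (_∈ ys) (sym (h (here refl) ty)) x∈))
    = count-unique p us x∈ t (h ∘ there)

count-map : ∀ {A B : Set} (p : B → Bool) (f : A → B) xs → count p (map f xs) ≡ count (p ∘ f) xs
count-map p f [] = refl
count-map p f (x ∷ xs) = cong (indicator (p (f x)) +_) (count-map p f xs)

-- Unique lists

module _ {A : Set} where

  Unique-++⁻ˡ : ∀ (xs : List A) {ys} → Unique (xs ++ ys) → Unique xs
  Unique-++⁻ˡ [] u = []
  Unique-++⁻ˡ (x ∷ xs) (p ∷ u) = All.tabulate (λ z∈ → All.lookup p (∈-++⁺ˡ z∈)) ∷ Unique-++⁻ˡ xs u

  Unique-++⁻ʳ : ∀ (xs : List A) {ys} → Unique (xs ++ ys) → Unique ys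
  Unique-++⁻ʳ [] u = u
  Unique-++⁻ʳ (x ∷ xs) (p ∷ u) = Unique-++⁻ʳ xs u

  Unique-disjoint : ∀ (xs : List A) {ys z} → Unique (xs ++ ys) → z ∈ xs → z ∉ ys
  Unique-disjoint (x ∷ xs) (p ∷ u) (here refl) z∈ = All.lookup p (∈-++⁺ʳ xs z∈) refl
  Unique-disjoint (x ∷ xs) (p ∷ u) (there h) z∈ = Unique-disjoint xs u h z∈

  Unique-↭ : ∀ {xs ys : List A} → xs ↭ ys → Unique xs → Unique ys
  Unique-↭ r = ↭ₛ.Unique-resp-↭ (setoid A) (↭⇒↭ₛ r)

  Unique-⊆-length : ∀ {xs ys : List A} → Unique xs → (∀ {z} → z ∈ xs → z ∈ ys) → length xs ≤ length ys
  Unique-⊆-length {[]} u h = z≤n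
  Unique-⊆-length {x ∷ xs} {ys} u@(_ ∷ us) h with ∈-∃++ (h (here refl))
  ... | as , bs , refl = ≤-trans (s≤s (Unique-⊆-length us h′)) (≤-reflexive (sym (length-++-sucʳ as x bs)))
    where
    h′ : ∀ {z} → z ∈ xs → z ∈ as ++ bs
    h′ z∈ with ∈-++⁻ as (h (there z∈))
    ... | inj₁ z∈as = ∈-++⁺ˡ z∈as
    ... | inj₂ (here refl) = ⊥-elim (Unique[x∷xs]⇒x∉xs u z∈)
    ... | inj₂ (there z∈bs) = ∈-++⁺ʳ as z∈bs

-- Adjacent transpositions

-- The transposition of `a` and `suc a` on all of ℕ. Structural recursion instead of comparisons
-- lets the involution, commutation and braid laws reduce to a few computing cases.
τ : ℕ → ℕ → ℕ
τ zero    zero          = 1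
τ zero    (suc zero)    = 0
τ zero    (suc (suc i)) = suc (suc i)
τ (suc a) zero          = 0
τ (suc a) (suc i)       = suc (τ a i)

τ-left : ∀ a → τ a a ≡ suc a
τ-left zero    = refl
τ-left (suc a) = cong suc (τ-left a)

τ-right : ∀ a → τ a (suc a) ≡ a
τ-right zero    = refl
τ-right (suc a) = cong suc (τ-right a)

τ-other : ∀ a i → i ≢ a → i ≢ suc a → τ a i ≡ i
τ-other zero    zero          p q = ⊥-elim (p refl)
τ-other zero    (suc zero)    p q = ⊥-elim (q refl)
τ-other zero    (suc (suc i)) p q = refl
τ-other (suc a) zero          p q = refl
τ-other (suc a) (suc i)       p q = cong suc (τ-other a i (p ∘ cong suc) (q ∘ cong suc))

data TauView (a : ℕ) : ℕ → Set where
  isL : TauView a a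
  isR : TauView a (suc a)
  isO : ∀ {i} → i ≢ a → i ≢ suc a → TauView a i

tauView : ∀ a i → TauView a i
tauView a i with i ≟ a | i ≟ suc a
... | yes refl | _        = isL
... | no _     | yes refl = isR
... | no p     | no q     = isO p q

τ-involutive : ∀ a i → τ a (τ a i) ≡ i
τ-involutive zero    zero          = refl
τ-involutive zero    (suc zero)    = refl
τ-involutive zero    (suc (suc i)) = refl
τ-involutive (suc a) zero          = refl
τ-involutive (suc a) (suc i)       = cong suc (τ-involutive a i)

τ-injective : ∀ a {i j} → τ a i ≡ τ a j → i ≡ j
τ-injective a {i} {j} e = trans (sym (τ-involutive a i)) (trans (cong (τ a) e) (τ-involutive a j))

τ-comm : ∀ a b i → suc a < b → τ a (τ b i) ≡ τ b (τ a i)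
τ-comm zero    (suc (suc b)) zero          p = refl
τ-comm zero    (suc (suc b)) (suc zero)    p = refl
τ-comm zero    (suc (suc b)) (suc (suc i)) p = refl
τ-comm zero (suc zero) i (s≤s ())
τ-comm (suc a) (suc b)       zero          p = refl
τ-comm (suc a) (suc b)       (suc i)       (s≤s p) = cong suc (τ-comm a b i p)

τ-braid : ∀ a i → τ a (τ (suc a) (τ a i)) ≡ τ (suc a) (τ a (τ (suc a) i))
τ-braid zero    zero                = refl
τ-braid zero    (suc zero)          = refl
τ-braid zero    (suc (suc zero))    = refl
τ-braid zero    (suc (suc (suc i))) = refl
τ-braid (suc a) zero                = refl
τ-braid (suc a) (suc i)             = cong suc (τ-braid a i)

-- One-line notation

-- 1-based, with value 0 outside the range 1 … length u.
val : List ℕ → ℕ → ℕ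
val []       i             = 0
val (x ∷ u)  zero          = 0
val (x ∷ u)  (suc zero)    = x
val (x ∷ u)  (suc (suc i)) = val u (suc i)

length-swapAt : ∀ a u → length (swapAt a u) ≡ length u
length-swapAt zero          u           = refl
length-swapAt (suc zero)    []          = refl
length-swapAt (suc zero)    (x ∷ [])    = refl
length-swapAt (suc zero)    (x ∷ y ∷ u) = refl
length-swapAt (suc (suc a)) []          = refl
length-swapAt (suc (suc a)) (x ∷ u)     = cong suc (length-swapAt (suc a) u)

swapAt-↭ : ∀ a u → swapAt a u ↭ u
swapAt-↭ zero          u           = ↭-refl
swapAt-↭ (suc zero)    []          = ↭-refl
swapAt-↭ (suc zero)    (x ∷ [])    = ↭-refl
swapAt-↭ (suc zero)    (x ∷ y ∷ u) = swap y x ↭-refl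
swapAt-↭ (suc (suc a)) []          = ↭-refl
swapAt-↭ (suc (suc a)) (x ∷ u)     = prep x (swapAt-↭ (suc a) u)

swapAt-involutive : ∀ a u → swapAt a (swapAt a u) ≡ u
swapAt-involutive zero          u           = refl
swapAt-involutive (suc zero)    []          = refl
swapAt-involutive (suc zero)    (x ∷ [])    = refl
swapAt-involutive (suc zero)    (x ∷ y ∷ u) = refl
swapAt-involutive (suc (suc a)) []          = refl
swapAt-involutive (suc (suc a)) (x ∷ u)     = cong (x ∷_) (swapAt-involutive (suc a) u)

swapAt-comm : ∀ a b u → suc a < b → swapAt a (swapAt b u) ≡ swapAt b (swapAt a u)
swapAt-comm zero b u p = refl
swapAt-comm (suc zero) (suc (suc (suc b))) [] p = refl
swapAt-comm (suc zero) (suc (suc (suc b))) (x ∷ []) p = refl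
swapAt-comm (suc zero) (suc (suc (suc b))) (x ∷ y ∷ u) p = refl
swapAt-comm (suc zero) (suc (suc zero)) u (s≤s (s≤s ()))
swapAt-comm (suc zero) (suc zero) u (s≤s ())
swapAt-comm (suc (suc a)) (suc (suc b)) [] p = refl
swapAt-comm (suc (suc a)) (suc (suc b)) (x ∷ u) (s≤s p) = cong (x ∷_) (swapAt-comm (suc a) (suc b) u p)
swapAt-comm (suc (suc a)) (suc zero) u (s≤s ())

-- The range matters: on a list of length `suc a` the swap at `suc a` is the identity, and the two
-- sides differ in general.
swapAt-braid : ∀ a u → 1 ≤ a → suc a < length u →
  swapAt a (swapAt (suc a) (swapAt a u)) ≡ swapAt (suc a) (swapAt a (swapAt (suc a) u))
swapAt-braid (suc zero) (x ∷ y ∷ z ∷ u) _ p = refl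
swapAt-braid (suc zero) (x ∷ y ∷ []) _ (s≤s (s≤s ()))
swapAt-braid (suc zero) (x ∷ []) _ (s≤s ())
swapAt-braid (suc (suc a)) (x ∷ u) _ (s≤s p) = cong (x ∷_) (swapAt-braid (suc a) u (s≤s z≤n) p)

val-0 : ∀ u → val u 0 ≡ 0
val-0 []      = refl
val-0 (x ∷ u) = refl

val-swapAt : ∀ a u i → 1 ≤ a → a < length u → val (swapAt a u) i ≡ val u (τ a i)
val-swapAt (suc zero) (x ∷ []) i _ (s≤s ())
val-swapAt (suc zero) (x ∷ y ∷ u) zero _ p = refl
val-swapAt (suc zero) (x ∷ y ∷ u) (suc zero) _ p = refl
val-swapAt (suc zero) (x ∷ y ∷ u) (suc (suc zero)) _ p = refl
val-swapAt (suc zero) (x ∷ y ∷ u) (suc (suc (suc i))) _ p = refl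
val-swapAt (suc (suc a)) (x ∷ u) zero _ p = refl
val-swapAt (suc (suc a)) (x ∷ u) (suc zero) _ p = refl
val-swapAt (suc (suc a)) (x ∷ u) (suc (suc i)) _ (s≤s p) = begin
  val (swapAt (suc a) u) (suc i)   ≡⟨ val-swapAt (suc a) u (suc i) (s≤s z≤n) p ⟩
  val u (τ (suc a) (suc i))        ≡⟨⟩
  val (x ∷ u) (τ (suc (suc a)) (suc (suc i))) ∎
  where open ≡-Reasoning

val-∈ : ∀ u i → 1 ≤ i → i ≤ length u → val u i ∈ u
val-∈ (x ∷ u) (suc zero) _ p = here refl
val-∈ (x ∷ u) (suc (suc i)) _ (s≤s p) = there (val-∈ u (suc i) (s≤s z≤n) p)

∈⇒val : ∀ {x u} → x ∈ u → ∃ λ i → 1 ≤ i × i ≤ length u × val u i ≡ x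
∈⇒val (here refl) = 1 , s≤s z≤n , s≤s z≤n , refl
∈⇒val {x} {y ∷ u} (there x∈) with ∈⇒val x∈
... | suc i , _ , q , e = suc (suc i) , s≤s z≤n , s≤s q , e

val-injective : ∀ {u i j} → Unique u → 1 ≤ i → i ≤ length u → 1 ≤ j → j ≤ length u →
  val u i ≡ val u j → i ≡ j
val-injective {x ∷ u} {suc zero} {suc zero} un _ _ _ _ e = refl
val-injective {x ∷ u} {suc zero} {suc (suc j)} un _ _ _ (s≤s q) e =
  ⊥-elim (Unique[x∷xs]⇒x∉xs un (subst (_∈ u) (sym e) (val-∈ u (suc j) (s≤s z≤n) q)))
val-injective {x ∷ u} {suc (suc i)} {suc zero} un _ (s≤s p) _ _ e =
  ⊥-elim (Unique[x∷xs]⇒x∉xs un (subst (_∈ u) e (val-∈ u (suc i) (s≤s z≤n) p)))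
val-injective {x ∷ u} {suc (suc i)} {suc (suc j)} (_ ∷ un) _ (s≤s p) _ (s≤s q) e =
  cong suc (val-injective un (s≤s z≤n) p (s≤s z≤n) q e)

-- Rothe diagrams

val-suc : ∀ x u {k} → 1 ≤ k → val (x ∷ u) (suc k) ≡ val u k
val-suc x u (s≤s z≤n) = refl

∈-diagramFrom⁻ : ∀ i u {r c} → (r , c) ∈ diagramFrom (suc i) u →
  ∃ λ k → r ≡ i + k × 1 ≤ k × ∃ λ j → k < j × j ≤ length u × val u j ≡ c × c < val u k
∈-diagramFrom⁻ i (x ∷ u) {r} {c} h with ∈-++⁻ (map (λ y → (suc i , y)) (filter (_<? x) u)) h
... | inj₁ h₁ with ∈-map⁻ _ h₁
...   | y , y∈ , refl with ∈-filter⁻ (_<? x) {xs = u} y∈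
...     | y∈u , y<x with ∈⇒val y∈u
...       | j , 1≤j , j≤ , e =
  1 , +-comm 1 i , s≤s z≤n , suc j , s≤s 1≤j , s≤s j≤ , trans (val-suc x u 1≤j) e , y<x
∈-diagramFrom⁻ i (x ∷ u) h | inj₂ h₂ with ∈-diagramFrom⁻ (suc i) u h₂
... | k , e , 1≤k , j , k<j , j≤ , ej , lt =
  suc k , trans e (sym (+-suc i k)) , s≤s z≤n , suc j , s≤s k<j , s≤s j≤ ,
  trans (val-suc x u (≤-trans 1≤k (<⇒≤ k<j))) ej , subst (_ <_) (sym (val-suc x u 1≤k)) lt

∈-diagramFrom⁺ : ∀ i u {k j} → 1 ≤ k → k < j → j ≤ length u → val u j < val u k →
  (i + k , val u j) ∈ diagramFrom (suc i) u
∈-diagramFrom⁺ i (x ∷ u) {suc zero} {suc (suc j)} _ _ (s≤s j≤) lt rewrite +-comm i 1 =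
  ∈-++⁺ˡ (∈-map⁺ _ (∈-filter⁺ (_<? x) (val-∈ u (suc j) (s≤s z≤n) j≤) lt))
∈-diagramFrom⁺ i (x ∷ u) {suc zero} {suc zero} _ (s≤s ()) _ lt
∈-diagramFrom⁺ i (x ∷ u) {suc (suc k)} {suc (suc j)} _ (s≤s k<j) (s≤s j≤) lt rewrite +-suc i (suc k) =
  ∈-++⁺ʳ (map (λ y → (suc i , y)) (filter (_<? x) u)) (∈-diagramFrom⁺ (suc i) u (s≤s z≤n) k<j j≤ lt)
∈-diagramFrom⁺ i (x ∷ u) {suc (suc k)} {suc zero} _ (s≤s ()) _ lt

∈-diagram⁻ : ∀ u {r c} → (r , c) ∈ diagram u →
  1 ≤ r × ∃ λ j → r < j × j ≤ length u × val u j ≡ c × c < val u r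
∈-diagram⁻ u h with ∈-diagramFrom⁻ 0 u h
... | k , refl , rest = rest

∈-diagram⁺ : ∀ u {r j} → 1 ≤ r → r < j → j ≤ length u → val u j < val u r → (r , val u j) ∈ diagram u
∈-diagram⁺ = ∈-diagramFrom⁺ 0

length-diagramFrom : ∀ i u → length (diagramFrom i u) ≡ invs u
length-diagramFrom i [] = refl
length-diagramFrom i (x ∷ u) =
  trans (length-++ (map (λ y → (i , y)) (filter (_<? x) u)))
        (cong₂ _+_ (length-map _ (filter (_<? x) u)) (length-diagramFrom (suc i) u))

diagramFrom-row : ∀ i u {r c} → (r , c) ∈ diagramFrom (suc i) u → i < r
diagramFrom-row i u h with ∈-diagramFrom⁻ i u h
... | suc k , refl , _ = m<m+n i (s≤s z≤n)

Unique-diagramFrom : ∀ i u → Unique u → Unique (diagramFrom (suc i) u)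
Unique-diagramFrom i [] un = []
Unique-diagramFrom i (x ∷ u) (_ ∷ un) =
  Unique.++⁺ (Unique.map⁺ (λ { refl → refl }) (Unique.filter⁺ (_<? x) un)) (Unique-diagramFrom (suc i) u un) disj
  where
  disj : ∀ {z} → ¬ (z ∈ map (λ y → (suc i , y)) (filter (_<? x) u) × z ∈ diagramFrom (suc (suc i)) u)
  disj (p , q) with ∈-map⁻ _ p
  ... | y , _ , refl = <-irrefl refl (diagramFrom-row (suc i) u q)

Unique-diagram : ∀ u → Unique u → Unique (diagram u)
Unique-diagram = Unique-diagramFrom 0

τrow : ℕ → Cell → Cell
τrow a (r , c) = (τ a r , c)

τrow-involutive : ∀ a z → τrow a (τrow a z) ≡ z
τrow-involutive a (r , c) = cong (_, c) (τ-involutive a r)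

map-τrow-involutive : ∀ a Z → map (τrow a) (map (τrow a) Z) ≡ Z
map-τrow-involutive a Z = trans (sym (map-∘ Z)) (trans (map-cong (τrow-involutive a) Z) (map-id Z))

map-τrow-fixed : ∀ a Z → (∀ {r c} → (r , c) ∈ Z → r ≢ a × r ≢ suc a) → map (τrow a) Z ≡ Z
map-τrow-fixed a Z h =
  map-id-local (All.tabulate λ { {r , c} z∈ → cong (_, c) (τ-other a r (proj₁ (h z∈)) (proj₂ (h z∈))) })

-- Both exchanged positions see the same later values, so exchanging them exchanges their rows; the
-- only new inversion is that of the two values themselves. Here `a` is the distance from the head
-- of the list, and `a + suc i` the row number in the surrounding diagram.
diagramFrom-swapAt : ∀ a i u → suc a < length u → val u (suc a) < val u (suc (suc a)) →
  diagramFrom (suc i) (swapAt (suc a) u) ↭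
    (a + suc i , val u (suc a)) ∷ map (τrow (a + suc i)) (diagramFrom (suc i) u)
diagramFrom-swapAt zero i (x ∷ []) (s≤s ()) lt
diagramFrom-swapAt zero i (x ∷ y ∷ u) _ x<y = begin
  map (suc i ,_) (filter (_<? y) (x ∷ u)) ++ F₂x ++ D
    ≡⟨ cong (λ l → map (suc i ,_) l ++ F₂x ++ D) (filter-accept (_<? y) x<y) ⟩
  (suc i , x) ∷ F₁y ++ F₂x ++ D
    ↭⟨ prep _ (↭.shifts F₁y F₂x) ⟩
  (suc i , x) ∷ F₂x ++ F₁y ++ D
    ≡⟨ cong ((suc i , x) ∷_) eq ⟩
  (suc i , x) ∷ map (τrow (suc i)) (diagramFrom (suc i) (x ∷ y ∷ u)) ∎
  where
  open PermutationReasoning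
  F₁y F₂x D : List Cell
  F₁y = map (suc i ,_) (filter (_<? y) u)
  F₂x = map (suc (suc i) ,_) (filter (_<? x) u)
  D = diagramFrom (suc (suc (suc i))) u
  mapcell : ∀ k l → map (τrow (suc i)) (map (k ,_) l) ≡ map (τ (suc i) k ,_) l
  mapcell k l = sym (map-∘ l)
  fixed : ∀ {r c} → (r , c) ∈ D → r ≢ suc i × r ≢ suc (suc i)
  fixed h = (λ { refl → <⇒≱ (diagramFrom-row (suc (suc i)) u h) (n≤1+n _) }) ,
            (λ { refl → <-irrefl refl (diagramFrom-row (suc (suc i)) u h) })
  eq : F₂x ++ F₁y ++ D ≡ map (τrow (suc i)) (diagramFrom (suc i) (x ∷ y ∷ u))
  eq = sym (trans (map-++ (τrow (suc i)) (map (suc i ,_) (filter (_<? x) (y ∷ u))) _)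
      (cong₂ _++_ (trans (cong (map (τrow (suc i)) ∘ map (suc i ,_)) (filter-reject (_<? x) (<⇒≯ x<y)))
                         (trans (mapcell (suc i) (filter (_<? x) u)) (cong (λ k → map (k ,_) (filter (_<? x) u)) (τ-left (suc i)))))
      (trans (map-++ (τrow (suc i)) (map (suc (suc i) ,_) (filter (_<? y) u)) D)
      (cong₂ _++_ (trans (mapcell (suc (suc i)) (filter (_<? y) u)) (cong (λ k → map (k ,_) (filter (_<? y) u)) (τ-right (suc i))))
                  (map-τrow-fixed (suc i) D fixed)))))
diagramFrom-swapAt (suc a) i (x ∷ u) (s≤s p) lt = begin
  map (suc i ,_) (filter (_<? x) (swapAt (suc a) u)) ++ diagramFrom (suc (suc i)) (swapAt (suc a) u)
    ↭⟨ ↭.++⁺ (↭.map⁺ _ (↭.filter-↭ (_<? x) (swapAt-↭ (suc a) u))) (diagramFrom-swapAt a (suc i) u p lt) ⟩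
  F ++ (a + suc (suc i) , v) ∷ map (τrow (a + suc (suc i))) D
    ≡⟨ cong (λ k → F ++ (k , v) ∷ map (τrow k) D) (+-suc a (suc i)) ⟩
  F ++ (k′ , v) ∷ map (τrow k′) D
    ↭⟨ ↭.shift (k′ , v) F _ ⟩
  (k′ , v) ∷ F ++ map (τrow k′) D
    ≡⟨ cong (λ l → (k′ , v) ∷ l ++ map (τrow k′) D) (map-τrow-fixed k′ F fixed) ⟨
  (k′ , v) ∷ map (τrow k′) F ++ map (τrow k′) D
    ≡⟨ cong ((k′ , v) ∷_) (map-++ (τrow k′) F D) ⟨
  (k′ , v) ∷ map (τrow k′) (F ++ D) ∎
  where
  open PermutationReasoning
  F D : List Cell
  F = map (suc i ,_) (filter (_<? x) u)
  D = diagramFrom (suc (suc i)) u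
  k′ v : ℕ
  k′ = suc a + suc i
  v = val u (suc a)
  fixed : ∀ {r c} → (r , c) ∈ F → r ≢ k′ × r ≢ suc k′
  fixed h with ∈-map⁻ _ h
  ... | y , _ , refl = <⇒≢ (s≤s (m≤n+m (suc i) a)) , <⇒≢ (s≤s (m≤n⇒m≤1+n (m≤n+m (suc i) a)))

diagram-swapAt : ∀ a u → 1 ≤ a → a < length u → val u a < val u (suc a) →
  diagram (swapAt a u) ↭ (a , val u a) ∷ map (τrow a) (diagram u)
diagram-swapAt (suc a) u _ p lt =
  subst (λ k → diagram (swapAt (suc a) u) ↭ (k , val u (suc a)) ∷ map (τrow k) (diagram u))
        (+-comm a 1) (diagramFrom-swapAt a 0 u p lt)

invs-swapAt : ∀ a u → 1 ≤ a → a < length u → val u a < val u (suc a) → invs (swapAt a u) ≡ suc (invs u)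
invs-swapAt a u 1≤a a< lt = begin
  invs (swapAt a u)                        ≡⟨ length-diagramFrom 1 (swapAt a u) ⟨
  length (diagram (swapAt a u))            ≡⟨ ↭-length (diagram-swapAt a u 1≤a a< lt) ⟩
  suc (length (map (τrow a) (diagram u)))  ≡⟨ cong suc (length-map (τrow a) (diagram u)) ⟩
  suc (length (diagram u))                 ≡⟨ cong suc (length-diagramFrom 1 u) ⟩
  suc (invs u)                             ∎
  where open ≡-Reasoning

-- Reduced words

length-range1 : ∀ n → length (range1 n) ≡ n
length-range1 n = trans (length-map suc (upTo n)) (length-upTo n)

Unique-range1 : ∀ n → Unique (range1 n)
Unique-range1 n = Unique.map⁺ suc-injective (Unique.upTo⁺ n)

invs-increasing : ∀ (f : ℕ → ℕ) n → (∀ i → f i < f (suc i)) → invs (applyUpTo f n) ≡ 0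
invs-increasing f zero    mono = refl
invs-increasing f (suc n) mono = cong₂ _+_ none (invs-increasing (f ∘ suc) n (mono ∘ suc))
  where
  above : ∀ i → f 0 < f (suc i)
  above zero    = mono 0
  above (suc i) = <-trans (above i) (mono (suc i))
  none : length (filter (_<? f 0) (applyUpTo (f ∘ suc) n)) ≡ 0
  none = cong length (filter-none (_<? f 0) {xs = applyUpTo (f ∘ suc) n} (All.tabulate λ {z} z∈ →
    let (i , _ , e) = ∈-applyUpTo⁻ (f ∘ suc) z∈ in <⇒≯ (subst (f 0 <_) (sym e) (above i))))

invs-range1 : ∀ n → invs (range1 n) ≡ 0
invs-range1 n = trans (cong invs (map-upTo suc n)) (invs-increasing suc n (λ i → n<1+n (suc i)))

evalWord-↭ : ∀ n ρ → evalWord n ρ ↭ range1 n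
evalWord-↭ n []      = ↭-refl
evalWord-↭ n (a ∷ ρ) = ↭-trans (swapAt-↭ a (evalWord n ρ)) (evalWord-↭ n ρ)

length-evalWord : ∀ n ρ → length (evalWord n ρ) ≡ n
length-evalWord n ρ = trans (↭-length (evalWord-↭ n ρ)) (length-range1 n)

Unique-evalWord : ∀ n ρ → Unique (evalWord n ρ)
Unique-evalWord n ρ = Unique-↭ (↭-sym (evalWord-↭ n ρ)) (Unique-range1 n)

-- Reducedness letter by letter: each letter acts on an ascent. This form carries the ascent that
-- every induction on words needs; it is equivalent to `IsReduced` by `IsReduced⇒Red` and
-- `Red⇒IsReduced`.
data Red (n : ℕ) : List ℕ → Set where
  []   : Red n []
  cons : ∀ {a σ} → 1 ≤ a → a < n → val (evalWord n σ) a < val (evalWord n σ) (suc a) →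
         Red n σ → Red n (a ∷ σ)

module _ {n : ℕ} where

  private
    inRange : ∀ σ {a} → a < n → a < length (evalWord n σ)
    inRange σ a<n = subst (_ <_) (sym (length-evalWord n σ)) a<n

  val-evalWord : ∀ a σ i → 1 ≤ a → a < n → val (evalWord n (a ∷ σ)) i ≡ val (evalWord n σ) (τ a i)
  val-evalWord a σ i 1≤a a<n = val-swapAt a (evalWord n σ) i 1≤a (inRange σ a<n)

  val-evalWord-injective : ∀ σ {i j} → 1 ≤ i → i ≤ n → 1 ≤ j → j ≤ n →
    val (evalWord n σ) i ≡ val (evalWord n σ) j → i ≡ j
  val-evalWord-injective σ p q r s =
    val-injective (Unique-evalWord n σ) p (subst (_ ≤_) (sym (length-evalWord n σ)) q)
                                        r (subst (_ ≤_) (sym (length-evalWord n σ)) s)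

  invs-ascent : ∀ {a} σ → 1 ≤ a → a < n → val (evalWord n σ) a < val (evalWord n σ) (suc a) →
    invs (evalWord n (a ∷ σ)) ≡ suc (invs (evalWord n σ))
  invs-ascent σ 1≤a a<n lt = invs-swapAt _ (evalWord n σ) 1≤a (inRange σ a<n) lt

  invs-descent : ∀ {a} σ → 1 ≤ a → a < n → val (evalWord n σ) (suc a) < val (evalWord n σ) a →
    invs (evalWord n σ) ≡ suc (invs (evalWord n (a ∷ σ)))
  invs-descent {a} σ 1≤a a<n gt =
    trans (cong invs (sym (swapAt-involutive a (evalWord n σ))))
      (invs-swapAt a (evalWord n (a ∷ σ)) 1≤a (inRange (a ∷ σ) a<n)
        (≡.subst₂ _<_ (sym (trans (val-evalWord a σ a 1≤a a<n) (cong (val (evalWord n σ)) (τ-left a))))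
                      (sym (trans (val-evalWord a σ (suc a) 1≤a a<n) (cong (val (evalWord n σ)) (τ-right a)))) gt))

  ascent-or-descent : ∀ {a} σ → 1 ≤ a → a < n →
    val (evalWord n σ) a < val (evalWord n σ) (suc a) ⊎ val (evalWord n σ) (suc a) < val (evalWord n σ) a
  ascent-or-descent {a} σ 1≤a a<n with <-cmp (val (evalWord n σ) a) (val (evalWord n σ) (suc a))
  ... | tri< lt _ _ = inj₁ lt
  ... | tri≈ _ eq _ = ⊥-elim (1+n≢n (sym (val-evalWord-injective σ 1≤a (<⇒≤ a<n) (s≤s z≤n) a<n eq)))
  ... | tri> _ _ gt = inj₂ gt

  invs≤length : ∀ ρ → All (λ a → 1 ≤ a × a < n) ρ → invs (evalWord n ρ) ≤ length ρ
  invs≤length [] _ = ≤-reflexive (invs-range1 n)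
  invs≤length (a ∷ σ) ((1≤a , a<n) ∷ al) with ascent-or-descent σ 1≤a a<n
  ... | inj₁ lt = ≤-trans (≤-reflexive (invs-ascent σ 1≤a a<n lt)) (s≤s (invs≤length σ al))
  ... | inj₂ gt = ≤-trans (n≤1+n _) (≤-trans (≤-reflexive (sym (invs-descent σ 1≤a a<n gt)))
                                             (m≤n⇒m≤1+n (invs≤length σ al)))

  -- A letter at a descent lengthens the word but lowers the inversion number, a loss of two that
  -- `invs≤length` does not allow to be recovered.
  length≤invs⇒Red : ∀ ρ → All (λ a → 1 ≤ a × a < n) ρ → length ρ ≤ invs (evalWord n ρ) → Red n ρ
  length≤invs⇒Red [] _ _ = []
  length≤invs⇒Red (a ∷ σ) ((1≤a , a<n) ∷ al) h with ascent-or-descent σ 1≤a a<n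
  ... | inj₁ lt = cons 1≤a a<n lt
    (length≤invs⇒Red σ al (s≤s⁻¹ (≤-trans h (≤-reflexive (invs-ascent σ 1≤a a<n lt)))))
  ... | inj₂ gt = ⊥-elim (<⇒≱ (n<1+n (length σ))
    (≤-trans h (≤-trans (n≤1+n _) (≤-trans (≤-reflexive (sym (invs-descent σ 1≤a a<n gt))) (invs≤length σ al)))))

  IsReduced⇒Red : ∀ {w ρ} → IsReduced n w ρ → Red n ρ
  IsReduced⇒Red {w} {ρ} (al , len , refl) = length≤invs⇒Red ρ al (≤-reflexive len)

  Red⇒IsReduced : ∀ {ρ} → Red n ρ → IsReduced n (evalWord n ρ) ρ
  Red⇒IsReduced [] = [] , sym (invs-range1 n) , refl
  Red⇒IsReduced {a ∷ σ} (cons 1≤a a<n lt r) with Red⇒IsReduced r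
  ... | al , len , _ = (1≤a , a<n) ∷ al , trans (cong suc len) (sym (invs-ascent σ 1≤a a<n lt)) , refl

-- Balanced fillings

above⁻ : ∀ x p → T (aboveᵇ x p) → col p ≡ col x × row x < row p
above⁻ x p t with Equivalence.to T-∧ t
... | s , l = ≡ᵇ⇒≡ _ _ s , <ᵇ⇒< _ _ l

above⁺ : ∀ x p → col p ≡ col x → row x < row p → T (aboveᵇ x p)
above⁺ x p e l = Equivalence.from T-∧ (≡⇒≡ᵇ _ _ e , <⇒<ᵇ l)

right⁻ : ∀ x q → T (rightᵇ x q) → row q ≡ row x × col x < col q
right⁻ x q t with Equivalence.to T-∧ t
... | s , l = ≡ᵇ⇒≡ _ _ s , <ᵇ⇒< _ _ l

right⁺ : ∀ x q → row q ≡ row x → col x < col q → T (rightᵇ x q)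
right⁺ x q e l = Equivalence.from T-∧ (≡⇒≡ᵇ _ _ e , <⇒<ᵇ l)

rightᵇ-τrow : ∀ a z q → rightᵇ (τrow a z) (τrow a q) ≡ rightᵇ z q
rightᵇ-τrow a z q = bool-ext
  (λ t → let (e , l) = right⁻ (τrow a z) (τrow a q) t in right⁺ z q (τ-injective a e) l)
  (λ t → let (e , l) = right⁻ z q t in right⁺ (τrow a z) (τrow a q) (cong (τ a) e) l)

_≟ᶜ_ : (z z′ : Cell) → Dec (z ≡ z′)
_≟ᶜ_ = ≡-dec _≟_ _≟_

open DecMembership _≟ᶜ_ using (_∈?_)

-- Fillings are listed here from the largest entry to the smallest.
Bal : List Cell → Set
Bal Z = ∀ B z A → Z ≡ B ++ z ∷ A → count (rightᵇ z) B ≡ count (aboveᵇ z) A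

-- The hypotheses are all that is used of the shape of the diagram at an ascent with smaller value
-- `x`: row `a` is row `suc a` cut off at column `x`, and column `x` lives strictly below row `a`.
module AddEntry (a x : ℕ) (Z : List Cell) (unique : Unique Z)
  (row-a   : ∀ {c} → (a , c) ∈ Z → c < x × (suc a , c) ∈ Z)
  (row-a+1 : ∀ {c} → (suc a , c) ∈ Z → c < x → (a , c) ∈ Z)
  (col-x   : ∀ {r} → (r , x) ∈ Z → r < a) where

  Z⁺ : List Cell
  Z⁺ = (a , x) ∷ map (τrow a) Z

  private
    low high : ℕ → Cell
    low  c = (a , c)
    high c = (suc a , c)

  -- The cells that come to lie left of the new cell `(a , x)` in its row. They are exactly the
  -- cells whose two counts in the balance condition grow, each by one.
  gainᵇ : Cell → Bool
  gainᵇ z = (row z ≡ᵇ suc a) ∧ (col z <ᵇ x)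

  private
    gain : Cell → ℕ
    gain z = indicator (gainᵇ z)

  -- Lists run from the largest entry down, so the split describes a column in which the entry of
  -- row `a` exceeds that of row `suc a`, and `B` holds the entries larger than both. The inequality
  -- is isolated because it follows from `Bal Z` and from `Bal Z⁺`.
  Crossing< : Set
  Crossing< = ∀ c B M A → Z ≡ B ++ low c ∷ M ++ high c ∷ A →
    count (rightᵇ (high c)) B < count (rightᵇ (low c)) B

  -- "Before" refers to the order in which entries are created: `high c` does not come later in the
  -- decreasing list, so its entry is the larger one.
  LowBeforeHigh : Set
  LowBeforeHigh = ∀ c B A → Z ≡ B ++ low c ∷ A → high c ∉ A

  private
    up-injective : ∀ {z z′} → row z ≡ a → row z′ ≡ a → high (col z) ≡ high (col z′) → z ≡ z′
    up-injective refl refl refl = refl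

    Unique-up : ∀ {c L} → Unique L → All (λ z → T (rightᵇ (low c) z)) L → Unique (map (high ∘ col) L)
    Unique-up [] [] = []
    Unique-up {c} {z ∷ L} (p ∷ un) (t ∷ ts) = All.tabulate fresh ∷ Unique-up un ts
      where
      fresh : ∀ {z′} → z′ ∈ map (high ∘ col) L → high (col z) ≢ z′
      fresh z′∈ e with ∈-map⁻ (high ∘ col) z′∈
      ... | v , v∈ , refl = All.lookup p v∈
        (up-injective (proj₁ (right⁻ (low c) z t)) (proj₁ (right⁻ (low c) v (All.lookup ts v∈))) e)

    -- Raising the cells of `B` to the right of `low c` by one row is injective. If all raised cells
    -- were in `B`, they would be counted to the right of `high c`, against the strict inequality.
    pigeonhole : ∀ c B → Unique B → count (rightᵇ (high c)) B < count (rightᵇ (low c)) B →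
      ∃ λ c′ → low c′ ∈ B × high c′ ∉ B
    pigeonhole c B un lt with any? (λ z → ¬? (high (col z) ∈? B)) (filterᵇ (rightᵇ (low c)) B)
    ... | yes found with find found
    ...   | z , z∈ , ∉B with ∈-filter⁻ (T? ∘ rightᵇ (low c)) {xs = B} z∈
    ...     | z∈B , t with proj₁ (right⁻ (low c) z t)
    ...       | refl = col z , z∈B , ∉B
    pigeonhole c B un lt | no none = ⊥-elim (<⇒≱ lt (begin
      count (rightᵇ (low c)) B                          ≡⟨ count≡length-filterᵇ (rightᵇ (low c)) B ⟨
      length (filterᵇ (rightᵇ (low c)) B)               ≡⟨ length-map (high ∘ col) (filterᵇ (rightᵇ (low c)) B) ⟨
      length (map (high ∘ col) (filterᵇ (rightᵇ (low c)) B))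
        ≤⟨ Unique-⊆-length (Unique-up (Unique.filter⁺ (T? ∘ rightᵇ (low c)) un) (all-filter (T? ∘ rightᵇ (low c)) B)) sub ⟩
      length (filterᵇ (rightᵇ (high c)) B)              ≡⟨ count≡length-filterᵇ (rightᵇ (high c)) B ⟩
      count (rightᵇ (high c)) B                         ∎))
      where
      open ≤-Reasoning
      sub : ∀ {z} → z ∈ map (high ∘ col) (filterᵇ (rightᵇ (low c)) B) → z ∈ filterᵇ (rightᵇ (high c)) B
      sub z∈ with ∈-map⁻ (high ∘ col) z∈
      ... | v , v∈ , refl with ∈-filter⁻ (T? ∘ rightᵇ (low c)) {xs = B} v∈ | high (col v) ∈? B
      ...   | _ , t | yes h = ∈-filter⁺ (T? ∘ rightᵇ (high c)) h
                                (right⁺ (high c) (high (col v)) refl (proj₂ (right⁻ (low c) v t)))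
      ...   | _     | no ¬h = ⊥-elim (none (lose v∈ ¬h))

  -- A crossing at c forces, by pigeonhole, a crossing with a larger lower entry.
  Crossing<⇒LowBeforeHigh : Crossing< → LowBeforeHigh
  Crossing<⇒LowBeforeHigh ineq c B = go c B (<-wellFounded (length B))
    where
    go : ∀ c B → Acc _<_ (length B) → ∀ A → Z ≡ B ++ low c ∷ A → high c ∉ A
    go c B (acc rs) A eq h∈A with ∈-∃++ h∈A
    ... | M , A′ , refl with pigeonhole c B (Unique-++⁻ˡ B (subst Unique eq unique)) (ineq c B M A′ eq)
    ...   | c′ , low∈B , high∉B with ∈-∃++ low∈B
    ...     | B₁ , B₂ , refl = go c′ B₁ (rs shorter) (B₂ ++ low c ∷ A) eq′ high∈
      where
      shorter : length B₁ < length (B₁ ++ low c′ ∷ B₂)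
      shorter = subst (length B₁ <_) (sym (length-++ B₁)) (m<m+n (length B₁) (s≤s z≤n))
      eq′ : Z ≡ B₁ ++ low c′ ∷ (B₂ ++ low c ∷ A)
      eq′ = trans eq (++-assoc B₁ (low c′ ∷ B₂) (low c ∷ A))
      high∈ : high c′ ∈ B₂ ++ low c ∷ A
      high∈ with ∈-++⁻ B (subst (high c′ ∈_) eq
                   (proj₂ (row-a (subst (low c′ ∈_) (sym eq) (∈-++⁺ˡ low∈B)))))
      ... | inj₁ h = ⊥-elim (high∉B h)
      ... | inj₂ h = ∈-++⁺ʳ B₂ h

  -- Balance at both cells turns right counts into above counts. Whatever is smaller and above
  -- `high c` is also smaller and above `low c`, and `high c` itself is one more such cell.
  Bal⇒Crossing< : Bal Z → Crossing<
  Bal⇒Crossing< bal c B M A eq = begin-strict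
    count (rightᵇ (high c)) B
      ≤⟨ m≤m+n _ _ ⟩
    count (rightᵇ (high c)) B + count (rightᵇ (high c)) (low c ∷ M)
      ≡⟨ count-++ (rightᵇ (high c)) B (low c ∷ M) ⟨
    count (rightᵇ (high c)) (B ++ low c ∷ M)
      ≡⟨ bal (B ++ low c ∷ M) (high c) A (trans eq (sym (++-assoc B (low c ∷ M) (high c ∷ A)))) ⟩
    count (aboveᵇ (high c)) A
      ≤⟨ count-mono A (λ {p} _ t → let (e , l) = above⁻ (high c) p t in above⁺ (low c) p e (<⇒≤ l)) ⟩
    count (aboveᵇ (low c)) A
      <⟨ n<1+n _ ⟩
    1 + count (aboveᵇ (low c)) A
      ≡⟨ cong (λ b → indicator b + count (aboveᵇ (low c)) A) (T⇒true (above⁺ (low c) (high c) refl (n<1+n a))) ⟨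
    count (aboveᵇ (low c)) (high c ∷ A)
      ≤⟨ m≤n+m _ (count (aboveᵇ (low c)) M) ⟩
    count (aboveᵇ (low c)) M + count (aboveᵇ (low c)) (high c ∷ A)
      ≡⟨ count-++ (aboveᵇ (low c)) M (high c ∷ A) ⟨
    count (aboveᵇ (low c)) (M ++ high c ∷ A)
      ≡⟨ bal B (low c) (M ++ high c ∷ A) eq ⟨
    count (rightᵇ (low c)) B ∎
    where open ≤-Reasoning

  private
    split⁺ : ∀ {B z A} → Z ≡ B ++ z ∷ A → Z⁺ ≡ ((a , x) ∷ map (τrow a) B) ++ τrow a z ∷ map (τrow a) A
    split⁺ {B} {z} {A} eq = cong ((a , x) ∷_) (trans (cong (map (τrow a)) eq) (map-++ (τrow a) B (z ∷ A)))

    right-Z⁺ : ∀ z B → count (rightᵇ (τrow a z)) ((a , x) ∷ map (τrow a) B) ≡ gain z + count (rightᵇ z) B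
    right-Z⁺ z B = cong₂ (λ b k → indicator (b ∧ (col z <ᵇ x)) + k)
      (bool-ext (λ t → ≡⇒≡ᵇ _ _ (trans (sym (τ-involutive a (row z))) (trans (cong (τ a) (sym (≡ᵇ⇒≡ a _ t))) (τ-left a))))
                (λ t → ≡⇒≡ᵇ a _ (sym (trans (cong (τ a) (≡ᵇ⇒≡ _ _ t)) (τ-right a)))))
      (trans (count-map (rightᵇ (τrow a z)) (τrow a) B) (count-cong B (λ {q} _ → rightᵇ-τrow a z q)))

  -- After the exchange `low c` is the upper cell. It is the only cell that could be above the
  -- lowered `high c` without being above the raised `low c`, and its entry is too large to be
  -- counted. Strictness now comes from the new cell `(a , x)`, which is to the right of the lowered
  -- cell only.
  Bal⁺⇒Crossing< : Bal Z⁺ → Crossing<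
  Bal⁺⇒Crossing< bal c B M A eq = begin-strict
    count (rightᵇ (high c)) B
      <⟨ n<1+n _ ⟩
    1 + count (rightᵇ (high c)) B
      ≤⟨ s≤s (m≤m+n _ _) ⟩
    1 + (count (rightᵇ (high c)) B + count (rightᵇ (high c)) (low c ∷ M))
      ≡⟨ cong suc (count-++ (rightᵇ (high c)) B (low c ∷ M)) ⟨
    1 + count (rightᵇ (high c)) (B ++ low c ∷ M)
      ≡⟨ cong (λ b → indicator b + count (rightᵇ (high c)) (B ++ low c ∷ M)) gain≡1 ⟨
    gain (high c) + count (rightᵇ (high c)) (B ++ low c ∷ M)
      ≡⟨ right-Z⁺ (high c) (B ++ low c ∷ M) ⟨
    count (rightᵇ (τrow a (high c))) ((a , x) ∷ map (τrow a) (B ++ low c ∷ M))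
      ≡⟨ bal _ (τrow a (high c)) (map (τrow a) A) (split⁺ (trans eq (sym (++-assoc B (low c ∷ M) (high c ∷ A))))) ⟩
    count (aboveᵇ (τrow a (high c))) (map (τrow a) A)
      ≤⟨ count-mono (map (τrow a) A) drop-low ⟩
    count (aboveᵇ (τrow a (low c))) (map (τrow a) A)
      ≤⟨ m≤n+m _ _ ⟩
    count (aboveᵇ (τrow a (low c))) (map (τrow a) (high c ∷ A))
      ≤⟨ m≤n+m _ (count (aboveᵇ (τrow a (low c))) (map (τrow a) M)) ⟩
    count (aboveᵇ (τrow a (low c))) (map (τrow a) M) + count (aboveᵇ (τrow a (low c))) (map (τrow a) (high c ∷ A))
      ≡⟨ count-++ (aboveᵇ (τrow a (low c))) (map (τrow a) M) _ ⟨
    count (aboveᵇ (τrow a (low c))) (map (τrow a) M ++ map (τrow a) (high c ∷ A))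
      ≡⟨ cong (count (aboveᵇ (τrow a (low c)))) (map-++ (τrow a) M (high c ∷ A)) ⟨
    count (aboveᵇ (τrow a (low c))) (map (τrow a) (M ++ high c ∷ A))
      ≡⟨ bal _ (τrow a (low c)) _ (split⁺ eq) ⟨
    count (rightᵇ (τrow a (low c))) ((a , x) ∷ map (τrow a) B)
      ≡⟨ right-Z⁺ (low c) B ⟩
    gain (low c) + count (rightᵇ (low c)) B
      ≡⟨ cong (λ b → indicator (b ∧ (c <ᵇ x)) + count (rightᵇ (low c)) B) (≢⇒≡ᵇ {a} {suc a} (λ e → 1+n≢n (sym e))) ⟩
    count (rightᵇ (low c)) B ∎
    where
    open ≤-Reasoning
    low∈ : low c ∈ Z
    low∈ = subst (low c ∈_) (sym eq) (∈-++⁺ʳ B (here refl))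
    gain≡1 : (suc a ≡ᵇ suc a) ∧ (c <ᵇ x) ≡ true
    gain≡1 = trans (cong (_∧ (c <ᵇ x)) (≡ᵇ-refl (suc a))) (T⇒true (<⇒<ᵇ (proj₁ (row-a low∈))))
    low∉A : low c ∉ A
    low∉A h = Unique-disjoint (B ++ low c ∷ []) (subst Unique (trans eq (sym (++-assoc B (low c ∷ []) _))) unique)
      (∈-++⁺ʳ B (here refl)) (∈-++⁺ʳ M (there h))
    drop-low : ∀ {p} → p ∈ map (τrow a) A → T (aboveᵇ (τrow a (high c)) p) → T (aboveᵇ (τrow a (low c)) p)
    drop-low {p} p∈ t with above⁻ (τrow a (high c)) p t
    ... | refl , l = above⁺ (τrow a (low c)) p refl
      (subst (_< row p) (sym (τ-left a)) (≤∧≢⇒< (subst (_< row p) (τ-right a) l) ne))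
      where
      ne : suc a ≢ row p
      ne refl with ∈-map⁻ (τrow a) p∈
      ... | q , q∈ , e = low∉A (subst (_∈ A) (trans (sym (τrow-involutive a q)) (trans (cong (τrow a) (sym e)) (cong (_, c) (τ-right a)))) q∈)

  module _ (ordered : LowBeforeHigh) where

    -- A cell of row `a` rises past the cell of row `suc a` in its column, which was not counted
    -- since `ordered` makes its entry larger. A cell of row `suc a` descends past the cell of row
    -- `a`, which exists exactly when its column is left of `x` and is then smaller by `ordered`.
    -- Any other row has rows `a` and `suc a` on the same side.
    above-Z⁺ : ∀ B z A → Z ≡ B ++ z ∷ A →
      count (aboveᵇ (τrow a z)) (map (τrow a) A) ≡ gain z + count (aboveᵇ z) A
    above-Z⁺ B (r , c) A eq = trans (count-map (aboveᵇ (τrow a (r , c))) (τrow a) A) (cases (tauView a r))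
      where
      ∈Z : ∀ {p} → p ∈ A → p ∈ Z
      ∈Z p∈ = subst (_ ∈_) (sym eq) (∈-++⁺ʳ B (there p∈))
      z∈Z : (r , c) ∈ Z
      z∈Z = subst (_ ∈_) (sym eq) (∈-++⁺ʳ B (here refl))
      cases : TauView a r → count (aboveᵇ (τrow a (r , c)) ∘ τrow a) A ≡ gain (r , c) + count (aboveᵇ (r , c)) A
      cases isL = trans (count-cong A λ { {r′ , c′} p∈ → bool-ext
            (λ t → let (e , l) = above⁻ (τrow a (a , c)) (τ a r′ , c′) t in
                   above⁺ (a , c) (r′ , c′) e (to r′ (subst (_< τ a r′) (τ-left a) l)))
            (λ t → let (e , l) = above⁻ (a , c) (r′ , c′) t in
                   above⁺ (τrow a (a , c)) (τ a r′ , c′) e (subst (_< τ a r′) (sym (τ-left a)) (from r′ l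
                     λ { refl → ordered c B A eq (subst (λ k → (suc a , k) ∈ A) e p∈) }))) })
          (cong (λ b → indicator (b ∧ (c <ᵇ x)) + count (aboveᵇ (a , c)) A) (sym (≢⇒≡ᵇ {a} {suc a} (λ e → 1+n≢n (sym e)))))
        where
        to : ∀ r′ → suc a < τ a r′ → a < r′
        to r′ l with tauView a r′
        ... | isL = ⊥-elim (<-irrefl (sym (τ-left a)) l)
        ... | isR = n<1+n a
        ... | isO p q = <-trans (n<1+n a) (subst (suc a <_) (τ-other a r′ p q) l)
        from : ∀ r′ → a < r′ → r′ ≢ suc a → suc a < τ a r′
        from r′ l ne = subst (suc a <_) (sym (τ-other a r′ (λ { refl → <-irrefl refl l }) ne)) (≤∧≢⇒< l (ne ∘ sym))
      cases isR = trans (count-+ A pointwise) (cong (_+ count (aboveᵇ (suc a , c)) A) hits)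
        where
        is-low : Cell → Bool
        is-low q = (row q ≡ᵇ a) ∧ (col q ≡ᵇ c)
        is-low⁻ : ∀ q → T (is-low q) → q ≡ (a , c)
        is-low⁻ (r′ , c′) t = let (p , q) = Equivalence.to T-∧ t in cong₂ _,_ (≡ᵇ⇒≡ r′ a p) (≡ᵇ⇒≡ c′ c q)
        rows : ∀ r′ → indicator (τ a (suc a) <ᵇ τ a r′) ≡ indicator (r′ ≡ᵇ a) + indicator (suc a <ᵇ r′)
        rows r′ rewrite τ-right a with tauView a r′
        ... | isL rewrite τ-left a | ≡ᵇ-refl a | T⇒true (<⇒<ᵇ (n<1+n a)) | ¬T⇒false (λ t → <⇒≱ (<ᵇ⇒< (suc a) a t) (n≤1+n a)) = refl
        ... | isR rewrite τ-right a | ≢⇒≡ᵇ (1+n≢n {a}) | ¬T⇒false (λ t → <-irrefl refl (<ᵇ⇒< a a t)) = refl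
        ... | isO p q rewrite τ-other a r′ p q | ≢⇒≡ᵇ p = cong indicator (bool-ext
              (λ t → <⇒<ᵇ (≤∧≢⇒< (<ᵇ⇒< a r′ t) (q ∘ sym))) (λ t → <⇒<ᵇ (<⇒≤ (<ᵇ⇒< (suc a) r′ t))))
        pointwise : ∀ {q} → q ∈ A → indicator (aboveᵇ (τrow a (suc a , c)) (τrow a q)) ≡
                      indicator (is-low q) + indicator (aboveᵇ (suc a , c) q)
        pointwise {r′ , c′} _ with c′ ≡ᵇ c
        ... | true  with r′ ≡ᵇ a | rows r′
        ...   | true  | e = e
        ...   | false | e = e
        pointwise {r′ , c′} _ | false with r′ ≡ᵇ a
        ...   | true  = refl
        ...   | false = refl
        hits : count is-low A ≡ gain (suc a , c)
        hits rewrite ≡ᵇ-refl a with c <? x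
        ... | yes c<x rewrite T⇒true (<⇒<ᵇ c<x) = count-unique is-low
                (Unique-++⁻ʳ (B ++ (suc a , c) ∷ []) (subst Unique (trans eq (sym (++-assoc B _ A))) unique))
                low∈A (Equivalence.from T-∧ (≡⇒≡ᵇ a a refl , ≡⇒≡ᵇ c c refl)) (λ {q} _ → is-low⁻ q)
          where
          low∈A : (a , c) ∈ A
          low∈A with ∈-++⁻ B (subst ((a , c) ∈_) eq (row-a+1 z∈Z c<x))
          ... | inj₂ (here e) = ⊥-elim (1+n≢n (sym (cong row e)))
          ... | inj₂ (there h) = h
          ... | inj₁ h with ∈-∃++ h
          ...   | B₁ , B₂ , refl = ⊥-elim (ordered c B₁ (B₂ ++ (suc a , c) ∷ A)
                    (trans eq (++-assoc B₁ ((a , c) ∷ B₂) _)) (∈-++⁺ʳ B₂ (here refl)))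
        ... | no c≮x rewrite ¬T⇒false (c≮x ∘ <ᵇ⇒< c x) = count-none is-low A λ {q} q∈ t →
                c≮x (proj₁ (row-a (subst (_∈ Z) (is-low⁻ q t) (∈Z q∈))))
      cases (isO p q) rewrite τ-other a r p q | ≢⇒≡ᵇ q = count-cong A λ { {r′ , c′} _ → cong ((c′ ≡ᵇ c) ∧_) (rows r′) }
        where
        rows : ∀ r′ → (r <ᵇ τ a r′) ≡ (r <ᵇ r′)
        rows r′ with tauView a r′
        ... | isL rewrite τ-left a = bool-ext (λ t → <⇒<ᵇ (≤∧≢⇒< (s≤s⁻¹ (<ᵇ⇒< r (suc a) t)) p)) (λ t → <⇒<ᵇ (m<n⇒m<1+n (<ᵇ⇒< r a t)))
        ... | isR rewrite τ-right a = bool-ext (λ t → <⇒<ᵇ (m<n⇒m<1+n (<ᵇ⇒< r a t))) (λ t → <⇒<ᵇ (≤∧≢⇒< (s≤s⁻¹ (<ᵇ⇒< r (suc a) t)) p))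
        ... | isO p′ q′ rewrite τ-other a r′ p′ q′ = refl

  above-new : count (aboveᵇ (a , x)) (map (τrow a) Z) ≡ 0
  above-new = count-none (aboveᵇ (a , x)) (map (τrow a) Z) λ {p} p∈ t → none p p∈ (above⁻ (a , x) p t)
    where
    none : ∀ p → p ∈ map (τrow a) Z → ¬ (col p ≡ x × a < row p)
    none p p∈ (refl , l) with ∈-map⁻ (τrow a) p∈
    ... | (r , _) , q∈ , refl = <⇒≯ r<a (subst (a <_) (τ-other a r (<⇒≢ r<a) (<⇒≢ (m<n⇒m<1+n r<a))) l)
      where
      r<a : r < a
      r<a = col-x q∈

  Bal-step : Bal Z → Bal Z⁺
  Bal-step bal [] .(a , x) ._ refl = sym above-new
  Bal-step bal (b ∷ B) z A eq with ∷-injective eq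
  ... | refl , eq′ = begin
    count (rightᵇ z) ((a , x) ∷ B)
      ≡⟨ cong₂ (λ z B → count (rightᵇ z) ((a , x) ∷ B)) (τrow-involutive a z) (map-τrow-involutive a B) ⟨
    count (rightᵇ (τrow a (τrow a z))) ((a , x) ∷ map (τrow a) (map (τrow a) B))
      ≡⟨ right-Z⁺ (τrow a z) (map (τrow a) B) ⟩
    gain (τrow a z) + count (rightᵇ (τrow a z)) (map (τrow a) B)
      ≡⟨ cong (gain (τrow a z) +_) (bal _ _ _ Z≡) ⟩
    gain (τrow a z) + count (aboveᵇ (τrow a z)) (map (τrow a) A)
      ≡⟨ above-Z⁺ (Crossing<⇒LowBeforeHigh (Bal⇒Crossing< bal)) _ _ _ Z≡ ⟨
    count (aboveᵇ (τrow a (τrow a z))) (map (τrow a) (map (τrow a) A))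
      ≡⟨ cong₂ (λ z A → count (aboveᵇ z) A) (τrow-involutive a z) (map-τrow-involutive a A) ⟩
    count (aboveᵇ z) A ∎
    where
    open ≡-Reasoning
    Z≡ : Z ≡ map (τrow a) B ++ τrow a z ∷ map (τrow a) A
    Z≡ = trans (sym (map-τrow-involutive a Z)) (trans (cong (map (τrow a)) eq′) (map-++ (τrow a) B (z ∷ A)))

  Bal-step⁻¹ : Bal Z⁺ → Bal Z
  Bal-step⁻¹ bal B z A eq = +-cancelˡ-≡ (gain z) _ _ (begin
    gain z + count (rightᵇ z) B                                  ≡⟨ right-Z⁺ z B ⟨
    count (rightᵇ (τrow a z)) ((a , x) ∷ map (τrow a) B)         ≡⟨ bal _ _ _ (split⁺ eq) ⟩
    count (aboveᵇ (τrow a z)) (map (τrow a) A)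
      ≡⟨ above-Z⁺ (Crossing<⇒LowBeforeHigh (Bal⁺⇒Crossing< bal)) B z A eq ⟩
    gain z + count (aboveᵇ z) A                                  ∎)
    where open ≡-Reasoning

-- The tableau of a reduced word

-- The filling listed from its largest entry to its smallest.  The letter a, applied last, creates
-- the inversion between the values in positions a and a + 1, and later letters move its row.
cellsOf : ℕ → List ℕ → List Cell
cellsOf n []      = []
cellsOf n (a ∷ σ) = (a , val (evalWord n σ) a) ∷ map (τrow a) (cellsOf n σ)

Φ : ℕ → List ℕ → List Cell
Φ n ρ = reverse (cellsOf n ρ)

length-cellsOf : ∀ n ρ → length (cellsOf n ρ) ≡ length ρ
length-cellsOf n []      = refl
length-cellsOf n (a ∷ σ) = cong suc (trans (length-map (τrow a) (cellsOf n σ)) (length-cellsOf n σ))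

length≡0⇒[] : ∀ {A : Set} (xs : List A) → length xs ≡ 0 → xs ≡ []
length≡0⇒[] [] _ = refl

diagram-range1 : ∀ n → diagram (range1 n) ≡ []
diagram-range1 n = length≡0⇒[] _ (trans (length-diagramFrom 1 (range1 n)) (invs-range1 n))

cellsOf-↭ : ∀ {n ρ} → Red n ρ → cellsOf n ρ ↭ diagram (evalWord n ρ)
cellsOf-↭ {n} [] = ↭-reflexive (sym (diagram-range1 n))
cellsOf-↭ {n} {a ∷ σ} (cons 1≤a a<n lt r) =
  ↭-trans (prep _ (↭.map⁺ (τrow a) (cellsOf-↭ r)))
          (↭-sym (diagram-swapAt a (evalWord n σ) 1≤a (subst (a <_) (sym (length-evalWord n σ)) a<n) lt))

-- Both rows consist of values standing after position `suc a`, cut at `val u a` and at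
-- `val u (suc a)`; the value in position `suc a` itself is too large for row `a`. This yields the
-- hypotheses of `AddEntry`.
module Ascent (a : ℕ) (u : List ℕ) (Z : List Cell) (un : Unique u) (1≤a : 1 ≤ a) (a< : a < length u)
  (lt : val u a < val u (suc a)) (Z↭ : Z ↭ diagram u) where

  private
    from : ∀ {r c} → (r , c) ∈ Z → 1 ≤ r × ∃ λ j → r < j × j ≤ length u × val u j ≡ c × c < val u r
    from z∈ = ∈-diagram⁻ u (∈-resp-↭ Z↭ z∈)

    to : ∀ {r j} → 1 ≤ r → r < j → j ≤ length u → val u j < val u r → (r , val u j) ∈ Z
    to p q r s = ∈-resp-↭ (↭-sym Z↭) (∈-diagram⁺ u p q r s)

    row-a : ∀ {c} → (a , c) ∈ Z → c < val u a × (suc a , c) ∈ Z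
    row-a z∈ with from z∈
    ... | _ , j , a<j , j≤ , refl , l =
      l , to (s≤s z≤n) (≤∧≢⇒< a<j λ { refl → <⇒≯ l lt }) j≤ (<-trans l lt)

    row-a+1 : ∀ {c} → (suc a , c) ∈ Z → c < val u a → (a , c) ∈ Z
    row-a+1 z∈ c< with from z∈
    ... | _ , j , a<j , j≤ , refl , _ = to 1≤a (<⇒≤ a<j) j≤ c<

    col-x : ∀ {r} → (r , val u a) ∈ Z → r < a
    col-x z∈ with from z∈
    ... | _ , j , r<j , j≤ , e , _ =
      subst (_ <_) (val-injective un (≤-trans (s≤s z≤n) r<j) j≤ 1≤a (<⇒≤ a<) e) r<j

  open AddEntry a (val u a) Z (Unique-↭ (↭-sym Z↭) (Unique-diagram u un)) row-a row-a+1 col-x public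

cellsOf-Bal : ∀ {n ρ} → Red n ρ → Bal (cellsOf n ρ)
cellsOf-Bal [] [] z A ()
cellsOf-Bal [] (b ∷ B) z A ()
cellsOf-Bal {n} {a ∷ σ} (cons 1≤a a<n lt r) = Bal-step (cellsOf-Bal r)
  where
  open Ascent a (evalWord n σ) (cellsOf n σ) (Unique-evalWord n σ) 1≤a
    (subst (a <_) (sym (length-evalWord n σ)) a<n) lt (cellsOf-↭ r)

-- If the largest entry were not at a descent of w, the value in position i + 1 would give either a
-- cell above it in its column, or an unbalanced cell to its left in its row.
largest-at-descent : ∀ {w i x Z} → Unique w → (i , x) ∷ Z ↭ diagram w → Bal ((i , x) ∷ Z) →
  1 ≤ i × i < length w × val w (suc i) ≡ x × x < val w i
largest-at-descent {w} {i} {x} {Z} un Z↭ bal with ∈-diagram⁻ w (∈-resp-↭ Z↭ (here refl))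
... | 1≤i , j , i<j , j≤ , refl , lt with m≤n⇒m<n∨m≡n i<j
...   | inj₂ refl = 1≤i , j≤ , refl , lt
...   | inj₁ i+1<j = ⊥-elim (absurd (<-cmp (val w (suc i)) (val w j)))
  where
  i+1≤ : suc i ≤ length w
  i+1≤ = ≤-trans (<⇒≤ i+1<j) j≤
  into : ∀ {z} → z ∈ diagram w → z ∈ (i , val w j) ∷ Z
  into = ∈-resp-↭ (↭-sym Z↭)
  absurd : Tri (val w (suc i) < val w j) (val w (suc i) ≡ val w j) (val w j < val w (suc i)) → ⊥
  absurd (tri≈ _ e _) = <⇒≢ i+1<j (val-injective un (s≤s z≤n) i+1≤ (≤-trans (s≤s z≤n) i<j) j≤ e)
  absurd (tri> _ _ gt) with into (∈-diagram⁺ w (s≤s z≤n) i+1<j j≤ gt)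
  ... | here e = 1+n≢n (cong row e)
  ... | there h = <⇒≢ (count-∈ (aboveᵇ (i , val w j)) h (above⁺ (i , val w j) (suc i , val w j) refl (n<1+n i)))
                      (bal [] (i , val w j) Z refl)
  absurd (tri< l _ _) with into (∈-diagram⁺ w 1≤i (n<1+n i) i+1≤ (<-trans l lt))
  ... | here e = <⇒≢ l (cong col e)
  ... | there h with ∈-∃++ h
  ...   | B , A , refl with count>0 (aboveᵇ (i , val w (suc i))) A
              (subst (1 ≤_) (bal ((i , val w j) ∷ B) (i , val w (suc i)) A refl)
                (count-∈ (rightᵇ (i , val w (suc i))) {xs = (i , val w j) ∷ B} (here refl)
                  (right⁺ (i , val w (suc i)) (i , val w j) refl l)))
  ...     | p , p∈ , t with above⁻ (i , val w (suc i)) p t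
  ...       | refl , i<r with ∈-diagram⁻ w (∈-resp-↭ Z↭ (there (∈-++⁺ʳ B (there p∈))))
  ...         | _ , j′ , r<j′ , j′≤ , e , _ =
    <⇒≱ (subst (_ <_) (val-injective un (≤-trans (s≤s z≤n) r<j′) j′≤ (s≤s z≤n) i+1≤ e) r<j′) i<r

invs≡0⇒Linked : ∀ u → invs u ≡ 0 → Linked _≤_ u
invs≡0⇒Linked [] _ = []
invs≡0⇒Linked (x ∷ []) _ = [-]
invs≡0⇒Linked (x ∷ y ∷ u) e = ≮⇒≥ (λ y<x → nonempty y<x (m+n≡0⇒m≡0 _ e)) ∷ invs≡0⇒Linked (y ∷ u) (m+n≡0⇒n≡0 (length (filter (_<? x) (y ∷ u))) e)
  where
  nonempty : y < x → length (filter (_<? x) (y ∷ u)) ≢ 0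
  nonempty y<x e′ with trans (sym (cong length (filter-accept (_<? x) {xs = u} y<x))) e′
  ... | ()

invs≡0⇒range1 : ∀ n u → IsPerm n u → invs u ≡ 0 → u ≡ range1 n
invs≡0⇒range1 n u u↭ e = Pointwise-≡⇒≡ (↗↭↗⇒≋ ≤-totalOrder
  (invs≡0⇒Linked u e) (invs≡0⇒Linked (range1 n) (invs-range1 n)) (↭⇒↭ₛ u↭))

-- The recursion runs on the number `k` of entries, because the remaining filling has its rows
-- exchanged and is no subterm of the given one.
cellsOf-surjective : ∀ n k w Z → length Z ≡ k → IsPerm n w → Z ↭ diagram w → Bal Z →
  ∃ λ ρ → Red n ρ × evalWord n ρ ≡ w × cellsOf n ρ ≡ Z
cellsOf-surjective n zero w [] _ pw Z↭ bal =
  [] , [] , sym (invs≡0⇒range1 n w pw (trans (sym (length-diagramFrom 1 w)) (sym (↭-length Z↭)))) , refl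
cellsOf-surjective n (suc k) w ((i , x) ∷ Z) len pw Z↭ bal
  with largest-at-descent (Unique-↭ (↭-sym pw) (Unique-range1 n)) Z↭ bal
... | 1≤i , i< , refl , lt with cellsOf-surjective n k u Z′ (trans (length-map (τrow i) Z) (suc-injective len)) pu Z′↭ bal′
  where
  u : List ℕ
  u = swapAt i w
  Z′ : List Cell
  Z′ = map (τrow i) Z
  pu : IsPerm n u
  pu = ↭-trans (swapAt-↭ i w) pw
  i<u : i < length u
  i<u = subst (i <_) (sym (length-swapAt i w)) i<
  val-i : val u i ≡ val w (suc i)
  val-i = trans (val-swapAt i w i 1≤i i<) (cong (val w) (τ-left i))
  val-i+1 : val u (suc i) ≡ val w i
  val-i+1 = trans (val-swapAt i w (suc i) 1≤i i<) (cong (val w) (τ-right i))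
  asc : val u i < val u (suc i)
  asc = ≡.subst₂ _<_ (sym val-i) (sym val-i+1) lt
  Z′↭ : Z′ ↭ diagram u
  Z′↭ = subst (Z′ ↭_) (map-τrow-involutive i (diagram u)) (↭.map⁺ (τrow i) (↭.drop-∷
    (↭-trans Z↭ (≡.subst₂ (λ v c → diagram v ↭ (i , c) ∷ map (τrow i) (diagram u))
                  (swapAt-involutive i w) val-i (diagram-swapAt i u 1≤i i<u asc)))))
  open Ascent i u Z′ (Unique-↭ (↭-sym pu) (Unique-range1 n)) 1≤i i<u asc Z′↭
  -- The given filling is `Z⁺` built over `Z′`: its head is the cell of the ascent of `u`, and
  -- exchanging the rows of `Z′` gives back `Z`.
  bal′ : Bal Z′
  bal′ = Bal-step⁻¹ (subst Bal (cong₂ (λ c L → (i , c) ∷ L) (sym val-i) (sym (map-τrow-involutive i Z))) bal)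
... | σ , red , ev , cells = i ∷ σ ,
  cons 1≤i (subst (i <_) (trans (↭-length pw) (length-range1 n)) i<)
       (subst (λ v → val v i < val v (suc i)) (sym ev)
         (≡.subst₂ _<_ (sym (trans (val-swapAt i w i 1≤i i<) (cong (val w) (τ-left i))))
                       (sym (trans (val-swapAt i w (suc i) 1≤i i<) (cong (val w) (τ-right i)))) lt)) red ,
  trans (cong (swapAt i) ev) (swapAt-involutive i w) ,
  cong₂ (λ c L → (i , c) ∷ L)
    (trans (cong (λ v → val v i) ev) (trans (val-swapAt i w i 1≤i i<) (cong (val w) (τ-left i))))
    (trans (cong (map (τrow i)) cells) (map-τrow-involutive i Z))

rows-injective : ∀ n ρ ρ′ → map row (cellsOf n ρ) ≡ map row (cellsOf n ρ′) → ρ ≡ ρ′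
rows-injective n [] [] e = refl
rows-injective n (a ∷ σ) (a′ ∷ σ′) e with ∷-injective e
... | refl , e′ = cong (a ∷_) (rows-injective n σ σ′ (map-injective (τ-injective a)
  (trans (sym (commute (cellsOf n σ))) (trans e′ (commute (cellsOf n σ′))))))
  where
  commute : ∀ Z → map row (map (τrow a) Z) ≡ map (τ a) (map row Z)
  commute Z = trans (sym (map-∘ Z)) (map-∘ Z)

-- Numbered fillings

numberFrom : {A : Set} → ℕ → List A → List (ℕ × A)
numberFrom k []       = []
numberFrom k (x ∷ xs) = (k , x) ∷ numberFrom (suc k) xs

module _ {A : Set} where

  numbered≡numberFrom : ∀ (xs : List A) → numbered xs ≡ numberFrom 1 xs
  numbered≡numberFrom xs = trans (cong (λ l → zip l xs) (map-upTo suc (length xs))) (go 1 suc (λ _ → refl) xs)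
    where
    go : ∀ k f → (∀ i → f i ≡ k + i) → ∀ (xs : List A) → zip (applyUpTo f (length xs)) xs ≡ numberFrom k xs
    go k f h []       = refl
    go k f h (x ∷ xs) = cong₂ (λ i l → (i , x) ∷ l) (trans (h 0) (+-identityʳ k))
      (go (suc k) (f ∘ suc) (λ i → trans (h (suc i)) (+-suc k i)) xs)

  numberFrom-++ : ∀ k (xs ys : List A) → numberFrom k (xs ++ ys) ≡ numberFrom k xs ++ numberFrom (k + length xs) ys
  numberFrom-++ k [] ys = cong (λ i → numberFrom i ys) (sym (+-identityʳ k))
  numberFrom-++ k (x ∷ xs) ys = cong ((k , x) ∷_)
    (trans (numberFrom-++ (suc k) xs ys) (cong (λ i → numberFrom (suc k) xs ++ numberFrom i ys) (sym (+-suc k (length xs)))))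

  ∈-numberFrom⁻ : ∀ k (xs : List A) {e} → e ∈ numberFrom k xs →
    ∃ λ ys → ∃ λ z → ∃ λ zs → xs ≡ ys ++ z ∷ zs × e ≡ (k + length ys , z)
  ∈-numberFrom⁻ k (x ∷ xs) (here refl) = [] , x , xs , refl , cong (_, x) (sym (+-identityʳ k))
  ∈-numberFrom⁻ k (x ∷ xs) (there h) with ∈-numberFrom⁻ (suc k) xs h
  ... | ys , z , zs , refl , refl = x ∷ ys , z , zs , refl , cong (_, z) (sym (+-suc k (length ys)))

  -- On a segment wholly before or wholly after a given entry the comparison `t` of entries is
  -- constant, so only the geometric test remains. This is how comparisons of entries become
  -- positions in a list.
  count-numberFrom-true : ∀ (p q : A → Bool) (t : ℕ → Bool) k xs →
    (∀ i → k ≤ i → i < k + length xs → t i ≡ true) →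
    count (λ e → p (proj₂ e) ∧ q (proj₂ e) ∧ t (proj₁ e)) (numberFrom k xs) ≡ count (λ x → p x ∧ q x) xs
  count-numberFrom-true p q t k [] h = refl
  count-numberFrom-true p q t k (x ∷ xs) h rewrite h k ≤-refl (m<m+n k (s≤s z≤n)) | ∧-identityʳ (q x) =
    cong (indicator (p x ∧ q x) +_)
      (count-numberFrom-true p q t (suc k) xs λ i k<i i< → h i (<⇒≤ k<i) (subst (i <_) (sym (+-suc k (length xs))) i<))

  count-numberFrom-false : ∀ (p q : A → Bool) (t : ℕ → Bool) k xs →
    (∀ i → k ≤ i → i < k + length xs → t i ≡ false) →
    count (λ e → p (proj₂ e) ∧ q (proj₂ e) ∧ t (proj₁ e)) (numberFrom k xs) ≡ 0
  count-numberFrom-false p q t k [] h = refl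
  count-numberFrom-false p q t k (x ∷ xs) h rewrite h k ≤-refl (m<m+n k (s≤s z≤n)) | ∧-zeroʳ (q x) | ∧-zeroʳ (p x) =
    count-numberFrom-false p q t (suc k) xs λ i k<i i< → h i (<⇒≤ k<i) (subst (i <_) (sym (+-suc k (length xs))) i<)

module _ (A : List Cell) (z : Cell) (B : List Cell) where

  private
    k : ℕ
    k = suc (length A)

    numbered-split : numbered (A ++ z ∷ B) ≡ numberFrom 1 A ++ (k , z) ∷ numberFrom (suc k) B
    numbered-split = trans (numbered≡numberFrom (A ++ z ∷ B)) (numberFrom-++ 1 A (z ∷ B))

    split-count : ∀ (p q : Cell → Bool) (t : ℕ → Bool) → t k ≡ false →
      length (filterᵇ (λ e → p (proj₂ e) ∧ q (proj₂ e) ∧ t (proj₁ e)) (numbered (A ++ z ∷ B))) ≡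
      count (λ e → p (proj₂ e) ∧ q (proj₂ e) ∧ t (proj₁ e)) (numberFrom 1 A) +
      count (λ e → p (proj₂ e) ∧ q (proj₂ e) ∧ t (proj₁ e)) (numberFrom (suc k) B)
    split-count p q t tk = trans (count≡length-filterᵇ P (numbered (A ++ z ∷ B))) (trans (cong (count P) numbered-split)
      (trans (count-++ P (numberFrom 1 A) _) (cong (count P (numberFrom 1 A) +_) drop-z)))
      where
      P : ℕ × Cell → Bool
      P e = p (proj₂ e) ∧ q (proj₂ e) ∧ t (proj₁ e)
      drop-z : count P ((k , z) ∷ numberFrom (suc k) B) ≡ count P (numberFrom (suc k) B)
      drop-z rewrite tk | ∧-zeroʳ (q z) | ∧-zeroʳ (p z) = refl

  rightLarger-split : rightLarger (A ++ z ∷ B) k z ≡ count (rightᵇ z) B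
  rightLarger-split = trans (split-count same right (k <ᵇ_) (¬T⇒false (<-irrefl refl ∘ <ᵇ⇒< k k)))
    (cong₂ _+_ (count-numberFrom-false same right (k <ᵇ_) 1 A λ i _ i<k → ¬T⇒false (<⇒≯ i<k ∘ <ᵇ⇒< k i))
               (count-numberFrom-true same right (k <ᵇ_) (suc k) B λ i k<i _ → T⇒true (<⇒<ᵇ k<i)))
    where
    same right : Cell → Bool
    same y  = row y ≡ᵇ row z
    right y = col z <ᵇ col y

  aboveSmaller-split : aboveSmaller (A ++ z ∷ B) k z ≡ count (aboveᵇ z) A
  aboveSmaller-split = trans (split-count same above (_<ᵇ k) (¬T⇒false (<-irrefl refl ∘ <ᵇ⇒< k k)))
    (trans (cong₂ _+_ (count-numberFrom-true same above (_<ᵇ k) 1 A λ i _ i<k → T⇒true (<⇒<ᵇ i<k))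
                      (count-numberFrom-false same above (_<ᵇ k) (suc k) B λ i k<i _ → ¬T⇒false (<⇒≯ k<i ∘ <ᵇ⇒< i k)))
           (+-identityʳ _))
    where
    same above : Cell → Bool
    same y  = col y ≡ᵇ col z
    above y = row z <ᵇ row y

count-reverse : ∀ {A : Set} (p : A → Bool) xs → count p (reverse xs) ≡ count p xs
count-reverse p xs = count-↭ p (↭.↭-reverse xs)

reverse-split : ∀ {A : Set} (xs : List A) z ys → reverse (xs ++ z ∷ ys) ≡ reverse ys ++ z ∷ reverse xs
reverse-split xs z ys = begin
  reverse (xs ++ z ∷ ys)               ≡⟨ reverse-++ xs (z ∷ ys) ⟩
  reverse (z ∷ ys) ++ reverse xs       ≡⟨ cong (_++ reverse xs) (unfold-reverse z ys) ⟩
  (reverse ys ++ z ∷ []) ++ reverse xs ≡⟨ ++-assoc (reverse ys) (z ∷ []) (reverse xs) ⟩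
  reverse ys ++ z ∷ reverse xs         ∎
  where open ≡-Reasoning

Balanced⇒Bal : ∀ T → Balanced T → Bal (reverse T)
Balanced⇒Bal T bal B z A eq = begin
  count (rightᵇ z) B                                            ≡⟨ count-reverse (rightᵇ z) B ⟨
  count (rightᵇ z) (reverse B)                                  ≡⟨ rightLarger-split (reverse A) z (reverse B) ⟨
  rightLarger (reverse A ++ z ∷ reverse B) (suc (length (reverse A))) z
    ≡⟨ cong (λ T → rightLarger T (suc (length (reverse A))) z) T≡ ⟨
  rightLarger T (suc (length (reverse A))) z                    ≡⟨ All.lookup bal e∈ ⟩
  aboveSmaller T (suc (length (reverse A))) z
    ≡⟨ cong (λ T → aboveSmaller T (suc (length (reverse A))) z) T≡ ⟩
  aboveSmaller (reverse A ++ z ∷ reverse B) (suc (length (reverse A))) z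
    ≡⟨ aboveSmaller-split (reverse A) z (reverse B) ⟩
  count (aboveᵇ z) (reverse A)                                  ≡⟨ count-reverse (aboveᵇ z) A ⟩
  count (aboveᵇ z) A                                            ∎
  where
  open ≡-Reasoning
  T≡ : T ≡ reverse A ++ z ∷ reverse B
  T≡ = trans (sym (reverse-involutive T)) (trans (cong reverse eq) (reverse-split B z A))
  e∈ : (suc (length (reverse A)) , z) ∈ numbered T
  e∈ = subst (_ ∈_) (sym (trans (cong numbered T≡) (trans (numbered≡numberFrom _) (numberFrom-++ 1 (reverse A) (z ∷ reverse B)))))
         (∈-++⁺ʳ (numberFrom 1 (reverse A)) (here refl))

Bal⇒Balanced : ∀ Z → Bal Z → Balanced (reverse Z)
Bal⇒Balanced Z bal = All.tabulate check
  where
  check : ∀ {e} → e ∈ numbered (reverse Z) →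
    rightLarger (reverse Z) (proj₁ e) (proj₂ e) ≡ aboveSmaller (reverse Z) (proj₁ e) (proj₂ e)
  check e∈ with ∈-numberFrom⁻ 1 (reverse Z) (subst (_ ∈_) (numbered≡numberFrom (reverse Z)) e∈)
  ... | A , z , B , eq , refl rewrite eq = begin
    rightLarger (A ++ z ∷ B) (suc (length A)) z   ≡⟨ rightLarger-split A z B ⟩
    count (rightᵇ z) B                            ≡⟨ count-reverse (rightᵇ z) B ⟨
    count (rightᵇ z) (reverse B)                  ≡⟨ bal (reverse B) z (reverse A) Z≡ ⟩
    count (aboveᵇ z) (reverse A)                  ≡⟨ count-reverse (aboveᵇ z) A ⟩
    count (aboveᵇ z) A                            ≡⟨ aboveSmaller-split A z B ⟨
    aboveSmaller (A ++ z ∷ B) (suc (length A)) z  ∎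
    where
    open ≡-Reasoning
    Z≡ : Z ≡ reverse B ++ z ∷ reverse A
    Z≡ = trans (sym (reverse-involutive Z)) (trans (cong reverse eq) (reverse-split A z B))

Φ-SBT : ∀ {n w ρ} → IsReduced n w ρ → IsSBT w (Φ n ρ)
Φ-SBT {n} {w} {ρ} red@(_ , _ , refl) =
  ↭-trans (↭.↭-reverse (cellsOf n ρ)) (cellsOf-↭ r) , Bal⇒Balanced (cellsOf n ρ) (cellsOf-Bal r)
  where
  r : Red n ρ
  r = IsReduced⇒Red red

Φ-surjective : ∀ {n w R} → IsPerm n w → IsSBT w R → ∃ λ ρ → IsReduced n w ρ × Φ n ρ ≡ R
Φ-surjective {n} {w} {R} pw (R↭ , bal)
  with cellsOf-surjective n _ w (reverse R) refl pw (↭-trans (↭.↭-reverse R) R↭) (Balanced⇒Bal R bal)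
... | ρ , red , refl , cells = ρ , Red⇒IsReduced red , trans (cong reverse cells) (reverse-involutive R)

map-row-Φ-injective : ∀ n ρ ρ′ → map row (Φ n ρ) ≡ map row (Φ n ρ′) → ρ ≡ ρ′
map-row-Φ-injective n ρ ρ′ e = rows-injective n ρ ρ′ (reverse-injective
  (trans (sym (reverse-map row (cellsOf n ρ))) (trans e (reverse-map row (cellsOf n ρ′)))))

Φ-injective : ∀ n {ρ ρ′} → Φ n ρ ≡ Φ n ρ′ → ρ ≡ ρ′
Φ-injective n {ρ} {ρ′} e = map-row-Φ-injective n ρ ρ′ (cong (map row) e)

-- Positions carried along by a word

act : List ℕ → ℕ → ℕ
act []      i = i
act (t ∷ P) i = τ t (act P i)

act-injective : ∀ P {i j} → act P i ≡ act P j → i ≡ j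
act-injective []      e = e
act-injective (t ∷ P) e = act-injective P (τ-injective t e)

actRow : List ℕ → Cell → Cell
actRow P (r , c) = (act P r , c)

Red-++⁻ : ∀ {n} P {σ} → Red n (P ++ σ) → Red n σ
Red-++⁻ []      r              = r
Red-++⁻ (t ∷ P) (cons _ _ _ r) = Red-++⁻ P r

val-act : ∀ {n} P {σ} → Red n (P ++ σ) → ∀ i → val (evalWord n (P ++ σ)) (act P i) ≡ val (evalWord n σ) i
val-act [] _ i = refl
val-act {n} (t ∷ P) {σ} (cons 1≤t t<n _ r) i = begin
  val (evalWord n (t ∷ P ++ σ)) (τ t (act P i))     ≡⟨ val-evalWord t (P ++ σ) _ 1≤t t<n ⟩
  val (evalWord n (P ++ σ)) (τ t (τ t (act P i)))   ≡⟨ cong (val (evalWord n (P ++ σ))) (τ-involutive t (act P i)) ⟩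
  val (evalWord n (P ++ σ)) (act P i)               ≡⟨ val-act P r i ⟩
  val (evalWord n σ) i                              ∎
  where open ≡-Reasoning

τ-mono : ∀ t {i j} → i < j → ¬ (i ≡ t × j ≡ suc t) → τ t i < τ t j
τ-mono t {i} {j} i<j ne with tauView t i | tauView t j
... | isL     | isL     = ⊥-elim (<-irrefl refl i<j)
... | isL     | isR     = ⊥-elim (ne (refl , refl))
... | isL     | isO p q rewrite τ-left t | τ-other t j p q = ≤∧≢⇒< i<j (q ∘ sym)
... | isR     | isL     = ⊥-elim (<⇒≱ i<j (n≤1+n t))
... | isR     | isR     = ⊥-elim (<-irrefl refl i<j)
... | isR     | isO p q rewrite τ-right t | τ-other t j p q = <-trans (n<1+n t) i<j
... | isO p q | isL     rewrite τ-left t | τ-other t i p q = m<n⇒m<1+n i<j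
... | isO p q | isR     rewrite τ-right t | τ-other t i p q = ≤∧≢⇒< (s≤s⁻¹ i<j) p
... | isO p q | isO p′ q′ rewrite τ-other t i p q | τ-other t j p′ q′ = i<j

-- In a reduced word, values out of order are never exchanged again.
act-mono : ∀ {n} P {σ} → Red n (P ++ σ) → ∀ {i j} → i < j →
  val (evalWord n σ) j < val (evalWord n σ) i → act P i < act P j
act-mono [] _ i<j _ = i<j
act-mono {n} (t ∷ P) {σ} (cons _ _ asc r) {i} {j} i<j inv = τ-mono t (act-mono P r i<j inv) λ { (p , q) →
  <⇒≯ asc (≡.subst₂ (λ i′ j′ → val (evalWord n (P ++ σ)) j′ < val (evalWord n (P ++ σ)) i′) p q
    (≡.subst₂ _<_ (sym (val-act P r j)) (sym (val-act P r i)) inv)) }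

val-cons-left : ∀ {n a σ} → 1 ≤ a → a < n → val (evalWord n (a ∷ σ)) a ≡ val (evalWord n σ) (suc a)
val-cons-left {n} {a} {σ} 1≤a a<n = trans (val-evalWord a σ a 1≤a a<n) (cong (val (evalWord n σ)) (τ-left a))

val-cons-right : ∀ {n a σ} → 1 ≤ a → a < n → val (evalWord n (a ∷ σ)) (suc a) ≡ val (evalWord n σ) a
val-cons-right {n} {a} {σ} 1≤a a<n = trans (val-evalWord a σ (suc a) 1≤a a<n) (cong (val (evalWord n σ)) (τ-right a))

val-cons-other : ∀ {n a σ} i → 1 ≤ a → a < n → i ≢ a → i ≢ suc a → val (evalWord n (a ∷ σ)) i ≡ val (evalWord n σ) i
val-cons-other {n} {a} {σ} i 1≤a a<n p q = trans (val-evalWord a σ i 1≤a a<n) (cong (val (evalWord n σ)) (τ-other a i p q))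

-- Just after the letter `b` its two values are out of order, so `act-mono` fixes the order of their
-- final rows.
act-ascent : ∀ {n} P {b σ} → Red n (P ++ b ∷ σ) → act P b < act P (suc b)
act-ascent P {b} {σ} r with Red-++⁻ P r
... | cons 1≤b b<n asc _ = act-mono P r (n<1+n b)
  (≡.subst₂ _<_ (sym (val-cons-right {σ = σ} 1≤b b<n)) (sym (val-cons-left {σ = σ} 1≤b b<n)) asc)

-- The cells created by `P` depend on the permutation `u` beneath it and not on a word for `u`; a
-- Coxeter move to the right of `P` therefore leaves them alone.
newCells : List ℕ → List ℕ → List Cell
newCells []      u = []
newCells (t ∷ P) u = (t , val (foldr swapAt u P) t) ∷ map (τrow t) (newCells P u)

cellsOf-++ : ∀ n P σ → cellsOf n (P ++ σ) ≡ newCells P (evalWord n σ) ++ map (actRow P) (cellsOf n σ)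
cellsOf-++ n [] σ = sym (map-id (cellsOf n σ))
cellsOf-++ n (t ∷ P) σ = cong₂ (λ u L → (t , val u t) ∷ L)
  (foldr-++ swapAt (range1 n) P σ)
  (trans (cong (map (τrow t)) (cellsOf-++ n P σ))
  (trans (map-++ (τrow t) (newCells P (evalWord n σ)) _)
         (cong (map (τrow t) (newCells P (evalWord n σ)) ++_) (sym (map-∘ (cellsOf n σ))))))

-- Coxeter moves

module _ {A : Set} where

  atD-++ : ∀ (d : A) xs ys k → atD d (xs ++ ys) (length xs + k) ≡ atD d ys k
  atD-++ d []       ys k = refl
  atD-++ d (x ∷ xs) ys k = atD-++ d xs ys k

  setAt-++ : ∀ xs (ys : List A) k a → setAt (xs ++ ys) (length xs + k) a ≡ xs ++ setAt ys k a
  setAt-++ []       ys k a = refl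
  setAt-++ (x ∷ xs) ys k a = cong (x ∷_) (setAt-++ xs ys k a)

  split-length : ∀ (xs : List A) i → i ≤ length xs → ∃ λ ys → ∃ λ zs → xs ≡ ys ++ zs × length zs ≡ i
  split-length xs i i≤ = take (length xs ∸ i) xs , drop (length xs ∸ i) xs , sym (take++drop≡id (length xs ∸ i) xs) ,
    trans (length-drop (length xs ∸ i) xs) (m∸[m∸n]≡n i≤)

-- Letters are numbered from the right end, so a prefix does not affect their numbers; the bound on
-- `i` keeps the subtraction from being truncated.
index-++ : ∀ (P σ : List ℕ) i → i ≤ length σ → length (P ++ σ) ∸ i ≡ length P + (length σ ∸ i)
index-++ P σ i i≤ = trans (cong (_∸ i) (length-++ P)) (+-∸-assoc (length P) i≤)

letter-++ : ∀ P σ i → i ≤ length σ → letter (P ++ σ) i ≡ letter σ i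
letter-++ P σ i i≤ = trans (cong (atD 0 (P ++ σ)) (index-++ P σ i i≤)) (atD-++ 0 P σ (length σ ∸ i))

setLetter-++ : ∀ P σ i a → i ≤ length σ → setLetter (P ++ σ) i a ≡ P ++ setLetter σ i a
setLetter-++ P σ i a i≤ = trans (cong (λ k → setAt (P ++ σ) k a) (index-++ P σ i i≤)) (setAt-++ P σ (length σ ∸ i) a)

letter-here : ∀ P x σ → letter (P ++ x ∷ σ) (suc (length σ)) ≡ x
letter-here P x σ = trans (letter-++ P (x ∷ σ) _ ≤-refl) (cong (atD 0 (x ∷ σ)) (n∸n≡0 (length σ)))

setLetter-here : ∀ P x σ a → setLetter (P ++ x ∷ σ) (suc (length σ)) a ≡ P ++ a ∷ σ
setLetter-here P x σ a = trans (setLetter-++ P (x ∷ σ) _ a ≤-refl) (cong (λ k → P ++ setAt (x ∷ σ) k a) (n∸n≡0 (length σ)))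

letter-next : ∀ P y x σ → letter (P ++ y ∷ x ∷ σ) (suc (length σ)) ≡ x
letter-next P y x σ = trans (cong (λ l → letter l (suc (length σ))) (sym (++-assoc P (y ∷ []) (x ∷ σ)))) (letter-here (P ++ y ∷ []) x σ)

setLetter-next : ∀ P y x σ a → setLetter (P ++ y ∷ x ∷ σ) (suc (length σ)) a ≡ P ++ y ∷ a ∷ σ
setLetter-next P y x σ a = trans (cong (λ l → setLetter l (suc (length σ)) a) (sym (++-assoc P (y ∷ []) (x ∷ σ))))
  (trans (setLetter-here (P ++ y ∷ []) x σ a) (++-assoc P (y ∷ []) (a ∷ σ)))

letter-next² : ∀ P z y x σ → letter (P ++ z ∷ y ∷ x ∷ σ) (suc (length σ)) ≡ x
letter-next² P z y x σ = trans (cong (λ l → letter l (suc (length σ))) (sym (++-assoc P (z ∷ []) (y ∷ x ∷ σ)))) (letter-next (P ++ z ∷ []) y x σ)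

setLetter-next² : ∀ P z y x σ a → setLetter (P ++ z ∷ y ∷ x ∷ σ) (suc (length σ)) a ≡ P ++ z ∷ y ∷ a ∷ σ
setLetter-next² P z y x σ a = trans (cong (λ l → setLetter l (suc (length σ)) a) (sym (++-assoc P (z ∷ []) (y ∷ x ∷ σ))))
  (trans (setLetter-next (P ++ z ∷ []) y x σ a) (++-assoc P (z ∷ []) (y ∷ a ∷ σ)))

<ᵇ-++ : ∀ {A : Set} (P σ : List A) {k} → k < length σ → (k <ᵇ length (P ++ σ)) ≡ true
<ᵇ-++ P σ k< = T⇒true (<⇒<ᵇ (<-≤-trans k< (subst (length σ ≤_) (sym (length-++ P)) (m≤n+m (length σ) (length P)))))

cW-at : ∀ P b a σ → cW (suc (length σ)) (P ++ b ∷ a ∷ σ) ≡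
  (if 1 <ᵇ ∣ a - b ∣ then P ++ a ∷ b ∷ σ else P ++ b ∷ a ∷ σ)
cW-at P b a σ
  rewrite <ᵇ-++ P (b ∷ a ∷ σ) (n<1+n (suc (length σ)))
        | letter-next P b a σ | letter-here P b (a ∷ σ)
        | setLetter-next P b a σ b | setLetter-here P b (b ∷ σ) a = refl

bW-at : ∀ P c b a σ → bW (suc (suc (length σ))) (P ++ c ∷ b ∷ a ∷ σ) ≡
  (if (c ≡ᵇ a) ∧ ((b ≡ᵇ suc a) ∨ (suc b ≡ᵇ a)) then P ++ b ∷ a ∷ b ∷ σ else P ++ c ∷ b ∷ a ∷ σ)
bW-at P c b a σ
  rewrite <ᵇ-++ P (c ∷ b ∷ a ∷ σ) (n<1+n (suc (suc (length σ))))
        | letter-next² P c b a σ | letter-next P c b (a ∷ σ) | letter-here P c (b ∷ a ∷ σ)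
        | setLetter-here P c (b ∷ a ∷ σ) b | setLetter-next P b b (a ∷ σ) a | setLetter-next² P b a a σ b = refl

cT-at : ∀ l Q x y R → length Q ≡ l → cT (suc l) (Q ++ x ∷ y ∷ R) ≡
  (if not (row x ≡ᵇ row y) ∧ not (col x ≡ᵇ col y) then Q ++ y ∷ x ∷ R else Q ++ x ∷ y ∷ R)
cT-at _ Q x y R refl = go
  where
  T₀ : List Cell
  T₀ = Q ++ x ∷ y ∷ R
  at₀ : atD (0 , 0) T₀ (length Q) ≡ x
  at₀ = trans (cong (atD (0 , 0) T₀) (sym (+-identityʳ (length Q)))) (atD-++ (0 , 0) Q (x ∷ y ∷ R) 0)
  at₁ : atD (0 , 0) T₀ (suc (length Q)) ≡ y
  at₁ = trans (cong (atD (0 , 0) T₀) (+-comm 1 (length Q))) (atD-++ (0 , 0) Q (x ∷ y ∷ R) 1)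
  len : (suc (length Q) <ᵇ length T₀) ≡ true
  len = T⇒true (<⇒<ᵇ (subst (suc (length Q) <_) (sym (trans (length-++ Q) (+-suc (length Q) (suc (length R)))))
    (s≤s (m<m+n (length Q) (s≤s z≤n)))))
  set₀ : ∀ a → setAt T₀ (length Q) a ≡ Q ++ a ∷ y ∷ R
  set₀ a = trans (cong (λ k → setAt T₀ k a) (sym (+-identityʳ (length Q)))) (setAt-++ Q (x ∷ y ∷ R) 0 a)
  set₁ : ∀ a b → setAt (Q ++ a ∷ y ∷ R) (suc (length Q)) b ≡ Q ++ a ∷ b ∷ R
  set₁ a b = trans (cong (λ k → setAt (Q ++ a ∷ y ∷ R) k b) (+-comm 1 (length Q))) (setAt-++ Q (a ∷ y ∷ R) 1 b)
  go : cT (suc (length Q)) T₀ ≡ (if not (row x ≡ᵇ row y) ∧ not (col x ≡ᵇ col y) then Q ++ y ∷ x ∷ R else T₀)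
  go rewrite len | at₀ | at₁ | set₀ y | set₁ y x = refl

bT-at : ∀ l Q p x q R → length Q ≡ l → bT (suc (suc l)) (Q ++ p ∷ x ∷ q ∷ R) ≡
  (if (aboveᵇ x p ∧ rightᵇ x q) ∨ (aboveᵇ x q ∧ rightᵇ x p) then Q ++ q ∷ x ∷ p ∷ R else Q ++ p ∷ x ∷ q ∷ R)
bT-at _ Q p x q R refl = go
  where
  T₀ : List Cell
  T₀ = Q ++ p ∷ x ∷ q ∷ R
  at₀ : atD (0 , 0) T₀ (length Q) ≡ p
  at₀ = trans (cong (atD (0 , 0) T₀) (sym (+-identityʳ (length Q)))) (atD-++ (0 , 0) Q (p ∷ x ∷ q ∷ R) 0)
  at₁ : atD (0 , 0) T₀ (suc (length Q)) ≡ x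
  at₁ = trans (cong (atD (0 , 0) T₀) (+-comm 1 (length Q))) (atD-++ (0 , 0) Q (p ∷ x ∷ q ∷ R) 1)
  at₂ : atD (0 , 0) T₀ (suc (suc (length Q))) ≡ q
  at₂ = trans (cong (atD (0 , 0) T₀) (+-comm 2 (length Q))) (atD-++ (0 , 0) Q (p ∷ x ∷ q ∷ R) 2)
  len : (suc (suc (length Q)) <ᵇ length T₀) ≡ true
  len = T⇒true (<⇒<ᵇ (subst (suc (suc (length Q)) <_) (sym (trans (length-++ Q)
    (trans (+-suc (length Q) (suc (suc (length R)))) (cong suc (+-suc (length Q) (suc (length R)))))))
    (s≤s (s≤s (m<m+n (length Q) (s≤s z≤n))))))
  set₀ : ∀ a → setAt T₀ (length Q) a ≡ Q ++ a ∷ x ∷ q ∷ R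
  set₀ a = trans (cong (λ k → setAt T₀ k a) (sym (+-identityʳ (length Q)))) (setAt-++ Q (p ∷ x ∷ q ∷ R) 0 a)
  set₂ : ∀ a b → setAt (Q ++ a ∷ x ∷ q ∷ R) (suc (suc (length Q))) b ≡ Q ++ a ∷ x ∷ b ∷ R
  set₂ a b = trans (cong (λ k → setAt (Q ++ a ∷ x ∷ q ∷ R) k b) (+-comm 2 (length Q))) (setAt-++ Q (a ∷ x ∷ q ∷ R) 2 b)
  go : bT (suc (suc (length Q))) T₀ ≡
    (if (aboveᵇ x p ∧ rightᵇ x q) ∨ (aboveᵇ x q ∧ rightᵇ x p) then Q ++ q ∷ x ∷ p ∷ R else T₀)
  go rewrite len | at₀ | at₁ | at₂ | set₀ q | set₂ q p = refl

reverse-split² : ∀ {A : Set} (xs : List A) y x ys → reverse (xs ++ y ∷ x ∷ ys) ≡ reverse ys ++ x ∷ y ∷ reverse xs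
reverse-split² xs y x ys = trans (reverse-split xs y (x ∷ ys))
  (trans (cong (_++ y ∷ reverse xs) (unfold-reverse x ys)) (++-assoc (reverse ys) (x ∷ []) (y ∷ reverse xs)))

reverse-split³ : ∀ {A : Set} (xs : List A) z y x ys →
  reverse (xs ++ z ∷ y ∷ x ∷ ys) ≡ reverse ys ++ x ∷ y ∷ z ∷ reverse xs
reverse-split³ xs z y x ys = trans (reverse-split xs z (y ∷ x ∷ ys))
  (trans (cong (_++ z ∷ reverse xs) (reverse-split² [] y x ys)) (++-assoc (reverse ys) (x ∷ y ∷ []) (z ∷ reverse xs)))

Φ-split² : ∀ n P σ {y x Y} → cellsOf n σ ≡ y ∷ x ∷ Y →
  Φ n (P ++ σ) ≡ reverse (map (actRow P) Y) ++ actRow P x ∷ actRow P y ∷ reverse (newCells P (evalWord n σ))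
Φ-split² n P σ {y} {x} {Y} e = trans (cong reverse (trans (cellsOf-++ n P σ)
    (cong (λ L → newCells P (evalWord n σ) ++ map (actRow P) L) e)))
  (reverse-split² (newCells P (evalWord n σ)) (actRow P y) (actRow P x) (map (actRow P) Y))

Φ-split³ : ∀ n P σ {z y x Y} → cellsOf n σ ≡ z ∷ y ∷ x ∷ Y →
  Φ n (P ++ σ) ≡ reverse (map (actRow P) Y) ++ actRow P x ∷ actRow P y ∷ actRow P z ∷ reverse (newCells P (evalWord n σ))
Φ-split³ n P σ {z} {y} {x} {Y} e = trans (cong reverse (trans (cellsOf-++ n P σ)
    (cong (λ L → newCells P (evalWord n σ) ++ map (actRow P) L) e)))
  (reverse-split³ (newCells P (evalWord n σ)) (actRow P z) (actRow P y) (actRow P x) (map (actRow P) Y))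

length-τrow² : ∀ i j Z → length (map (τrow i) (map (τrow j) Z)) ≡ length Z
length-τrow² i j Z = trans (length-map (τrow i) (map (τrow j) Z)) (length-map (τrow j) Z)

length-τrow³ : ∀ i j k Z → length (map (τrow i) (map (τrow j) (map (τrow k) Z))) ≡ length Z
length-τrow³ i j k Z = trans (length-map (τrow i) (map (τrow j) (map (τrow k) Z))) (length-τrow² j k Z)

length-below : ∀ n P σ (Y : List Cell) → length Y ≡ length (cellsOf n σ) → length (reverse (map (actRow P) Y)) ≡ length σ
length-below n P σ Y e =
  trans (length-reverse (map (actRow P) Y)) (trans (length-map (actRow P) Y) (trans e (length-cellsOf n σ)))

Far : ℕ → ℕ → Set
Far a b = suc a < b ⊎ suc b < a

far? : ∀ a b → Far a b ⊎ (a ≡ b ⊎ b ≡ suc a ⊎ a ≡ suc b)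
far? a b with <-cmp a b
... | tri≈ _ e _ = inj₂ (inj₁ e)
... | tri< l _ _ with m≤n⇒m<n∨m≡n l
...   | inj₁ p = inj₁ (inj₁ p)
...   | inj₂ e = inj₂ (inj₂ (inj₁ (sym e)))
far? a b | tri> _ _ l with m≤n⇒m<n∨m≡n l
...   | inj₁ p = inj₁ (inj₂ p)
...   | inj₂ e = inj₂ (inj₂ (inj₂ (sym e)))

Far-sym : ∀ {a b} → Far a b → Far b a
Far-sym (inj₁ p) = inj₂ p
Far-sym (inj₂ p) = inj₁ p

Far⇒≢ : ∀ {a b} → Far a b → a ≢ b × a ≢ suc b
Far⇒≢ (inj₁ p) = (λ { refl → <⇒≱ p (n≤1+n _) }) , (λ { refl → <⇒≱ p (m≤n⇒m≤1+n (n≤1+n _)) })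
Far⇒≢ (inj₂ p) = (λ { refl → <⇒≱ p (n≤1+n _) }) , (λ { refl → <-irrefl refl p })

Far⇒distance : ∀ {a b} → Far a b → (1 <ᵇ ∣ a - b ∣) ≡ true
Far⇒distance {a} {b} far = T⇒true (<⇒<ᵇ (dist far))
  where
  dist : Far a b → 1 < ∣ a - b ∣
  dist (inj₁ p) = subst (1 <_) (sym (m≤n⇒∣m-n∣≡n∸m (<⇒≤ (<⇒≤ p)))) (m+n≤o⇒m≤o∸n 2 p)
  dist (inj₂ p) = subst (1 <_) (trans (sym (m≤n⇒∣m-n∣≡n∸m (<⇒≤ (<⇒≤ p)))) (∣-∣-comm b a)) (m+n≤o⇒m≤o∸n 2 p)

near-distance : ∀ a → (1 <ᵇ ∣ a - suc a ∣) ≡ false × (1 <ᵇ ∣ suc a - a ∣) ≡ false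
near-distance a = cong (1 <ᵇ_) ∣a-1+a∣≡1 , cong (1 <ᵇ_) (trans (∣-∣-comm (suc a) a) ∣a-1+a∣≡1)
  where
  ∣a-1+a∣≡1 : ∣ a - suc a ∣ ≡ 1
  ∣a-1+a∣≡1 = trans (m≤n⇒∣m-n∣≡n∸m (n≤1+n a)) (m+n∸n≡m 1 a)

swapAt-far : ∀ {a b} u → Far a b → swapAt a (swapAt b u) ≡ swapAt b (swapAt a u)
swapAt-far u (inj₁ p) = swapAt-comm _ _ u p
swapAt-far u (inj₂ p) = sym (swapAt-comm _ _ u p)

τ-far : ∀ {a b} i → Far a b → τ a (τ b i) ≡ τ b (τ a i)
τ-far i (inj₁ p) = τ-comm _ _ i p
τ-far i (inj₂ p) = sym (τ-comm _ _ i p)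

cells-far : ∀ {n a b σ} → Far a b → 1 ≤ a → a < n → cellsOf n (b ∷ a ∷ σ) ≡
  (b , val (evalWord n σ) b) ∷ (a , val (evalWord n σ) a) ∷ map (τrow b) (map (τrow a) (cellsOf n σ))
cells-far {n} {a} {b} {σ} far 1≤a a<n = cong₂ (λ c r → (b , c) ∷ (r , val (evalWord n σ) a) ∷ map (τrow b) (map (τrow a) (cellsOf n σ)))
  (val-cons-other {σ = σ} b 1≤a a<n (proj₁ (Far⇒≢ (Far-sym far))) (proj₂ (Far⇒≢ (Far-sym far))))
  (τ-other b a (proj₁ (Far⇒≢ far)) (proj₂ (Far⇒≢ far)))

-- Letters at distance at least two create cells in different rows and columns, and these trade
-- places. If `b ≡ suc a`, both letters move the same smaller value, so the cells share a column; if
-- `a ≡ suc b`, the second letter brings the first cell into its own row; `a ≡ b` would undo an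
-- ascent. Hence the two moves are trivial together.
Φ-cW-at : ∀ {n} P b a σ → Red n (P ++ b ∷ a ∷ σ) →
  Φ n (cW (suc (length σ)) (P ++ b ∷ a ∷ σ)) ≡ cT (suc (length σ)) (Φ n (P ++ b ∷ a ∷ σ))
Φ-cW-at {n} P b a σ red with Red-++⁻ P red
... | cons 1≤b b<n asc-b (cons 1≤a a<n asc-a _) with far? a b
...   | inj₁ far = begin
  Φ n (cW (suc (length σ)) (P ++ b ∷ a ∷ σ))
    ≡⟨ cong (Φ n) (trans (cW-at P b a σ) (cong (if_then P ++ a ∷ b ∷ σ else (P ++ b ∷ a ∷ σ)) (Far⇒distance far))) ⟩
  Φ n (P ++ a ∷ b ∷ σ)
    ≡⟨ Φ-split² n P (a ∷ b ∷ σ) (trans (cells-far {σ = σ} (Far-sym far) 1≤b b<n) (cong (λ L → (a , _) ∷ (b , _) ∷ L) Y≡)) ⟩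
  Q ++ actRow P (b , val u b) ∷ actRow P (a , val u a) ∷ reverse (newCells P (evalWord n (a ∷ b ∷ σ)))
    ≡⟨ cong (λ v → Q ++ actRow P (b , val u b) ∷ actRow P (a , val u a) ∷ reverse (newCells P v)) (swapAt-far u far) ⟩
  Q ++ actRow P (b , val u b) ∷ actRow P (a , val u a) ∷ R
    ≡⟨ cong (if_then Q ++ actRow P (b , val u b) ∷ actRow P (a , val u a) ∷ R else (Q ++ actRow P (a , val u a) ∷ actRow P (b , val u b) ∷ R)) cond ⟨
  _ ≡⟨ cT-at (length σ) Q (actRow P (a , val u a)) (actRow P (b , val u b)) R (length-below n P σ Y lenY) ⟨
  cT (suc (length σ)) (Q ++ actRow P (a , val u a) ∷ actRow P (b , val u b) ∷ R)
    ≡⟨ cong (cT (suc (length σ))) (Φ-split² n P (b ∷ a ∷ σ) (cells-far {σ = σ} far 1≤a a<n)) ⟨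
  cT (suc (length σ)) (Φ n (P ++ b ∷ a ∷ σ)) ∎
  where
  open ≡-Reasoning
  u : List ℕ
  u = evalWord n σ
  Y Q R : List Cell
  Y = map (τrow b) (map (τrow a) (cellsOf n σ))
  Q = reverse (map (actRow P) Y)
  R = reverse (newCells P (evalWord n (b ∷ a ∷ σ)))
  lenY : length Y ≡ length (cellsOf n σ)
  lenY = length-τrow² b a (cellsOf n σ)
  Y≡ : map (τrow a) (map (τrow b) (cellsOf n σ)) ≡ Y
  Y≡ = trans (sym (map-∘ (cellsOf n σ))) (trans (map-cong (λ { (r , c) → cong (_, c) (τ-far r far) }) (cellsOf n σ)) (map-∘ (cellsOf n σ)))
  cond : (not (act P a ≡ᵇ act P b) ∧ not (val u a ≡ᵇ val u b)) ≡ true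
  cond rewrite ≢⇒≡ᵇ (proj₁ (Far⇒≢ far) ∘ act-injective P)
             | ≢⇒≡ᵇ (proj₁ (Far⇒≢ far) ∘ val-evalWord-injective σ 1≤a (<⇒≤ a<n) 1≤b (<⇒≤ b<n)) = refl
...   | inj₂ near = begin
  Φ n (cW (suc (length σ)) (P ++ b ∷ a ∷ σ))
    ≡⟨ cong (Φ n) (trans (cW-at P b a σ) (cong (if_then P ++ a ∷ b ∷ σ else (P ++ b ∷ a ∷ σ)) (distance near))) ⟩
  Φ n (P ++ b ∷ a ∷ σ)
    ≡⟨ Φ-split² n P (b ∷ a ∷ σ) refl ⟩
  Q ++ x ∷ y ∷ R
    ≡⟨ cong (if_then Q ++ y ∷ x ∷ R else (Q ++ x ∷ y ∷ R)) (cond near) ⟨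
  _ ≡⟨ cT-at (length σ) Q x y R (length-below n P σ Y lenY) ⟨
  cT (suc (length σ)) (Q ++ x ∷ y ∷ R)
    ≡⟨ cong (cT (suc (length σ))) (Φ-split² n P (b ∷ a ∷ σ) refl) ⟨
  cT (suc (length σ)) (Φ n (P ++ b ∷ a ∷ σ)) ∎
  where
  open ≡-Reasoning
  Y Q R : List Cell
  Y = map (τrow b) (map (τrow a) (cellsOf n σ))
  Q = reverse (map (actRow P) Y)
  R = reverse (newCells P (evalWord n (b ∷ a ∷ σ)))
  x y : Cell
  x = actRow P (τ b a , val (evalWord n σ) a)
  y = actRow P (b , val (evalWord n (a ∷ σ)) b)
  lenY : length Y ≡ length (cellsOf n σ)
  lenY = length-τrow² b a (cellsOf n σ)
  distinct : a ≢ b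
  distinct refl = <⇒≯ asc-a (≡.subst₂ _<_ (val-cons-left {σ = σ} 1≤a a<n) (val-cons-right {σ = σ} 1≤a a<n) asc-b)
  distance : a ≡ b ⊎ b ≡ suc a ⊎ a ≡ suc b → (1 <ᵇ ∣ a - b ∣) ≡ false
  distance (inj₁ e) = ⊥-elim (distinct e)
  distance (inj₂ (inj₁ refl)) = proj₁ (near-distance a)
  distance (inj₂ (inj₂ refl)) = proj₂ (near-distance b)
  cond : a ≡ b ⊎ b ≡ suc a ⊎ a ≡ suc b → (not (row x ≡ᵇ row y) ∧ not (col x ≡ᵇ col y)) ≡ false
  cond (inj₁ e) = ⊥-elim (distinct e)
  cond (inj₂ (inj₁ refl)) = trans (cong (λ k → not (row x ≡ᵇ row y) ∧ not (col x ≡ᵇ k)) (val-cons-right {σ = σ} 1≤a a<n))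
    (trans (cong (λ t → not (row x ≡ᵇ row y) ∧ not t) (≡ᵇ-refl (col x))) (∧-zeroʳ _))
  cond (inj₂ (inj₂ refl)) = cong (λ t → not t ∧ not (col x ≡ᵇ col y))
    (trans (cong (λ r → act P r ≡ᵇ act P b) (τ-right b)) (≡ᵇ-refl (act P b)))

module _ {n a : ℕ} {σ : List ℕ} (1≤a : 1 ≤ a) (a+1<n : suc a < n) where

  private
    u : List ℕ
    u = evalWord n σ
    a<n : a < n
    a<n = <⇒≤ a+1<n
    low≢ : a ≢ suc a
    low≢ e = 1+n≢n (sym e)
    low≢² : a ≢ suc (suc a)
    low≢² = <⇒≢ (m<n⇒m<1+n (n<1+n a))
    W : List Cell
    W = map (τrow a) (map (τrow (suc a)) (map (τrow a) (cellsOf n σ)))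

  cells-braid₁ : cellsOf n (a ∷ suc a ∷ a ∷ σ) ≡ (a , val u (suc a)) ∷ (a , val u a) ∷ (suc a , val u a) ∷ W
  cells-braid₁ = cong₂ _∷_
    (cong (a ,_) (trans (val-cons-other {a = suc a} {σ = a ∷ σ} a (s≤s z≤n) a+1<n low≢ low≢²) (val-cons-left {σ = σ} 1≤a a<n)))
    (cong₂ _∷_ (cong₂ _,_ (τ-right a) (val-cons-right {σ = σ} 1≤a a<n))
      (cong (λ r → (r , val u a) ∷ W) (trans (cong (τ a) (τ-other (suc a) a low≢ low≢²)) (τ-left a))))

  cells-braid₂ : cellsOf n (suc a ∷ a ∷ suc a ∷ σ) ≡ (suc a , val u a) ∷ (a , val u a) ∷ (a , val u (suc a)) ∷ W
  cells-braid₂ = cong₂ _∷_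
    (cong (suc a ,_) (trans (val-cons-right {σ = suc a ∷ σ} 1≤a a<n) val-a))
    (cong₂ _∷_ (cong₂ _,_ (τ-other (suc a) a low≢ low≢²) val-a)
      (cong₂ (λ r L → (r , val u (suc a)) ∷ L) (trans (cong (τ (suc a)) (τ-right a)) (τ-other (suc a) a low≢ low≢²)) W≡))
    where
    val-a : val (evalWord n (suc a ∷ σ)) a ≡ val u a
    val-a = val-cons-other {a = suc a} {σ = σ} a (s≤s z≤n) a+1<n low≢ low≢²
    flat : ∀ i j k (L : List Cell) → map (τrow i) (map (τrow j) (map (τrow k) L)) ≡ map (τrow i ∘ τrow j ∘ τrow k) L
    flat i j k L = trans (cong (map (τrow i)) (sym (map-∘ L))) (sym (map-∘ L))
    W≡ : map (τrow (suc a)) (map (τrow a) (map (τrow (suc a)) (cellsOf n σ))) ≡ W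
    W≡ = trans (flat (suc a) a (suc a) (cellsOf n σ))
      (trans (map-cong (λ { (r , c) → cong (_, c) (sym (τ-braid a r)) }) (cellsOf n σ)) (sym (flat a (suc a) a (cellsOf n σ))))

  length-W : length W ≡ length (cellsOf n σ)
  length-W = length-τrow³ a (suc a) a (cellsOf n σ)

  evalWord-braid : evalWord n (a ∷ suc a ∷ a ∷ σ) ≡ evalWord n (suc a ∷ a ∷ suc a ∷ σ)
  evalWord-braid = swapAt-braid a u 1≤a (subst (suc a <_) (sym (length-evalWord n σ)) a+1<n)

  -- p < q are the values of u in positions a and a + 1; the middle entry of the braid lies in cell (a , p).
  module BraidIn (P : List ℕ) (mono : act P a < act P (suc a)) (p<q : val u a < val u (suc a)) where

    private
      p q : ℕ
      p = val u a
      q = val u (suc a)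
      Q R : List Cell
      Q = reverse (map (actRow P) W)
      R = reverse (newCells P (evalWord n (a ∷ suc a ∷ a ∷ σ)))
      x hi ri : Cell
      x  = actRow P (a , p)
      hi = actRow P (suc a , p)
      ri = actRow P (a , q)
      len : length Q ≡ length σ
      len = length-below n P σ W length-W
      hi-above : aboveᵇ x hi ≡ true
      hi-above = T⇒true (above⁺ x hi refl mono)
      ri-right : rightᵇ x ri ≡ true
      ri-right = T⇒true (right⁺ x ri refl p<q)
      Φ₁ : Φ n (P ++ a ∷ suc a ∷ a ∷ σ) ≡ Q ++ hi ∷ x ∷ ri ∷ R
      Φ₁ = Φ-split³ n P (a ∷ suc a ∷ a ∷ σ) cells-braid₁
      Φ₂ : Φ n (P ++ suc a ∷ a ∷ suc a ∷ σ) ≡ Q ++ ri ∷ x ∷ hi ∷ R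
      Φ₂ = trans (Φ-split³ n P (suc a ∷ a ∷ suc a ∷ σ) cells-braid₂)
        (cong (λ v → Q ++ ri ∷ x ∷ hi ∷ reverse (newCells P v)) (sym evalWord-braid))

    bT-braid₁ : bT (suc (suc (length σ))) (Φ n (P ++ a ∷ suc a ∷ a ∷ σ)) ≡ Φ n (P ++ suc a ∷ a ∷ suc a ∷ σ)
    bT-braid₁ = trans (cong (bT (suc (suc (length σ)))) Φ₁) (trans (bT-at (length σ) Q hi x ri R len) (trans branch (sym Φ₂)))
      where
      branch : (if (aboveᵇ x hi ∧ rightᵇ x ri) ∨ (aboveᵇ x ri ∧ rightᵇ x hi) then Q ++ ri ∷ x ∷ hi ∷ R else Q ++ hi ∷ x ∷ ri ∷ R)
               ≡ Q ++ ri ∷ x ∷ hi ∷ R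
      branch rewrite hi-above | ri-right = refl

    bT-braid₂ : bT (suc (suc (length σ))) (Φ n (P ++ suc a ∷ a ∷ suc a ∷ σ)) ≡ Φ n (P ++ a ∷ suc a ∷ a ∷ σ)
    bT-braid₂ = trans (cong (bT (suc (suc (length σ)))) Φ₂) (trans (bT-at (length σ) Q ri x hi R len) (trans branch (sym Φ₁)))
      where
      branch : (if (aboveᵇ x ri ∧ rightᵇ x hi) ∨ (aboveᵇ x hi ∧ rightᵇ x ri) then Q ++ hi ∷ x ∷ ri ∷ R else Q ++ ri ∷ x ∷ hi ∷ R)
               ≡ Q ++ hi ∷ x ∷ ri ∷ R
      branch rewrite hi-above | ri-right | ∨-zeroʳ (aboveᵇ x ri ∧ rightᵇ x hi) = refl

-- Besides agreeing on braids, the two moves must be trivial simultaneously: `cells⇒letters` shows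
-- that three consecutive entries in the required position come only from a braid.
Φ-bW-at : ∀ {n} P c b a σ → Red n (P ++ c ∷ b ∷ a ∷ σ) →
  Φ n (bW (suc (suc (length σ))) (P ++ c ∷ b ∷ a ∷ σ)) ≡ bT (suc (suc (length σ))) (Φ n (P ++ c ∷ b ∷ a ∷ σ))
Φ-bW-at {n} P c b a σ red with Red-++⁻ P red
... | cons 1≤c c<n asc-c (cons 1≤b b<n asc-b (cons 1≤a a<n asc-a _)) =
  trans (cong (Φ n) (bW-at P c b a σ)) (go (T? lettersᵇ))
  where
  lettersᵇ cellsᵇ : Bool
  lettersᵇ = (c ≡ᵇ a) ∧ ((b ≡ᵇ suc a) ∨ (suc b ≡ᵇ a))
  i : ℕ
  i = suc (suc (length σ))
  p x q : Cell
  p = actRow P (τ c (τ b a) , val (evalWord n σ) a)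
  x = actRow P (τ c b , val (evalWord n (a ∷ σ)) b)
  q = actRow P (c , val (evalWord n (b ∷ a ∷ σ)) c)
  cellsᵇ = (aboveᵇ x p ∧ rightᵇ x q) ∨ (aboveᵇ x q ∧ rightᵇ x p)
  letters⁺ : c ≡ a → b ≡ suc a ⊎ suc b ≡ a → T lettersᵇ
  letters⁺ e f = Equivalence.from T-∧ (≡⇒≡ᵇ c a e , Equivalence.from T-∨ (Sum.map (≡⇒≡ᵇ b (suc a)) (≡⇒≡ᵇ (suc b) a) f))
  τ-fix : ∀ s t → τ s t ≡ s → t ≡ suc s
  τ-fix s t e = τ-injective s (trans e (sym (τ-right s)))
  -- Equal columns mean that consecutive letters move the same value, which then stands one position
  -- after the earlier letter; equal rows mean that the later letter carries the earlier cell into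
  -- its own row. Each condition determines the difference of two neighbouring letters.
  cells⇒letters : T cellsᵇ → T lettersᵇ
  cells⇒letters t with Equivalence.to T-∨ t
  ... | inj₁ t₁ with Equivalence.to T-∧ t₁
  ...   | ab , ri = letters⁺ (suc-injective (trans (sym b≡1+c) b≡1+a)) (inj₁ b≡1+a)
    where
    b≡1+a : b ≡ suc a
    b≡1+a = val-evalWord-injective (a ∷ σ) 1≤b (<⇒≤ b<n) (s≤s z≤n) a<n
      (trans (sym (proj₁ (above⁻ x p ab))) (sym (val-cons-right {σ = σ} 1≤a a<n)))
    b≡1+c : b ≡ suc c
    b≡1+c = τ-fix c b (act-injective P (sym (proj₁ (right⁻ x q ri))))
  cells⇒letters t | inj₂ t₂ with Equivalence.to T-∧ t₂
  ...   | ab , ri = letters⁺ (trans c≡1+b (sym a≡1+b)) (inj₂ (sym a≡1+b))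
    where
    c≡1+b : c ≡ suc b
    c≡1+b = val-evalWord-injective (b ∷ a ∷ σ) 1≤c (<⇒≤ c<n) (s≤s z≤n) b<n
      (trans (proj₁ (above⁻ x q ab)) (sym (val-cons-right {σ = a ∷ σ} 1≤b b<n)))
    a≡1+b : a ≡ suc b
    a≡1+b = τ-fix b a (τ-injective c (act-injective P (proj₁ (right⁻ x p ri))))
  go : Dec (T lettersᵇ) → Φ n (if lettersᵇ then P ++ b ∷ a ∷ b ∷ σ else P ++ c ∷ b ∷ a ∷ σ) ≡ bT i (Φ n (P ++ c ∷ b ∷ a ∷ σ))
  go (no ¬t) = begin
    Φ n (if lettersᵇ then P ++ b ∷ a ∷ b ∷ σ else P ++ c ∷ b ∷ a ∷ σ)
      ≡⟨ cong (λ t → Φ n (if t then P ++ b ∷ a ∷ b ∷ σ else P ++ c ∷ b ∷ a ∷ σ)) (¬T⇒false ¬t) ⟩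
    Φ n (P ++ c ∷ b ∷ a ∷ σ)
      ≡⟨ Φ-split³ n P (c ∷ b ∷ a ∷ σ) refl ⟩
    Q ++ p ∷ x ∷ q ∷ R
      ≡⟨ cong (if_then Q ++ q ∷ x ∷ p ∷ R else (Q ++ p ∷ x ∷ q ∷ R)) (¬T⇒false (¬t ∘ cells⇒letters)) ⟨
    _ ≡⟨ bT-at (length σ) Q p x q R (length-below n P σ W lenW) ⟨
    bT i (Q ++ p ∷ x ∷ q ∷ R)
      ≡⟨ cong (bT i) (Φ-split³ n P (c ∷ b ∷ a ∷ σ) refl) ⟨
    bT i (Φ n (P ++ c ∷ b ∷ a ∷ σ)) ∎
    where
    open ≡-Reasoning
    W Q R : List Cell
    W = map (τrow c) (map (τrow b) (map (τrow a) (cellsOf n σ)))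
    Q = reverse (map (actRow P) W)
    R = reverse (newCells P (evalWord n (c ∷ b ∷ a ∷ σ)))
    lenW : length W ≡ length (cellsOf n σ)
    lenW = length-τrow³ c b a (cellsOf n σ)
  go (yes t) = trans (cong (λ t → Φ n (if t then P ++ b ∷ a ∷ b ∷ σ else P ++ c ∷ b ∷ a ∷ σ)) (T⇒true t))
    (braid (≡ᵇ⇒≡ c a (proj₁ (Equivalence.to T-∧ t)))
           (Sum.map (≡ᵇ⇒≡ b (suc a)) (≡ᵇ⇒≡ (suc b) a) (Equivalence.to T-∨ (proj₂ (Equivalence.to (T-∧ {c ≡ᵇ a}) t)))))
    where
    braid : c ≡ a → b ≡ suc a ⊎ suc b ≡ a → Φ n (P ++ b ∷ a ∷ b ∷ σ) ≡ bT i (Φ n (P ++ c ∷ b ∷ a ∷ σ))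
    braid refl (inj₁ refl) = sym bT-braid₁
      where open BraidIn {σ = σ} 1≤a b<n P (act-ascent P red) asc-a
    braid refl (inj₂ refl) = sym bT-braid₂
      where
      low≢ : b ≢ suc b
      low≢ e = 1+n≢n (sym e)
      low≢² : b ≢ suc (suc b)
      low≢² = <⇒≢ (m<n⇒m<1+n (n<1+n b))
      -- With p, q, s for the values of `σ` in positions b, b + 1, b + 2, the letters b + 1, b, b +
      -- 1 produce p s q, then s p q, then s q p. The third letter thus supplies p < q. The first
      -- supplies q < s, which for `mono` says that positions b and b + 1 are out of order at the
      -- end.
      p<q : val (evalWord n σ) b < val (evalWord n σ) (suc b)
      p<q = ≡.subst₂ _<_
        (trans (val-cons-right {σ = suc b ∷ σ} 1≤b b<n) (val-cons-other {a = suc b} {σ = σ} b 1≤a a<n low≢ low≢²))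
        (trans (val-cons-other {σ = suc b ∷ σ} (suc (suc b)) 1≤b b<n (low≢² ∘ sym) (1+n≢n)) (val-cons-right {σ = σ} 1≤a a<n))
        asc-c
      mono : act P b < act P (suc b)
      mono = act-mono P red (n<1+n b) (≡.subst₂ _<_
        (sym (trans (val-cons-left {σ = b ∷ suc b ∷ σ} 1≤a a<n) (trans (val-cons-other {σ = suc b ∷ σ} (suc (suc b)) 1≤b b<n (low≢² ∘ sym) (1+n≢n)) (val-cons-right {σ = σ} 1≤a a<n))))
        (sym (trans (val-cons-other {a = suc b} {σ = b ∷ suc b ∷ σ} b 1≤a a<n low≢ low≢²) (trans (val-cons-left {σ = suc b ∷ σ} 1≤b b<n) (val-cons-left {σ = σ} 1≤a a<n))))
        asc-a)
      open BraidIn {σ = σ} 1≤b a<n P mono p<q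

length-Φ : ∀ n ρ → length (Φ n ρ) ≡ length ρ
length-Φ n ρ = trans (length-reverse (cellsOf n ρ)) (length-cellsOf n ρ)

cW-out : ∀ i ρ → length ρ ≤ i → cW i ρ ≡ ρ
cW-out zero    ρ _ = refl
cW-out (suc i) ρ h rewrite ¬T⇒false (λ t → <⇒≱ (<ᵇ⇒< (suc i) (length ρ) t) h) = refl

cT-out : ∀ i T → length T ≤ i → cT i T ≡ T
cT-out zero    T _ = refl
cT-out (suc i) T h rewrite ¬T⇒false (λ t → <⇒≱ (<ᵇ⇒< (suc i) (length T) t) h) = refl

bW-out : ∀ i ρ → length ρ ≤ i → bW i ρ ≡ ρ
bW-out zero          ρ _ = refl
bW-out (suc zero)    ρ _ = refl
bW-out (suc (suc i)) ρ h rewrite ¬T⇒false (λ t → <⇒≱ (<ᵇ⇒< (suc (suc i)) (length ρ) t) h) = refl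

bT-out : ∀ i T → length T ≤ i → bT i T ≡ T
bT-out zero          T _ = refl
bT-out (suc zero)    T _ = refl
bT-out (suc (suc i)) T h rewrite ¬T⇒false (λ t → <⇒≱ (<ᵇ⇒< (suc (suc i)) (length T) t) h) = refl

Φ-cW : ∀ {n ρ} → Red n ρ → ∀ i → Φ n (cW i ρ) ≡ cT i (Φ n ρ)
Φ-cW red zero = refl
Φ-cW {n} {ρ} red (suc i) with suc i <? length ρ
... | no  h = trans (cong (Φ n) (cW-out (suc i) ρ (≮⇒≥ h)))
  (sym (cT-out (suc i) (Φ n ρ) (subst (_≤ suc i) (sym (length-Φ n ρ)) (≮⇒≥ h))))
... | yes h with split-length ρ (suc (suc i)) h
...   | P , b ∷ a ∷ σ , refl , refl = Φ-cW-at P b a σ red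

Φ-bW : ∀ {n ρ} → Red n ρ → ∀ i → Φ n (bW i ρ) ≡ bT i (Φ n ρ)
Φ-bW red zero = refl
Φ-bW red (suc zero) = refl
Φ-bW {n} {ρ} red (suc (suc i)) with suc (suc i) <? length ρ
... | no  h = trans (cong (Φ n) (bW-out (suc (suc i)) ρ (≮⇒≥ h)))
  (sym (bT-out (suc (suc i)) (Φ n ρ) (subst (_≤ suc (suc i)) (sym (length-Φ n ρ)) (≮⇒≥ h))))
... | yes h with split-length ρ (suc (suc (suc i))) h
...   | P , c ∷ b ∷ a ∷ σ , refl , refl = Φ-bW-at P c b a σ red

-- The super-Yamanouchi word

interval : ℕ → ℕ → List ℕ
interval r zero    = []
interval r (suc c) = r ∷ interval (suc r) c

-- The head of the list is the length of the block starting with the largest letter, length ds.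
blocks : List ℕ → List ℕ
blocks []       = []
blocks (d ∷ ds) = interval (suc (length ds)) d ++ blocks ds

length-interval : ∀ r c → length (interval r c) ≡ c
length-interval r zero    = refl
length-interval r (suc c) = cong suc (length-interval (suc r) c)

IsRun : List ℕ → Set
IsRun R = ∃ λ x → ∃ λ c → 1 ≤ x × R ≡ interval x (suc c)

interval-≥ : ∀ r c → All (r ≤_) (interval r c)
interval-≥ r zero    = []
interval-≥ r (suc c) = ≤-refl ∷ All.map <⇒≤ (interval-≥ (suc r) c)

foldr-⊓ : ∀ x ys → All (x ≤_) ys → foldr _⊓_ x ys ≡ x
foldr-⊓ x []       _        = refl
foldr-⊓ x (y ∷ ys) (p ∷ ps) = trans (cong (y ⊓_) (foldr-⊓ x ys ps)) (m≥n⇒m⊓n≡n p)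

minList-interval : ∀ x c → minList (interval x (suc c)) ≡ x
minList-interval x c = foldr-⊓ x (interval (suc x) c) (All.map <⇒≤ (interval-≥ (suc x) c))

Consecutive⇒interval : ∀ x R → Consecutive (x ∷ R) → x ∷ R ≡ interval x (suc (length R))
Consecutive⇒interval x []      _          = refl
Consecutive⇒interval x (y ∷ R) (refl , c) = cong (x ∷_) (Consecutive⇒interval y R c)

concat-consRun : ∀ x rs → concat (consRun x rs) ≡ x ∷ concat rs
concat-consRun x []             = refl
concat-consRun x ([] ∷ rs)      = refl
concat-consRun x ((y ∷ r) ∷ rs) with x <ᵇ y
... | true  = refl
... | false = refl

concat-runs : ∀ ρ → concat (runs ρ) ≡ ρ
concat-runs []      = refl
concat-runs (x ∷ ρ) = trans (concat-consRun x (runs ρ)) (cong (x ∷_) (concat-runs ρ))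

consRun-nonempty : ∀ x rs → All (_≢ []) rs → All (_≢ []) (consRun x rs)
consRun-nonempty x [] _ = (λ ()) ∷ []
consRun-nonempty x ([] ∷ rs) (_ ∷ ne) = (λ ()) ∷ ne
consRun-nonempty x ((y ∷ r) ∷ rs) (p ∷ ne) with x <ᵇ y
... | true  = (λ ()) ∷ ne
... | false = (λ ()) ∷ p ∷ ne

runs-nonempty : ∀ ρ → All (_≢ []) (runs ρ)
runs-nonempty []      = []
runs-nonempty (x ∷ ρ) = consRun-nonempty x (runs ρ) (runs-nonempty ρ)

areRuns : ∀ {rs} → All (_≢ []) rs → All Consecutive rs → All (All (1 ≤_)) rs → All IsRun rs
areRuns [] [] [] = []
areRuns {[] ∷ _} (ne ∷ _) _ _ = ⊥-elim (ne refl)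
areRuns {(x ∷ r) ∷ _} (_ ∷ ne) (c ∷ cs) ((p ∷ _) ∷ ps) = (x , length r , p , Consecutive⇒interval x r c) ∷ areRuns ne cs ps

IsRun⇒≥1 : ∀ {R} → IsRun R → 1 ≤ minList R
IsRun⇒≥1 (x , c , 1≤x , refl) = subst (1 ≤_) (sym (minList-interval x c)) 1≤x

IsRun-at : ∀ {R m} → IsRun R → minList R ≡ m → R ≡ interval m (length R)
IsRun-at (x , c , _ , refl) refl =
  cong₂ interval (sym (minList-interval x c)) (cong suc (sym (length-interval (suc x) c)))

private
  FirstMin≤ : ℕ → List (List ℕ) → Set
  FirstMin≤ m rs = ∀ R rs′ → rs ≡ R ∷ rs′ → minList R ≤ m

-- Every start value from `m` down to 1 receives a block, an empty one where no run starts. Since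
-- the minima decrease strictly, no start value is needed twice.
runs⇒blocks : ∀ m rs → All IsRun rs → Linked _>ℕ_ (map minList rs) → FirstMin≤ m rs →
  ∃ λ ds → length ds ≡ m × concat rs ≡ blocks ds
runs⇒blocks zero [] _ _ _ = [] , refl , refl
runs⇒blocks zero (R ∷ rs) (i ∷ _) _ h = ⊥-elim (<⇒≱ (IsRun⇒≥1 i) (h R rs refl))
runs⇒blocks (suc m) [] al li h with runs⇒blocks m [] [] [] (λ _ _ ())
... | ds , refl , e = 0 ∷ ds , refl , e
runs⇒blocks (suc m) (R ∷ rs) al@(i ∷ is) li h with m≤n⇒m<n∨m≡n (h R rs refl)
... | inj₁ lt with runs⇒blocks m (R ∷ rs) al li (λ { _ _ refl → s≤s⁻¹ lt })
...   | ds , refl , e = 0 ∷ ds , refl , e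
runs⇒blocks (suc m) (R ∷ rs) (i ∷ is) li h | inj₂ eq with runs⇒blocks m rs is (Linked.tail li) (next li)
  where
  next : ∀ {rs} → Linked _>ℕ_ (minList R ∷ map minList rs) → FirstMin≤ m rs
  next (lt ∷ _) _ _ refl = s≤s⁻¹ (subst (_ <_) eq lt)
... | ds , refl , e = length R ∷ ds , refl , cong₂ _++_ (IsRun-at i eq) e

SuperYamanouchi⇒blocks : ∀ {n π} → All (λ a → 1 ≤ a × a < n) π → SuperYamanouchi π →
  ∃ λ ds → length ds ≡ n × π ≡ blocks ds
SuperYamanouchi⇒blocks {n} {π} al (cs , li)
  with runs⇒blocks n (runs π) (areRuns (runs-nonempty π) cs (All.map (All.map proj₁) letters)) li first
  where
  letters : All (All (λ a → 1 ≤ a × a < n)) (runs π)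
  letters = concat⁻ (subst (All _) (sym (concat-runs π)) al)
  first : FirstMin≤ n (runs π)
  first R rs e with areRuns (runs-nonempty π) cs (All.map (All.map proj₁) letters) | letters
  ... | is | ls rewrite e with is | ls
  ...   | (x , c , _ , refl) ∷ _ | ((_ , x<n) ∷ _) ∷ _ = subst (_≤ n) (sym (minList-interval x c)) (<⇒≤ x<n)
... | ds , len , e = ds , len , trans (sym (concat-runs π)) e

-- Lehmer codes

code : List ℕ → List ℕ
code []      = []
code (x ∷ u) = length (filter (_<? x) u) ∷ code u

-- The word of `blocks` with the lengths listed from the smallest start value up. This is the order
-- of `code`, and it suits inductions on the permutation, while `blocks` suits the pairing loop,
-- which starts at the largest block.
blocksUp : ℕ → List ℕ → List ℕ
blocksUp r []       = []
blocksUp r (d ∷ ds) = blocksUp (suc r) ds ++ interval r d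

blocksUp-∷ʳ : ∀ r ds d → blocksUp r (ds ++ d ∷ []) ≡ interval (r + length ds) d ++ blocksUp r ds
blocksUp-∷ʳ r [] d = trans (cong (λ k → interval k d) (sym (+-identityʳ r))) (sym (++-identityʳ _))
blocksUp-∷ʳ r (e ∷ ds) d = trans (cong (_++ interval r e) (trans (blocksUp-∷ʳ (suc r) ds d)
    (cong (λ k → interval k d ++ blocksUp (suc r) ds) (sym (+-suc r (length ds))))))
  (++-assoc (interval (r + suc (length ds)) d) (blocksUp (suc r) ds) (interval r e))

blocks≡blocksUp : ∀ ds → blocks ds ≡ blocksUp 1 (reverse ds)
blocks≡blocksUp [] = refl
blocks≡blocksUp (d ∷ ds) = sym (trans (cong (blocksUp 1) (unfold-reverse d ds))
  (trans (blocksUp-∷ʳ 1 (reverse ds) d)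
         (cong₂ (λ k L → interval (suc k) d ++ L) (length-reverse ds) (sym (blocks≡blocksUp ds)))))

interval-suc : ∀ r c → interval (suc r) c ≡ map suc (interval r c)
interval-suc r zero    = refl
interval-suc r (suc c) = cong (suc r ∷_) (interval-suc (suc r) c)

blocksUp-suc : ∀ r ds → blocksUp (suc r) ds ≡ map suc (blocksUp r ds)
blocksUp-suc r []       = refl
blocksUp-suc r (d ∷ ds) = trans (cong₂ _++_ (blocksUp-suc (suc r) ds) (interval-suc r d))
  (sym (map-++ suc (blocksUp (suc r) ds) (interval r d)))

blocksUp-≥ : ∀ r ds → All (r ≤_) (blocksUp r ds)
blocksUp-≥ r []       = []
blocksUp-≥ r (d ∷ ds) = All.++⁺ (All.map <⇒≤ (blocksUp-≥ (suc r) ds)) (interval-≥ r d)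

foldr-swapAt-suc : ∀ x u β → All (1 ≤_) β → foldr swapAt (x ∷ u) (map suc β) ≡ x ∷ foldr swapAt u β
foldr-swapAt-suc x u [] [] = refl
foldr-swapAt-suc x u (suc b ∷ β) (_ ∷ al) = cong (swapAt (suc (suc b))) (foldr-swapAt-suc x u β al)

foldr-swapAt-↭ : ∀ u β → foldr swapAt u β ↭ u
foldr-swapAt-↭ u []      = ↭-refl
foldr-swapAt-↭ u (b ∷ β) = ↭-trans (swapAt-↭ b (foldr swapAt u β)) (foldr-swapAt-↭ u β)

bring-to-front : ∀ P y Q → foldr swapAt (P ++ y ∷ Q) (interval 1 (length P)) ≡ y ∷ P ++ Q
bring-to-front [] y Q = refl
bring-to-front (p ∷ P) y Q = cong (swapAt 1) (begin
  foldr swapAt (p ∷ P ++ y ∷ Q) (interval 2 (length P))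
    ≡⟨ cong (foldr swapAt (p ∷ P ++ y ∷ Q)) (interval-suc 1 (length P)) ⟩
  foldr swapAt (p ∷ P ++ y ∷ Q) (map suc (interval 1 (length P)))
    ≡⟨ foldr-swapAt-suc p (P ++ y ∷ Q) (interval 1 (length P)) (interval-≥ 1 (length P)) ⟩
  p ∷ foldr swapAt (P ++ y ∷ Q) (interval 1 (length P))
    ≡⟨ cong (p ∷_) (bring-to-front P y Q) ⟩
  p ∷ y ∷ P ++ Q ∎)
  where open ≡-Reasoning

AllPairs-remove : ∀ P {y Q} → AllPairs _<_ (P ++ y ∷ Q) → All (_< y) P × All (y <_) Q × AllPairs _<_ (P ++ Q)
AllPairs-remove [] (p ∷ ap) = [] , p , ap
AllPairs-remove (x ∷ P) (p ∷ ap) with AllPairs-remove P ap | All.++⁻ P p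
... | lows , highs , rest | xP , (x<y ∷ xQ) = x<y ∷ lows , highs , All.++⁺ xP xQ ∷ rest

interval-< : ∀ r d {n} → All (_< n) (interval r d) → r + d ≤ n ⊎ d ≡ 0
interval-< r zero _ = inj₂ refl
interval-< r (suc zero) {n} (p ∷ _) = inj₁ (subst (_≤ n) (+-comm 1 r) p)
interval-< r (suc (suc d)) {n} (_ ∷ ps) with interval-< (suc r) (suc d) ps
... | inj₁ q = inj₁ (subst (_≤ n) (sym (+-suc r (suc d))) q)

split-at : ∀ {A : Set} (xs : List A) d → d < length xs → ∃ λ P → ∃ λ y → ∃ λ Q → xs ≡ P ++ y ∷ Q × length P ≡ d
split-at (x ∷ xs) zero    _       = [] , x , xs , refl , refl
split-at (x ∷ xs) (suc d) (s≤s p) with split-at xs d p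
... | P , y , Q , refl , refl = x ∷ P , y , Q , refl , refl

-- The interval starting at 1 acts first and brings the entry with `d` smaller ones to the front;
-- all other letters are at least 2 and only permute what follows it. The tail of an initial range
-- is in general no range, hence the statement for every increasing `s`.
code-blocksUp : ∀ ds s → AllPairs _<_ s → length ds ≡ length s → All (_< length s) (blocksUp 1 ds) →
  code (foldr swapAt s (blocksUp 1 ds)) ≡ ds
code-blocksUp [] [] _ _ _ = refl
code-blocksUp (d ∷ ds) s@(s₀ ∷ s′) ap len al with split-at s d d<
  where
  d< : d < length s
  d< with interval-< 1 d (All.++⁻ʳ (blocksUp 2 ds) al)
  ... | inj₁ p = p
  ... | inj₂ refl = s≤s z≤n
... | P , y , Q , eq , refl with AllPairs-remove P (subst (AllPairs _<_) eq ap)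
...   | lows , highs , ap′ = begin
  code (foldr swapAt s (blocksUp 2 ds ++ interval 1 (length P)))
    ≡⟨ cong code (foldr-++ swapAt s (blocksUp 2 ds) (interval 1 (length P))) ⟩
  code (foldr swapAt (foldr swapAt s (interval 1 (length P))) (blocksUp 2 ds))
    ≡⟨ cong₂ (λ v β → code (foldr swapAt v β)) (trans (cong (λ v → foldr swapAt v (interval 1 (length P))) eq) (bring-to-front P y Q)) (blocksUp-suc 1 ds) ⟩
  code (foldr swapAt (y ∷ P ++ Q) (map suc β))
    ≡⟨ cong code (foldr-swapAt-suc y (P ++ Q) β (blocksUp-≥ 1 ds)) ⟩
  length (filter (_<? y) (foldr swapAt (P ++ Q) β)) ∷ code (foldr swapAt (P ++ Q) β)
    ≡⟨ cong₂ _∷_ smaller (code-blocksUp ds (P ++ Q) ap′ (trans (suc-injective len) len′) β<) ⟩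
  length P ∷ ds ∎
  where
  open ≡-Reasoning
  β : List ℕ
  β = blocksUp 1 ds
  smaller : length (filter (_<? y) (foldr swapAt (P ++ Q) β)) ≡ length P
  smaller = trans (↭-length (↭.filter-↭ (_<? y) (foldr-swapAt-↭ (P ++ Q) β)))
    (cong length (trans (filter-++ (_<? y) P Q) (trans (cong₂ _++_ (filter-all (_<? y) lows) (filter-none (_<? y) (All.map <⇒≯ highs))) (++-identityʳ P))))
  len′ : length s′ ≡ length (P ++ Q)
  len′ = suc-injective (trans (cong length eq) (length-++-sucʳ P y Q))
  β< : All (_< length (P ++ Q)) β
  β< = subst (λ k → All (_< k) β) len′
    (All.map s≤s⁻¹ (All.map⁻ (subst (All (_< length s)) (blocksUp-suc 1 ds) (All.++⁻ˡ (blocksUp 2 ds) al))))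

SuperYamanouchi⇒code : ∀ {n w π} → IsReduced n w π → SuperYamanouchi π →
  ∃ λ ds → length ds ≡ n × π ≡ blocks ds × reverse ds ≡ code w
SuperYamanouchi⇒code {n} {w} {π} (al , _ , refl) sy with SuperYamanouchi⇒blocks al sy
... | ds , refl , refl = ds , refl , refl , sym (trans
  (cong (λ β → code (foldr swapAt (range1 n) β)) (blocks≡blocksUp ds))
  (code-blocksUp (reverse ds) (range1 n) increasing (trans (length-reverse ds) (sym (length-range1 n)))
    (subst (All _) (blocks≡blocksUp ds) (All.map (λ { (_ , a<n) → subst (_ <_) (sym (length-range1 n)) a<n }) al))))
  where
  increasing : AllPairs _<_ (range1 n)
  increasing = subst (AllPairs _<_) (sym (map-upTo suc n)) (AllPairs.applyUpTo⁺₁ suc n (λ i<j _ → s≤s i<j))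

code-diagramFrom : ∀ i u r → count (λ z → row z ≡ᵇ i + suc r) (diagramFrom (suc i) u) ≡ val (code u) (suc r)
code-diagramFrom i [] r = refl
code-diagramFrom i (x ∷ u) r = trans (count-++ (inRow (i + suc r)) (map (suc i ,_) F) D) (cases r)
  where
  F : List ℕ
  F = filter (_<? x) u
  D : List Cell
  D = diagramFrom (suc (suc i)) u
  inRow : ℕ → Cell → Bool
  inRow k z = row z ≡ᵇ k
  cellAt : ℕ → Cell
  cellAt y = (suc i , y)
  count-all : ∀ L → count (λ _ → true) L ≡ length L
  count-all []      = refl
  count-all (_ ∷ L) = cong suc (count-all L)
  cases : ∀ r → count (λ z → row z ≡ᵇ i + suc r) (map (suc i ,_) F) + count (λ z → row z ≡ᵇ i + suc r) D ≡ val (code (x ∷ u)) (suc r)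
  cases zero rewrite +-comm i 1 = trans (cong₂ _+_
    (trans (count-map (inRow (suc i)) cellAt F) (trans (count-cong F (λ _ → ≡ᵇ-refl i)) (count-all F)))
    (count-none _ D λ {z} z∈ t → <-irrefl (sym (≡ᵇ⇒≡ (row z) (suc i) t)) (diagramFrom-row (suc i) u z∈))) (+-identityʳ _)
  cases (suc r) rewrite +-suc i (suc r) = cong₂ _+_
    (trans (count-map (inRow (suc (i + suc r))) cellAt F) (count-none _ F λ _ t → m≢1+m+n i (trans (≡ᵇ⇒≡ i (i + suc r) t) (+-suc i r))))
    (code-diagramFrom (suc i) u r)

code-diagram : ∀ u r → count (λ z → row z ≡ᵇ suc r) (diagram u) ≡ val (code u) (suc r)
code-diagram = code-diagramFrom 0

-- The pairing algorithm

act-∷ʳ : ∀ P b i → act (P ++ b ∷ []) i ≡ act P (τ b i)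
act-∷ʳ []      b i = refl
act-∷ʳ (t ∷ P) b i = cong (τ t) (act-∷ʳ P b i)

-- Entries of the tableau, largest first, each with its row; g carries positions to their final rows.
entries : (ℕ → ℕ) → List ℕ → List (ℕ × ℕ)
entries g []      = []
entries g (b ∷ σ) = (suc (length σ) , g b) ∷ entries (g ∘ τ b) σ

entries-cong : ∀ {g h} → (∀ i → g i ≡ h i) → ∀ σ → entries g σ ≡ entries h σ
entries-cong e []      = refl
entries-cong e (b ∷ σ) = cong₂ (λ t L → (suc (length σ) , t) ∷ L) (e b) (entries-cong (e ∘ τ b) σ)

inRow : ℕ → List (ℕ × ℕ) → List ℕ
inRow r E = map proj₁ (filterᵇ (λ e → proj₂ e ≡ᵇ r) E)

inRow-accept : ∀ {r j t} E → t ≡ r → inRow r ((j , t) ∷ E) ≡ j ∷ inRow r E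
inRow-accept {r} {j} {t} E e = cong (map proj₁) (filter-accept (λ e → T? (proj₂ e ≡ᵇ r)) {x = j , t} {xs = E} (≡⇒≡ᵇ t r e))

inRow-reject : ∀ {r j t} E → t ≢ r → inRow r ((j , t) ∷ E) ≡ inRow r E
inRow-reject {r} {j} {t} E ne = cong (map proj₁) (filter-reject (λ e → T? (proj₂ e ≡ᵇ r)) {x = j , t} {xs = E} (ne ∘ ≡ᵇ⇒≡ t r))

-- A scan for row `r` is governed by the relative order of the values ending in rows at least `r`.
-- With `g` sending a current position to the final row of its value, `rank g k` counts such values
-- before position `k`.
module Rank (r : ℕ) where

  rank : (ℕ → ℕ) → ℕ → ℕ
  rank g zero    = 0
  rank g (suc k) = indicator (r ≤ᵇ g k) + rank g k

  rank-cong : ∀ {g h} → (∀ i → g i ≡ h i) → ∀ k → rank g k ≡ rank h k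
  rank-cong e zero    = refl
  rank-cong e (suc k) = cong₂ (λ t m → indicator (r ≤ᵇ t) + m) (e k) (rank-cong e k)

  rank-≥ : ∀ g {k} → r ≤ g k → rank g (suc k) ≡ suc (rank g k)
  rank-≥ g h rewrite T⇒true (≤⇒≤ᵇ h) = refl

  rank-< : ∀ g {k} → g k < r → rank g (suc k) ≡ rank g k
  rank-< g {k} h rewrite ¬T⇒false (<⇒≱ h ∘ ≤ᵇ⇒≤ r (g k)) = refl

  -- A prefix contains both exchanged positions or neither of them, unless it ends exactly between
  -- the two.
  rank-τ : ∀ g b k → k ≢ suc b → rank (g ∘ τ b) k ≡ rank g k
  rank-τ g b zero    _  = refl
  rank-τ g b (suc k) ne with k ≟ suc b
  ... | yes refl rewrite τ-left b | τ-right b | rank-τ g b b (λ e → 1+n≢n (sym e)) =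
    x∙yz≈y∙xz (indicator (r ≤ᵇ g b)) (indicator (r ≤ᵇ g (suc b))) (rank g b)
  ... | no  k≢   = cong₂ (λ t m → indicator (r ≤ᵇ g t) + m) (τ-other b k (ne ∘ cong suc) k≢) (rank-τ g b k k≢)

  rank-mono : ∀ g {i j} → i ≤ j → rank g i ≤ rank g j
  rank-mono g {j = j} z≤n = z≤n
  rank-mono g {i} {suc j} i≤j with m≤n⇒m<n∨m≡n i≤j
  ... | inj₁ i<j  = ≤-trans (rank-mono g (s≤s⁻¹ i<j)) (m≤n+m _ _)
  ... | inj₂ refl = ≤-refl

  rank-strict : ∀ g {i j} → i < j → r ≤ g i → rank g i < rank g j
  rank-strict g i<j h = ≤-trans (≤-reflexive (sym (rank-≥ g h))) (rank-mono g i<j)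

  rank-injective : ∀ g {i j} → r ≤ g i → r ≤ g j → rank g i ≡ rank g j → i ≡ j
  rank-injective g {i} {j} p q e with <-cmp i j
  ... | tri< l _ _ = ⊥-elim (<⇒≢ (rank-strict g l p) e)
  ... | tri≈ _ e′ _ = e′
  ... | tri> _ _ l = ⊥-elim (<⇒≢ (rank-strict g l q) (sym e))

  -- The scan reads the word from the left, so it undoes the letters one after another; undoing `b`
  -- replaces `g` by `g ∘ τ b`.
  module Step (g : ℕ → ℕ) (b : ℕ) (g-injective : ∀ {i j} → g i ≡ g j → i ≡ j) (asc : g b < g (suc b)) where

    -- The position `p` follows a value, the one ending in row `r`. Undoing `b` puts a further value
    -- of the class in front of it exactly when the entry of `b` lies in row `r`, since the other
    -- value then ends in a higher row.
    track-row : ∀ {p} → g p ≡ r → ∃ λ p′ → g (τ b p′) ≡ r × rank (g ∘ τ b) p′ ≡ indicator (g b ≡ᵇ r) + rank g p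
    track-row {p} gp with tauView b p
    ... | isL = suc b , trans (cong g (τ-right b)) gp ,
      trans (cong₂ _+_ (cong indicator (T⇒true {r ≤ᵇ g (τ b b)} (≤⇒≤ᵇ (≤-trans (≤-reflexive (sym gp)) (≤-trans (<⇒≤ asc) (≤-reflexive (cong g (sym (τ-left b)))))))))
                       (rank-τ g b b (λ e → 1+n≢n (sym e))))
            (cong (λ t → indicator t + rank g b) (sym (T⇒true (≡⇒≡ᵇ (g b) r gp))))
    ... | isR = b , trans (cong g (τ-left b)) gp ,
      trans (rank-τ g b b (λ e → 1+n≢n (sym e)))
        (trans (sym (rank-< g (subst (g b <_) gp asc)))
               (cong (λ t → indicator t + rank g (suc b)) (sym (≢⇒≡ᵇ (λ e → <⇒≢ asc (trans e (sym gp)))))))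
    ... | isO p≢b p≢1+b = p , trans (cong g (τ-other b p p≢b p≢1+b)) gp ,
      trans (rank-τ g b p p≢1+b)
            (cong (λ t → indicator t + rank g p) (sym (≢⇒≡ᵇ (λ e → p≢b (g-injective (trans gp (sym e)))))))

    -- The position `k` follows a rank and not a value: when two values of the class are exchanged,
    -- `k` stays and changes its occupant. It has to move only if the value taking its place ends
    -- below row `r`.
    track-class : ∀ {k} → r ≤ g k → ¬ (k ≡ suc b × g b < r) → r ≤ g (τ b k) × rank (g ∘ τ b) k ≡ rank g k
    track-class {k} h ne with tauView b k
    ... | isL = ≤-trans h (≤-trans (<⇒≤ asc) (≤-reflexive (cong g (sym (τ-left b))))) , rank-τ g b b (λ e → 1+n≢n (sym e))
    ... | isO p q = ≤-trans h (≤-reflexive (cong g (sym (τ-other b k p q)))) , rank-τ g b k q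
    ... | isR = ≤-trans r≤gb (≤-reflexive (cong g (sym (τ-right b)))) ,
      trans (rank-≥ (g ∘ τ b) {b} (≤-trans h (≤-reflexive (cong g (sym (τ-left b))))))
            (trans (cong suc (rank-τ g b b (λ e → 1+n≢n (sym e)))) (sym (rank-≥ g r≤gb)))
      where
      r≤gb : r ≤ g b
      r≤gb = ≮⇒≥ (λ l → ne (refl , l))

    -- The remaining case: the value of the class moves from `suc b` to `b`, and the scan, meeting
    -- the unpaired letter `b`, lowers its target accordingly.
    track-down : r ≤ g (suc b) → g b < r → r ≤ g (τ b b) × rank (g ∘ τ b) b ≡ rank g (suc b)
    track-down h l = ≤-trans h (≤-reflexive (cong g (sym (τ-left b)))) ,
      trans (rank-τ g b b (λ e → 1+n≢n (sym e))) (sym (rank-< g l))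

elemᵇ⁺ : ∀ {j P} → j ∈ P → elemᵇ j P ≡ true
elemᵇ⁺ {j} {x ∷ P} (here refl) rewrite ≡ᵇ-refl j = refl
elemᵇ⁺ {j} {x ∷ P} (there h) rewrite elemᵇ⁺ h = ∨-zeroʳ (j ≡ᵇ x)

elemᵇ⁻ : ∀ {j P} → j ∉ P → elemᵇ j P ≡ false
elemᵇ⁻ {j} {[]} h = refl
elemᵇ⁻ {j} {x ∷ P} h rewrite ≢⇒≡ᵇ (h ∘ here) = elemᵇ⁻ (h ∘ there)

module _ {ρ P : List ℕ} {j : ℕ} (js : List ℕ) where

  scan-stop : ∀ k → j ∉ P → letter ρ j ≡ k → scan ρ P k (j ∷ js) ≡ just j
  scan-stop k j∉ refl rewrite elemᵇ⁻ j∉ | ≡ᵇ-refl (letter ρ j) = refl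

  scan-paired : ∀ k → j ∈ P → scan ρ P k (j ∷ js) ≡ scan ρ P k js
  scan-paired k j∈ rewrite elemᵇ⁺ j∈ = refl

  scan-down : ∀ k → j ∉ P → letter ρ j ≡ k → scan ρ P (suc k) (j ∷ js) ≡ scan ρ P k js
  scan-down k j∉ refl rewrite elemᵇ⁻ j∉ | ≢⇒≡ᵇ {letter ρ j} {suc (letter ρ j)} (λ e → 1+n≢n (sym e)) | ≡ᵇ-refl (letter ρ j) = refl

  scan-other : ∀ k → letter ρ j ≢ k → letter ρ j ≢ k ∸ 1 → scan ρ P k (j ∷ js) ≡ scan ρ P k js
  scan-other k p q rewrite ≢⇒≡ᵇ p | ≢⇒≡ᵇ q | ∧-zeroʳ (not (elemᵇ j P)) = refl

-- While scanning for the (q+1)-st entry of row r, k is the position of the (q+1)-st among the values that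
-- end up in the rows ≥ r; p is the position of the value that ends up in row r.
module _ {n : ℕ} {ρ P : List ℕ} {r : ℕ} (red : Red n ρ) where

  open Rank r

  scan-row : ∀ Pre σ → ρ ≡ Pre ++ σ → ∀ k p ps {j qs} →
    1 ≤ k → r ≤ act Pre k → act Pre p ≡ r → rank (act Pre) k ≡ length ps + rank (act Pre) p →
    (∀ {i t} → (i , t) ∈ entries (act Pre) σ → r < t → i ∈ P) →
    (∀ {i t} → (i , t) ∈ entries (act Pre) σ → t < r → i ∉ P) →
    inRow r (entries (act Pre) σ) ≡ ps ++ j ∷ qs → All (_∈ P) ps → j ∉ P →
    scan ρ P k (rangeDown (length σ)) ≡ just j
  scan-row Pre [] _ k p [] _ _ _ _ _ _ () _ _
  scan-row Pre [] _ k p (_ ∷ _) _ _ _ _ _ _ () _ _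
  scan-row Pre (b ∷ σ) refl k p ps {j} {qs} 1≤k r≤gk gp rk higher lower row-r ps∈ j∉ = cases (<-cmp (g b) r)
    where
    g : ℕ → ℕ
    g = act Pre
    e : ℕ
    e = suc (length σ)
    asc : g b < g (suc b)
    asc = act-ascent Pre red
    open Step g b (act-injective Pre) asc
    Pre′ : List ℕ
    Pre′ = Pre ++ b ∷ []
    1≤b : 1 ≤ b
    1≤b with Red-++⁻ Pre red
    ... | cons h _ _ _ = h
    letter-e : letter ρ e ≡ b
    letter-e = letter-here Pre b σ
    recurse : ∀ k p ps → 1 ≤ k → r ≤ g (τ b k) → g (τ b p) ≡ r → rank (g ∘ τ b) k ≡ length ps + rank (g ∘ τ b) p →
      inRow r (entries (g ∘ τ b) σ) ≡ ps ++ j ∷ qs → All (_∈ P) ps →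
      scan ρ P k (rangeDown (length σ)) ≡ just j
    recurse k p ps 1≤k r≤ gp rk row-r ps∈ = scan-row Pre′ σ (sym (++-assoc Pre (b ∷ []) σ)) k p ps 1≤k
      (subst (r ≤_) (sym (act-∷ʳ Pre b k)) r≤) (trans (act-∷ʳ Pre b p) gp)
      (trans (rank-cong (act-∷ʳ Pre b) k) (trans rk (cong (length ps +_) (sym (rank-cong (act-∷ʳ Pre b) p)))))
      (λ h → higher (there (subst (_ ∈_) E≡ h))) (λ h → lower (there (subst (_ ∈_) E≡ h)))
      (trans (cong (inRow r) E≡) row-r) ps∈ j∉
      where
      E≡ : entries (act Pre′) σ ≡ entries (g ∘ τ b) σ
      E≡ = entries-cong (act-∷ʳ Pre b) σ
    cases : Tri (g b < r) (g b ≡ r) (r < g b) → scan ρ P k (rangeDown e) ≡ just j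
    no-gain : g b ≢ r → indicator (g b ≡ᵇ r) + rank g p ≡ rank g p
    no-gain ne = cong (λ t → indicator t + rank g p) (≢⇒≡ᵇ ne)
    -- An entry of a higher row is already paired; the scan passes it, and neither rank changes.
    cases (tri> _ ne gt) with track-class r≤gk (λ { (_ , l) → <⇒≯ gt l }) | track-row gp
    ... | r≤ , same | p′ , gp′ , rp′ =
      trans (scan-paired (rangeDown (length σ)) k (higher (here refl) gt))
        (recurse k p′ ps 1≤k r≤ gp′ (trans same (trans rk (cong (length ps +_) (sym (trans rp′ (no-gain ne))))))
          (trans (sym (inRow-reject (entries (g ∘ τ b) σ) ne)) row-r) ps∈)
    cases (tri≈ _ eq _) = found ps ps∈ rk (trans (sym (inRow-accept (entries (g ∘ τ b) σ) eq)) row-r)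
      where
      found : ∀ ps → All (_∈ P) ps → rank g k ≡ length ps + rank g p →
        e ∷ inRow r (entries (g ∘ τ b) σ) ≡ ps ++ j ∷ qs → scan ρ P k (rangeDown e) ≡ just j
      -- With no paired entry of row `r` left to pass, the ranks of `k` and `p` agree; hence both
      -- are `b`, and the scan stops here.
      found [] _ rk row-r with ∷-injective row-r
      ... | refl , _ = scan-stop (rangeDown (length σ)) k j∉ (trans letter-e (trans
              (act-injective Pre (trans eq (sym gp))) (sym (rank-injective g r≤gk (≤-reflexive (sym gp)) rk))))
      -- Passing a paired entry of row `r` shortens `ps` by one and raises the rank of `p` by one,
      -- so the invariant persists.
      found (q ∷ ps) (q∈ ∷ ps∈) rk row-r with ∷-injective row-r
      ... | refl , row-r′ with track-class r≤gk (λ { (_ , l) → <⇒≢ l eq }) | track-row gp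
      ...   | r≤ , same | p′ , gp′ , rp′ =
        trans (scan-paired (rangeDown (length σ)) k q∈)
          (recurse k p′ ps 1≤k r≤ gp′ (trans same (trans rk (trans (sym (+-suc (length ps) (rank g p))) (cong (length ps +_) (sym (trans rp′ (cong (λ t → indicator t + rank g p) (T⇒true (≡⇒≡ᵇ (g b) r eq)))))))))
            row-r′ ps∈)
    -- An entry of a lower row is unpaired, but its letter cannot be `k`, since the value in
    -- position `k` ends in row `r` or higher. It matters only as the letter `k ∸ 1`.
    cases (tri< l ne _) with track-row gp | k ≟ suc b
    ... | p′ , gp′ , rp′ | yes refl =
      let (r≤ , same) = track-down r≤gk l in
      trans (scan-down (rangeDown (length σ)) b (lower (here refl) l) letter-e)
        (recurse b p′ ps 1≤b r≤ gp′ (trans same (trans rk (cong (length ps +_) (sym (trans rp′ (no-gain ne))))))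
          (trans (sym (inRow-reject (entries (g ∘ τ b) σ) ne)) row-r) ps∈)
    ... | p′ , gp′ , rp′ | no k≢ =
      let (r≤ , same) = track-class r≤gk (λ { (h , _) → k≢ h }) in
      trans (scan-other (rangeDown (length σ)) k
              (λ h → <⇒≱ l (subst (λ i → r ≤ g i) (trans (sym h) letter-e) r≤gk))
              (λ h → k≢ (trans (sym (m+[n∸m]≡n 1≤k)) (cong suc (trans (sym h) letter-e)))))
        (recurse k p′ ps 1≤k r≤ gp′ (trans same (trans rk (cong (length ps +_) (sym (trans rp′ (no-gain ne))))))
          (trans (sym (inRow-reject (entries (g ∘ τ b) σ) ne)) row-r) ps∈)

rank-id : ∀ r q → Rank.rank r id (r + q) ≡ q + Rank.rank r id r
rank-id r zero    = cong (Rank.rank r id) (+-identityʳ r)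
rank-id r (suc q) = trans (cong (Rank.rank r id) (+-suc r q))
  (trans (Rank.rank-≥ r id (m≤m+n r q)) (cong suc (rank-id r q)))

pairLoop-just : ∀ {π ρ P k} Pre σ {j} → π ≡ Pre ++ k ∷ σ → scan ρ P k (rangeDown (length ρ)) ≡ just j →
  pairLoop π ρ P (rangeDown (suc (length σ))) ≡ j ∷ pairLoop π ρ (j ∷ P) (rangeDown (length σ))
pairLoop-just {k = k} Pre σ refl s rewrite letter-here Pre k σ | s = refl

map-proj₁-entries : ∀ g σ → map proj₁ (entries g σ) ≡ rangeDown (length σ)
map-proj₁-entries g []      = refl
map-proj₁-entries g (b ∷ σ) = cong (suc (length σ) ∷_) (map-proj₁-entries (g ∘ τ b) σ)

module Pairing {n : ℕ} {ρ : List ℕ} (red : Red n ρ) where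

  E : List (ℕ × ℕ)
  E = entries id ρ

  private
    distinct : AllPairs (λ e e′ → proj₁ e ≢ proj₁ e′) E
    distinct = AllPairs.map⁻ (subst Unique (sym (map-proj₁-entries id ρ))
      (Unique.map⁺ suc-injective (Unique.downFrom⁺ (length ρ))))

    functional : ∀ {L : List (ℕ × ℕ)} → AllPairs (λ e e′ → proj₁ e ≢ proj₁ e′) L →
      ∀ {j t t′} → (j , t) ∈ L → (j , t′) ∈ L → t ≡ t′
    functional (p ∷ ap) (here refl) (here refl) = refl
    functional (p ∷ ap) (here refl) (there h) = ⊥-elim (All.lookup p h refl)
    functional (p ∷ ap) (there h) (here refl) = ⊥-elim (All.lookup p h refl)
    functional (p ∷ ap) (there h) (there h′) = functional ap h h′

    Unique-inRow : ∀ r → Unique (inRow r E)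
    Unique-inRow r = AllPairs.map⁺ (AllPairs.filter⁺ (λ e → T? (proj₂ e ≡ᵇ r)) distinct)

    ∈-inRow⁻ : ∀ {r j} → j ∈ inRow r E → (j , r) ∈ E
    ∈-inRow⁻ {r} h with ∈-map⁻ proj₁ h
    ... | (j , t) , h′ , refl with ∈-filter⁻ (λ e → T? (proj₂ e ≡ᵇ r)) {xs = E} h′
    ...   | e∈ , t≡ = subst (λ t → (j , t) ∈ E) (≡ᵇ⇒≡ t r t≡) e∈

    ∈-inRow⁺ : ∀ {r j} → (j , r) ∈ E → j ∈ inRow r E
    ∈-inRow⁺ {r} h = ∈-map⁺ proj₁ (∈-filter⁺ (λ e → T? (proj₂ e ≡ᵇ r)) h (≡⇒≡ᵇ r r refl))

  -- Within the block of row `r`, `ps` are the entries already paired and `qs` those to come. The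
  -- letter `r + length ps` asks for the value with `length ps` values of the class before it and at
  -- least row `r`, so `scan-row` returns the head of `qs`.
  pair-row : ∀ {π r} → 1 ≤ r → ∀ qs ps {P} Pre rest → π ≡ Pre ++ interval (r + length ps) (length qs) ++ rest →
    inRow r E ≡ ps ++ qs →
    (∀ {i t} → (i , t) ∈ E → r < t → i ∈ P) → (∀ {i t} → (i , t) ∈ E → t < r → i ∉ P) →
    All (_∈ P) ps → All (_∉ P) qs →
    pairLoop π ρ P (rangeDown (length (interval (r + length ps) (length qs) ++ rest)))
      ≡ qs ++ pairLoop π ρ (qs ʳ++ P) (rangeDown (length rest))
  pair-row 1≤r [] ps Pre rest _ _ _ _ _ _ = refl
  pair-row {π} {r} 1≤r (j ∷ qs) ps {P} Pre rest eq row-r higher lower ps∈ (j∉ ∷ qs∉) =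
    trans (pairLoop-just Pre (interval (suc (r + length ps)) (length qs) ++ rest) eq found)
          (cong (j ∷_) next)
    where
    found : scan ρ P (r + length ps) (rangeDown (length ρ)) ≡ just j
    found = scan-row red [] ρ refl (r + length ps) r ps (≤-trans 1≤r (m≤m+n r (length ps))) (m≤m+n r (length ps)) refl
      (rank-id r (length ps)) higher lower row-r ps∈ j∉
    j-row : (j , r) ∈ E
    j-row = ∈-inRow⁻ (subst (j ∈_) (sym row-r) (∈-++⁺ʳ ps (here refl)))
    r+ : suc (r + length ps) ≡ r + length (ps ++ j ∷ [])
    r+ = trans (sym (+-suc r (length ps))) (cong (r +_) (sym (trans (length-++ ps) (+-comm (length ps) 1))))
    fresh : All (j ≢_) qs
    fresh with Unique-++⁻ʳ ps (subst Unique row-r (Unique-inRow r))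
    ... | p ∷ _ = p
    next : pairLoop π ρ (j ∷ P) (rangeDown (length (interval (suc (r + length ps)) (length qs) ++ rest)))
             ≡ qs ++ pairLoop π ρ ((j ∷ qs) ʳ++ P) (rangeDown (length rest))
    next = trans (cong (λ k → pairLoop π ρ (j ∷ P) (rangeDown (length (interval k (length qs) ++ rest)))) r+) (pair-row 1≤r qs (ps ++ j ∷ []) (Pre ++ (r + length ps) ∷ []) rest
      (trans eq (trans (cong (λ k → Pre ++ (r + length ps) ∷ interval k (length qs) ++ rest) r+) (sym (++-assoc Pre ((r + length ps) ∷ []) _))))
      (trans row-r (sym (++-assoc ps (j ∷ []) qs)))
      (λ h l → there (higher h l))
      (λ { h l (here refl) → <⇒≢ l (functional distinct h j-row) ; h l (there m) → lower h l m })
      (All.++⁺ (All.map there ps∈) (here refl ∷ []))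
      (All.zipWith (λ { (ne , ∉P) (here e) → ne (sym e) ; (ne , ∉P) (there m) → ∉P m }) (fresh , qs∉)))

  rowsDown : ℕ → List ℕ
  rowsDown zero    = []
  rowsDown (suc m) = inRow (suc m) E ++ rowsDown m

  RowLengths : List ℕ → Set
  RowLengths []       = ⊤
  RowLengths (d ∷ ds) = d ≡ length (inRow (suc (length ds)) E) × RowLengths ds

  -- The current row is `length ds`. At the start of its block all higher rows have been paired and
  -- no entry of this or a lower row has, which is the state `pair-row` asks for.
  pair-rows : ∀ {π} ds {P} Pre → π ≡ Pre ++ blocks ds → RowLengths ds →
    (∀ {i t} → (i , t) ∈ E → length ds < t → i ∈ P) → (∀ {i t} → (i , t) ∈ E → t ≤ length ds → i ∉ P) →
    pairLoop π ρ P (rangeDown (length (blocks ds))) ≡ rowsDown (length ds)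
  pair-rows [] Pre _ _ _ _ = refl
  pair-rows {π} (d ∷ ds) {P} Pre eq (refl , lens) higher lower = begin
    pairLoop π ρ P (rangeDown (length (interval r d ++ blocks ds)))
      ≡⟨ cong (λ k → pairLoop π ρ P (rangeDown (length (interval k d ++ blocks ds)))) (sym (+-identityʳ r)) ⟩
    pairLoop π ρ P (rangeDown (length (interval (r + 0) d ++ blocks ds)))
      ≡⟨ pair-row {π} {r} (s≤s z≤n) (inRow r E) [] Pre (blocks ds)
           (trans eq (cong (λ k → Pre ++ interval k d ++ blocks ds) (sym (+-identityʳ r)))) refl
           higher (λ h l → lower h (<⇒≤ l)) [] (All.tabulate (λ h → lower (∈-inRow⁻ h) ≤-refl)) ⟩
    inRow r E ++ pairLoop π ρ (inRow r E ʳ++ P) (rangeDown (length (blocks ds)))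
      ≡⟨ cong (inRow r E ++_) (pair-rows ds (Pre ++ interval r d) (trans eq (sym (++-assoc Pre (interval r d) (blocks ds)))) lens higher′ lower′) ⟩
    inRow r E ++ rowsDown (length ds) ∎
    where
    open ≡-Reasoning
    r : ℕ
    r = suc (length ds)
    P′≡ : inRow r E ʳ++ P ≡ reverse (inRow r E) ++ P
    P′≡ = ʳ++-defn (inRow r E)
    higher′ : ∀ {i t} → (i , t) ∈ E → length ds < t → i ∈ inRow r E ʳ++ P
    higher′ {i} h l with m≤n⇒m<n∨m≡n l
    ... | inj₁ l′ = subst (i ∈_) (sym P′≡) (∈-++⁺ʳ (reverse (inRow r E)) (higher h l′))
    ... | inj₂ refl = subst (i ∈_) (sym P′≡) (∈-++⁺ˡ (∈-resp-↭ (↭-sym (↭.↭-reverse (inRow r E))) (∈-inRow⁺ h)))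
    lower′ : ∀ {i t} → (i , t) ∈ E → t ≤ length ds → i ∉ inRow r E ʳ++ P
    lower′ {i} h l m with ∈-++⁻ (reverse (inRow r E)) (subst (i ∈_) P′≡ m)
    ... | inj₁ m′ = <⇒≢ (s≤s l) (functional distinct h (∈-inRow⁻ (∈-resp-↭ (↭.↭-reverse (inRow r E)) m′)))
    ... | inj₂ m′ = lower h (m≤n⇒m≤1+n l) m′

-- Row words

numberDown : {A : Set} → List A → List (ℕ × A)
numberDown []      = []
numberDown (z ∷ Z) = (suc (length Z) , z) ∷ numberDown Z

module _ {A B : Set} where

  numberDown-map : ∀ (f : A → B) Z → numberDown (map f Z) ≡ map (λ e → (proj₁ e , f (proj₂ e))) (numberDown Z)
  numberDown-map f []      = refl
  numberDown-map f (z ∷ Z) = cong₂ (λ k L → (suc k , f z) ∷ L) (length-map f Z) (numberDown-map f Z)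

numbered-reverse : ∀ {A : Set} (Z : List A) → numbered (reverse Z) ≡ reverse (numberDown Z)
numbered-reverse Z = trans (numbered≡numberFrom (reverse Z)) (go Z)
  where
  go : ∀ Z → numberFrom 1 (reverse Z) ≡ reverse (numberDown Z)
  go [] = refl
  go (z ∷ Z) = begin
    numberFrom 1 (reverse (z ∷ Z))                                  ≡⟨ cong (numberFrom 1) (unfold-reverse z Z) ⟩
    numberFrom 1 (reverse Z ++ z ∷ [])                              ≡⟨ numberFrom-++ 1 (reverse Z) (z ∷ []) ⟩
    numberFrom 1 (reverse Z) ++ (suc (length (reverse Z)) , z) ∷ [] ≡⟨ cong₂ (λ L k → L ++ (suc k , z) ∷ []) (go Z) (length-reverse Z) ⟩
    reverse (numberDown Z) ++ (suc (length Z) , z) ∷ []             ≡⟨ unfold-reverse _ (numberDown Z) ⟨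
    reverse (numberDown (z ∷ Z))                                    ∎
    where open ≡-Reasoning

entries≡ : ∀ n g ρ → entries g ρ ≡ map (λ e → (proj₁ e , g (row (proj₂ e)))) (numberDown (cellsOf n ρ))
entries≡ n g []      = refl
entries≡ n g (a ∷ σ) = cong₂ (λ k L → (suc k , g a) ∷ L)
  (sym (trans (length-map (τrow a) (cellsOf n σ)) (length-cellsOf n σ)))
  (trans (entries≡ n (g ∘ τ a) σ) (sym (trans (cong (map _) (numberDown-map (τrow a) (cellsOf n σ))) (sym (map-∘ (numberDown (cellsOf n σ)))))))

inRow-++ : ∀ r L M → inRow r (L ++ M) ≡ inRow r L ++ inRow r M
inRow-++ r L M = trans (cong (map proj₁) (filter-++ (λ e → T? (proj₂ e ≡ᵇ r)) L M))
  (map-++ proj₁ (filterᵇ (λ e → proj₂ e ≡ᵇ r) L) _)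

inRow-reverse : ∀ r L → inRow r (reverse L) ≡ reverse (inRow r L)
inRow-reverse r [] = refl
inRow-reverse r (e ∷ L) = begin
  inRow r (reverse (e ∷ L))                  ≡⟨ cong (inRow r) (unfold-reverse e L) ⟩
  inRow r (reverse L ++ e ∷ [])              ≡⟨ inRow-++ r (reverse L) (e ∷ []) ⟩
  inRow r (reverse L) ++ inRow r (e ∷ [])    ≡⟨ cong (_++ inRow r (e ∷ [])) (inRow-reverse r L) ⟩
  reverse (inRow r L) ++ inRow r (e ∷ [])    ≡⟨ cong (reverse (inRow r L) ++_) (single e) ⟩
  reverse (inRow r L) ++ reverse (inRow r (e ∷ [])) ≡⟨ reverse-++ (inRow r (e ∷ [])) (inRow r L) ⟨
  reverse (inRow r (e ∷ []) ++ inRow r L)    ≡⟨ cong reverse (inRow-++ r (e ∷ []) L) ⟨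
  reverse (inRow r (e ∷ L))                  ∎
  where
  open ≡-Reasoning
  single : ∀ e → inRow r (e ∷ []) ≡ reverse (inRow r (e ∷ []))
  single e with proj₂ e ≡ᵇ r
  ... | true  = refl
  ... | false = refl

rowEntries≡inRow : ∀ T r → rowEntries T r ≡ inRow r (map (λ e → (proj₁ e , row (proj₂ e))) (numbered T))
rowEntries≡inRow T r = go (numbered T)
  where
  go : ∀ (L : List (ℕ × Cell)) →
    map proj₁ (filterᵇ (λ e → row (proj₂ e) ≡ᵇ r) L) ≡ inRow r (map (λ e → (proj₁ e , row (proj₂ e))) L)
  go [] = refl
  go (e ∷ L) with row (proj₂ e) ≡ᵇ r
  ... | true  = cong (proj₁ e ∷_) (go L)
  ... | false = go L

rowEntries-Φ : ∀ n ρ r → rowEntries (Φ n ρ) r ≡ reverse (inRow r (entries id ρ))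
rowEntries-Φ n ρ r = begin
  rowEntries (Φ n ρ) r                                         ≡⟨ rowEntries≡inRow (Φ n ρ) r ⟩
  inRow r (map rowPart (numbered (reverse (cellsOf n ρ))))     ≡⟨ cong (inRow r ∘ map rowPart) (numbered-reverse (cellsOf n ρ)) ⟩
  inRow r (map rowPart (reverse (numberDown (cellsOf n ρ))))   ≡⟨ cong (inRow r) (reverse-map rowPart (numberDown (cellsOf n ρ))) ⟩
  inRow r (reverse (map rowPart (numberDown (cellsOf n ρ))))   ≡⟨ inRow-reverse r (map rowPart (numberDown (cellsOf n ρ))) ⟩
  reverse (inRow r (map rowPart (numberDown (cellsOf n ρ))))   ≡⟨ cong (reverse ∘ inRow r) (entries≡ n id ρ) ⟨
  reverse (inRow r (entries id ρ))                             ∎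
  where
  open ≡-Reasoning
  rowPart : ℕ × Cell → ℕ × ℕ
  rowPart e = (proj₁ e , row (proj₂ e))

length-inRow : ∀ n ρ r → length (inRow r (entries id ρ)) ≡ count (λ z → row z ≡ᵇ r) (cellsOf n ρ)
length-inRow n ρ r = begin
  length (inRow r (entries id ρ))                          ≡⟨ length-map proj₁ (filterᵇ here? (entries id ρ)) ⟩
  length (filterᵇ here? (entries id ρ))                    ≡⟨ count≡length-filterᵇ here? (entries id ρ) ⟩
  count here? (entries id ρ)                               ≡⟨ cong (count here?) (entries≡ n id ρ) ⟩
  count here? (map rowPart (numberDown (cellsOf n ρ)))     ≡⟨ count-map here? rowPart (numberDown (cellsOf n ρ)) ⟩
  count (here? ∘ rowPart) (numberDown (cellsOf n ρ))       ≡⟨ forget (cellsOf n ρ) ⟩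
  count (λ z → row z ≡ᵇ r) (cellsOf n ρ)                   ∎
  where
  open ≡-Reasoning
  here? : ℕ × ℕ → Bool
  here? e = proj₂ e ≡ᵇ r
  rowPart : ℕ × Cell → ℕ × ℕ
  rowPart e = (proj₁ e , row (proj₂ e))
  forget : ∀ Z → count (here? ∘ rowPart) (numberDown Z) ≡ count (λ z → row z ≡ᵇ r) Z
  forget []      = refl
  forget (z ∷ Z) = cong (indicator (row z ≡ᵇ r) +_) (forget Z)

cellsOf-rows : ∀ {n ρ} → Red n ρ → ∀ {z} → z ∈ cellsOf n ρ → 1 ≤ row z × row z ≤ n
cellsOf-rows {n} {ρ} red z∈ with ∈-diagram⁻ (evalWord n ρ) (∈-resp-↭ (cellsOf-↭ red) z∈)
... | 1≤r , j , r<j , j≤ , _ = 1≤r , ≤-trans (<⇒≤ r<j) (subst (j ≤_) (length-evalWord n ρ) j≤)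

range1-∷ʳ : ∀ n → range1 (suc n) ≡ range1 n ++ suc n ∷ []
range1-∷ʳ n = trans (cong (map suc) (sym (upTo-∷ʳ n))) (map-++ suc (upTo n) (n ∷ []))

concatMap-∷ʳ : ∀ {A : Set} (f : ℕ → List A) n → concatMap f (range1 (suc n)) ≡ concatMap f (range1 n) ++ f (suc n)
concatMap-∷ʳ f n = trans (cong (concatMap f) (range1-∷ʳ n))
  (trans (concatMap-++ f (range1 n) (suc n ∷ [])) (cong (concatMap f (range1 n) ++_) (++-identityʳ (f (suc n)))))

val-++ˡ : ∀ u v {i} → i ≤ length u → val (u ++ v) i ≡ val u i
val-++ˡ []      v z≤n = val-0 v
val-++ˡ (x ∷ u) v {zero}        _       = refl
val-++ˡ (x ∷ u) v {suc zero}    _       = refl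
val-++ˡ (x ∷ u) v {suc (suc i)} (s≤s p) = val-++ˡ u v p

val-∷ʳ : ∀ u x → val (u ++ x ∷ []) (suc (length u)) ≡ x
val-∷ʳ []          x = refl
val-∷ʳ (y ∷ [])    x = refl
val-∷ʳ (y ∷ z ∷ u) x = val-∷ʳ (z ∷ u) x

module _ {n : ℕ} {w π ρ : List ℕ} (redπ : IsReduced n w π) (sy : SuperYamanouchi π) (redρ : IsReduced n w ρ) where

  private
    red : Red n ρ
    red = IsReduced⇒Red redρ

    open Pairing red

    row-length : ∀ r → length (inRow (suc r) E) ≡ val (code w) (suc r)
    row-length r = trans (length-inRow n ρ (suc r))
      (trans (count-↭ (λ z → row z ≡ᵇ suc r) (cellsOf-↭ red))
      (trans (code-diagram (evalWord n ρ) r) (cong (λ v → val (code v) (suc r)) (proj₂ (proj₂ redρ)))))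

    rowLengths : ∀ ds → (∀ r → suc r ≤ length ds → val (reverse ds) (suc r) ≡ length (inRow (suc r) E)) → RowLengths ds
    rowLengths [] h = _
    rowLengths (d ∷ ds) h =
      trans (sym (trans (cong₂ val (unfold-reverse d ds) (cong suc (sym (length-reverse ds)))) (val-∷ʳ (reverse ds) d))) (h (length ds) ≤-refl) ,
      rowLengths ds λ r r< → trans (sym (trans (cong (λ u → val u (suc r)) (unfold-reverse d ds))
        (val-++ˡ (reverse ds) (d ∷ []) (subst (suc r ≤_) (sym (length-reverse ds)) r<)))) (h r (m≤n⇒m≤1+n r<))

    rows≤n : ∀ {i t} → (i , t) ∈ E → t ≤ n
    rows≤n {i} {t} h with ∈-map⁻ (λ e → (proj₁ e , row (proj₂ e))) (subst ((i , t) ∈_) (entries≡ n id ρ) h)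
    ... | (j , z) , e∈ , refl = proj₂ (cellsOf-rows red (strip (cellsOf n ρ) e∈))
      where
      strip : ∀ Z {e : ℕ × Cell} → e ∈ numberDown Z → proj₂ e ∈ Z
      strip (_ ∷ _) (here refl) = here refl
      strip (_ ∷ Z) (there h)   = there (strip Z h)

    rowsDown≡ : ∀ m → reverse (rowsDown m) ≡ concatMap (rowEntries (Φ n ρ)) (range1 m)
    rowsDown≡ zero = refl
    rowsDown≡ (suc m) = begin
      reverse (inRow (suc m) E ++ rowsDown m)                                    ≡⟨ reverse-++ (inRow (suc m) E) (rowsDown m) ⟩
      reverse (rowsDown m) ++ reverse (inRow (suc m) E)                          ≡⟨ cong₂ _++_ (rowsDown≡ m) (sym (rowEntries-Φ n ρ (suc m))) ⟩
      concatMap (rowEntries (Φ n ρ)) (range1 m) ++ rowEntries (Φ n ρ) (suc m)    ≡⟨ concatMap-∷ʳ (rowEntries (Φ n ρ)) m ⟨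
      concatMap (rowEntries (Φ n ρ)) (range1 (suc m))                            ∎
      where open ≡-Reasoning

  -- Row lengths depend on `w` only: they form its Lehmer code, which also gives the block lengths
  -- of `π`. Each block is therefore used up by exactly one row.
  permW≡permT-Φ : permW π ρ ≡ permT n (Φ n ρ)
  permW≡permT-Φ with SuperYamanouchi⇒code redπ sy
  ... | ds , len , π≡ , rev = begin
    reverse (pairLoop π ρ [] (rangeDown (length ρ)))
      ≡⟨ cong (λ l → reverse (pairLoop π ρ [] (rangeDown l))) (trans (proj₁ (proj₂ redρ)) (trans (sym (proj₁ (proj₂ redπ))) (cong length π≡))) ⟩
    reverse (pairLoop π ρ [] (rangeDown (length (blocks ds))))
      ≡⟨ cong reverse (pair-rows ds [] π≡ (rowLengths ds (λ r _ → trans (cong (λ u → val u (suc r)) rev) (sym (row-length r))))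
           (λ h l → ⊥-elim (<⇒≱ (subst (_< _) len l) (rows≤n h))) (λ _ _ ())) ⟩
    reverse (rowsDown (length ds))
      ≡⟨ rowsDown≡ (length ds) ⟩
    concatMap (rowEntries (Φ n ρ)) (range1 (length ds))
      ≡⟨ cong (λ m → concatMap (rowEntries (Φ n ρ)) (range1 m)) len ⟩
    permT n (Φ n ρ) ∎
    where open ≡-Reasoning

-- Standardisation

positions : ℕ → List ℕ → ℕ → List ℕ
positions k []       r = []
positions k (x ∷ xs) r = if x ≡ᵇ r then k ∷ positions (suc k) xs r else positions (suc k) xs r

positions-hit : ∀ k x xs → positions k (x ∷ xs) x ≡ k ∷ positions (suc k) xs x
positions-hit k x xs rewrite ≡ᵇ-refl x = refl

positions-miss : ∀ k {x} xs {r} → x ≢ r → positions k (x ∷ xs) r ≡ positions (suc k) xs r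
positions-miss k xs ne rewrite ≢⇒≡ᵇ ne = refl

positions-≥ : ∀ k xs r → All (k ≤_) (positions k xs r)
positions-≥ k [] r = []
positions-≥ k (x ∷ xs) r with x ≡ᵇ r
... | true  = ≤-refl ∷ All.map <⇒≤ (positions-≥ (suc k) xs r)
... | false = All.map <⇒≤ (positions-≥ (suc k) xs r)

length-positions : ∀ k xs r → length (positions k xs r) ≡ count (_≡ᵇ r) xs
length-positions k [] r = refl
length-positions k (x ∷ xs) r with x ≡ᵇ r
... | true  = cong suc (length-positions (suc k) xs r)
... | false = length-positions (suc k) xs r

rowEntries≡positions : ∀ T r → rowEntries T r ≡ positions 1 (map row T) r
rowEntries≡positions T r = trans (cong (λ L → map proj₁ (filterᵇ (λ e → row (proj₂ e) ≡ᵇ r) L)) (numbered≡numberFrom T)) (go 1 T)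
  where
  go : ∀ k T → map proj₁ (filterᵇ (λ e → row (proj₂ e) ≡ᵇ r) (numberFrom k T)) ≡ positions k (map row T) r
  go k [] = refl
  go k (z ∷ T) with row z ≡ᵇ r
  ... | true  = cong (k ∷_) (go (suc k) T)
  ... | false = go (suc k) T

permT≡positions : ∀ n T → permT n T ≡ concatMap (positions 1 (map row T)) (range1 n)
permT≡positions n T = concatMap-cong (rowEntries≡positions T) (range1 n)

positions-injective : ∀ k xs ys → length xs ≡ length ys → (∀ {r} → r ∈ xs → positions k xs r ≡ positions k ys r) → 
  (∀ {r} → r ∈ ys → positions k xs r ≡ positions k ys r) → xs ≡ ys
positions-injective k [] [] _ _ _ = refl
positions-injective k (x ∷ xs) (y ∷ ys) len h h′ with x ≟ y
... | no x≢y = ⊥-elim (<-irrefl refl (All.lookup (positions-≥ (suc k) ys x) (subst (k ∈_) e (here refl))))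
  where
  e : k ∷ positions (suc k) xs x ≡ positions (suc k) ys x
  e = trans (sym (positions-hit k x xs)) (trans (h (here refl)) (positions-miss k ys (x≢y ∘ sym)))
... | yes refl = cong (x ∷_) (positions-injective (suc k) xs ys (suc-injective len) (λ {r} r∈ → strip r (h (there r∈))) (λ {r} r∈ → strip r (h′ (there r∈))))
  where
  strip : ∀ r → positions k (x ∷ xs) r ≡ positions k (x ∷ ys) r → positions (suc k) xs r ≡ positions (suc k) ys r
  strip r e with x ≟ r
  ... | yes refl = proj₂ (∷-injective (trans (sym (positions-hit k x xs)) (trans e (positions-hit k x ys))))
  ... | no ne    = trans (sym (positions-miss k xs ne)) (trans e (positions-miss k ys ne))

++-injective-length : ∀ {A : Set} (xs xs′ : List A) {ys ys′} → length xs ≡ length xs′ →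
  xs ++ ys ≡ xs′ ++ ys′ → xs ≡ xs′ × ys ≡ ys′
++-injective-length []       []         _   e = refl , e
++-injective-length (x ∷ xs) (x′ ∷ xs′) len e with ∷-injective e
... | refl , e′ with ++-injective-length xs xs′ (suc-injective len) e′
...   | refl , e″ = refl , e″

concatMap-injective : ∀ {A : Set} (f g : ℕ → List A) rs → (∀ r → length (f r) ≡ length (g r)) →
  concatMap f rs ≡ concatMap g rs → ∀ {r} → r ∈ rs → f r ≡ g r
concatMap-injective f g (r ∷ rs) len e h with ++-injective-length (f r) (g r) (len r) e
concatMap-injective f g (r ∷ rs) len e (here refl) | p , _ = p
concatMap-injective f g (r ∷ rs) len e (there h)   | _ , q = concatMap-injective f g rs len q h

∈-range1 : ∀ {n r} → 1 ≤ r → r ≤ n → r ∈ range1 n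
∈-range1 (s≤s z≤n) r≤n = ∈-map⁺ suc (∈-upTo⁺ r≤n)

-- Fillings of the same cells have equal row lengths, so the two concatenations can be cut at the
-- same places and compared row by row.
permT-injective : ∀ {n T T′} → T ↭ T′ → (∀ {z} → z ∈ T → 1 ≤ row z × row z ≤ n) →
  permT n T ≡ permT n T′ → map row T ≡ map row T′
permT-injective {n} {T} {T′} T↭ range e = positions-injective 1 (map row T) (map row T′) (↭-length rows↭)
  (λ r∈ → same (inRange r∈)) (λ r∈ → same (inRange (∈-resp-↭ (↭-sym rows↭) r∈)))
  where
  rows↭ : map row T ↭ map row T′
  rows↭ = ↭.map⁺ row T↭
  inRange : ∀ {r} → r ∈ map row T → r ∈ range1 n
  inRange r∈ with ∈-map⁻ row r∈
  ... | z , z∈ , refl = ∈-range1 (proj₁ (range z∈)) (proj₂ (range z∈))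
  same : ∀ {r} → r ∈ range1 n → positions 1 (map row T) r ≡ positions 1 (map row T′) r
  same = concatMap-injective (positions 1 (map row T)) (positions 1 (map row T′)) (range1 n)
    (λ r → trans (length-positions 1 (map row T) r) (trans (count-↭ (_≡ᵇ r) rows↭) (sym (length-positions 1 (map row T′) r))))
    (trans (sym (permT≡positions n T)) (trans e (permT≡positions n T′)))

length-filter-<? : ∀ x u → length (filter (_<? x) u) ≡ count (_<ᵇ x) u
length-filter-<? x [] = refl
length-filter-<? x (y ∷ u) with y <ᵇ x
... | true  = cong suc (length-filter-<? x u)
... | false = length-filter-<? x u

invs-insert-min : ∀ k L M → All (k <_) L → All (k ≤_) M → invs (L ++ k ∷ M) ≡ length L + invs (L ++ M)
invs-insert-min k [] M _ k≤ = cong (_+ invs M) (cong length (filter-none (_<? k) (All.map ≤⇒≯ k≤)))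
invs-insert-min k (l ∷ L) M (k<l ∷ k<) k≤ = begin
  length (filter (_<? l) (L ++ k ∷ M)) + invs (L ++ k ∷ M)
    ≡⟨ cong₂ _+_ (trans (length-filter-<? l (L ++ k ∷ M)) smaller) (invs-insert-min k L M k< k≤) ⟩
  suc (count (_<ᵇ l) (L ++ M)) + (length L + invs (L ++ M))
    ≡⟨ cong suc (x∙yz≈y∙xz (count (_<ᵇ l) (L ++ M)) (length L) (invs (L ++ M))) ⟩
  suc (length L) + (count (_<ᵇ l) (L ++ M) + invs (L ++ M))
    ≡⟨ cong (λ c → suc (length L) + (c + invs (L ++ M))) (length-filter-<? l (L ++ M)) ⟨
  suc (length L) + (length (filter (_<? l) (L ++ M)) + invs (L ++ M)) ∎
  where
  open ≡-Reasoning
  smaller : count (_<ᵇ l) (L ++ k ∷ M) ≡ suc (count (_<ᵇ l) (L ++ M))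
  smaller = trans (count-↭ (_<ᵇ l) (↭.shift k L M)) (cong (λ b → indicator b + count (_<ᵇ l) (L ++ M)) (T⇒true (<⇒<ᵇ k<l)))

length-concatMap-positions : ∀ k m xs → All (1 ≤_) xs → length (concatMap (positions k xs) (range1 m)) ≡ count (_<ᵇ suc m) xs
length-concatMap-positions k zero xs ≥1 = sym (count-none (_<ᵇ 1) xs λ {x} x∈ t → <⇒≱ (<ᵇ⇒< x 1 t) (All.lookup ≥1 x∈))
length-concatMap-positions k (suc m) xs ≥1 = begin
  length (concatMap f (range1 (suc m)))              ≡⟨ cong length (concatMap-∷ʳ f m) ⟩
  length (concatMap f (range1 m) ++ f (suc m))       ≡⟨ length-++ (concatMap f (range1 m)) ⟩
  length (concatMap f (range1 m)) + length (f (suc m)) ≡⟨ cong₂ _+_ (length-concatMap-positions k m xs ≥1) (length-positions k xs (suc m)) ⟩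
  count (_<ᵇ suc m) xs + count (_≡ᵇ suc m) xs        ≡⟨ count-+ xs (λ {x} _ → split x) ⟨
  count (_<ᵇ suc (suc m)) xs                         ∎
  where
  open ≡-Reasoning
  f : ℕ → List ℕ
  f = positions k xs
  split : ∀ x → indicator (x <ᵇ suc (suc m)) ≡ indicator (x <ᵇ suc m) + indicator (x ≡ᵇ suc m)
  split x with <-cmp x (suc m)
  ... | tri< l ne _ rewrite T⇒true (<⇒<ᵇ l) | T⇒true (<⇒<ᵇ (m<n⇒m<1+n l)) | ≢⇒≡ᵇ ne = refl
  ... | tri≈ nl refl _ rewrite T⇒true (<⇒<ᵇ (n<1+n m)) | ¬T⇒false (nl ∘ <ᵇ⇒< (suc m) (suc m)) | ≡ᵇ-refl m = refl
  ... | tri> nl ne gt rewrite ¬T⇒false (nl ∘ <ᵇ⇒< x (suc m)) | ≢⇒≡ᵇ ne | ¬T⇒false (λ t → <⇒≱ gt (s≤s⁻¹ (<ᵇ⇒< x (suc (suc m)) t))) = refl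

range1-split : ∀ n m → suc m ≤ n → ∃ λ hi → range1 n ≡ range1 m ++ suc m ∷ hi × All (suc m <_) hi
range1-split (suc n) m (s≤s m≤n) with m≤n⇒m<n∨m≡n m≤n
... | inj₂ refl = [] , range1-∷ʳ n , []
... | inj₁ m<n with range1-split n m m<n
...   | hi , e , hi> = hi ++ suc n ∷ [] ,
  trans (range1-∷ʳ n) (trans (cong (_++ suc n ∷ []) e) (++-assoc (range1 m) (suc m ∷ hi) (suc n ∷ []))) ,
  All.++⁺ hi> (s≤s m<n ∷ [])

-- The concatenation is the inverse of the standardisation of `xs`, and inversion does not change
-- the number of inversions. In the induction the index `k` of the first letter is the minimum; it
-- is inverted with everything before it, namely the indices of the smaller letters.
invs-concatMap-positions : ∀ n k xs → All (λ x → 1 ≤ x × x ≤ n) xs →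
  invs (concatMap (positions k xs) (range1 n)) ≡ invs xs
invs-concatMap-positions n k [] _ = cong invs (empty (range1 n))
  where
  empty : ∀ rs → concatMap (positions k []) rs ≡ []
  empty []       = refl
  empty (r ∷ rs) = empty rs
invs-concatMap-positions n k (suc m ∷ xs) ((_ , m<n) ∷ al) with range1-split n m m<n
... | hi , e , hi> = begin
  invs (concatMap f (range1 n))
    ≡⟨ cong (invs ∘ concatMap f) e ⟩
  invs (concatMap f (range1 m ++ suc m ∷ hi))
    ≡⟨ cong invs (concatMap-++ f (range1 m) (suc m ∷ hi)) ⟩
  invs (concatMap f (range1 m) ++ f (suc m) ++ concatMap f hi)
    ≡⟨ cong invs (cong₂ _++_ (agree (range1 m) low) (cong₂ _++_ (positions-hit k (suc m) xs) (agree hi high))) ⟩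
  invs (L ++ k ∷ g (suc m) ++ M)
    ≡⟨ invs-insert-min k L (g (suc m) ++ M) (above (range1 m)) (All.++⁺ (All.map <⇒≤ (positions-≥ (suc k) xs (suc m))) (All.map <⇒≤ (above hi))) ⟩
  length L + invs (L ++ g (suc m) ++ M)
    ≡⟨ cong₂ (λ a b → a + invs b) (trans (length-concatMap-positions (suc k) m xs (All.map proj₁ al)) (sym (length-filter-<? (suc m) xs)))
         (sym (trans (cong (concatMap g) e) (concatMap-++ g (range1 m) (suc m ∷ hi)))) ⟩
  length (filter (_<? suc m) xs) + invs (concatMap g (range1 n))
    ≡⟨ cong (length (filter (_<? suc m) xs) +_) (invs-concatMap-positions n (suc k) xs al) ⟩
  length (filter (_<? suc m) xs) + invs xs ∎
  where
  open ≡-Reasoning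
  f g : ℕ → List ℕ
  f = positions k (suc m ∷ xs)
  g = positions (suc k) xs
  L M : List ℕ
  L = concatMap g (range1 m)
  M = concatMap g hi
  agree : ∀ rs → All (suc m ≢_) rs → concatMap f rs ≡ concatMap g rs
  agree []       []        = refl
  agree (r ∷ rs) (ne ∷ al) = cong₂ _++_ (positions-miss k xs ne) (agree rs al)
  low : All (suc m ≢_) (range1 m)
  low = All.tabulate λ r∈ e′ → let (i , i∈ , e″) = ∈-map⁻ suc r∈ in
    <-irrefl (suc-injective (trans (sym e″) (sym e′))) (∈-upTo⁻ i∈)
  high : All (suc m ≢_) hi
  high = All.map <⇒≢ hi>
  above : ∀ rs → All (k <_) (concatMap g rs)
  above []       = []
  above (r ∷ rs) = All.++⁺ (positions-≥ (suc k) xs r) (above rs)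

invs-permT : ∀ n T → (∀ {z} → z ∈ T → 1 ≤ row z × row z ≤ n) → invs (permT n T) ≡ invs (map row T)
invs-permT n T range = trans (cong invs (permT≡positions n T))
  (invs-concatMap-positions n 1 (map row T) (All.map⁺ (All.tabulate range)))

-- Inversion numbers

-- The inversions of the row word that `invT` leaves out. By `sum-word` this number is also the sum
-- of the differences of the letters of `π` and `ρ`, so it cancels in `invW`.
columnInvs : List Cell → ℕ
columnInvs []      = 0
columnInvs (z ∷ Z) = count (aboveᵇ z) Z + columnInvs Z

invT-∷ʳ : ∀ T z → invT (T ++ z ∷ []) ≡ invT T + count (λ x → (row z <ᵇ row x) ∧ not (col x ≡ᵇ col z)) T
invT-∷ʳ [] z = refl
invT-∷ʳ (x ∷ T) z = begin
  length (filterᵇ p (T ++ z ∷ [])) + invT (T ++ z ∷ [])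
    ≡⟨ cong₂ _+_ (trans (count≡length-filterᵇ p (T ++ z ∷ [])) (count-++ p T (z ∷ []))) (invT-∷ʳ T z) ⟩
  (count p T + (indicator (p z) + 0)) + (invT T + count q T)
    ≡⟨ interchange (count p T) _ (invT T) _ ⟩
  (count p T + invT T) + ((indicator (p z) + 0) + count q T)
    ≡⟨ cong₂ (λ a b → (a + invT T) + (b + count q T)) (sym (count≡length-filterᵇ p T)) (+-identityʳ (indicator (p z))) ⟩
  (length (filterᵇ p T) + invT T) + (indicator (p z) + count q T) ∎
  where
  open ≡-Reasoning
  p q : Cell → Bool
  p y = (row y <ᵇ row x) ∧ not (col x ≡ᵇ col y)
  q x = (row z <ᵇ row x) ∧ not (col x ≡ᵇ col z)

invs-∷ʳ : ∀ u z → invs (u ++ z ∷ []) ≡ invs u + count (z <ᵇ_) u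
invs-∷ʳ [] z = refl
invs-∷ʳ (x ∷ u) z = begin
  length (filter (_<? x) (u ++ z ∷ [])) + invs (u ++ z ∷ [])
    ≡⟨ cong₂ _+_ (trans (length-filter-<? x (u ++ z ∷ [])) (count-++ (_<ᵇ x) u (z ∷ []))) (invs-∷ʳ u z) ⟩
  (count (_<ᵇ x) u + (indicator (z <ᵇ x) + 0)) + (invs u + count (z <ᵇ_) u)
    ≡⟨ interchange (count (_<ᵇ x) u) _ (invs u) _ ⟩
  (count (_<ᵇ x) u + invs u) + ((indicator (z <ᵇ x) + 0) + count (z <ᵇ_) u)
    ≡⟨ cong₂ (λ a b → (a + invs u) + (b + count (z <ᵇ_) u)) (sym (length-filter-<? x u)) (+-identityʳ (indicator (z <ᵇ x))) ⟩
  (length (filter (_<? x) u) + invs u) + (indicator (z <ᵇ x) + count (z <ᵇ_) u) ∎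
  where open ≡-Reasoning

invs-rows : ∀ Z → invs (map row (reverse Z)) ≡ invT (reverse Z) + columnInvs Z
invs-rows [] = refl
invs-rows (z ∷ Z) = begin
  invs (map row (reverse (z ∷ Z)))
    ≡⟨ cong (invs ∘ map row) (unfold-reverse z Z) ⟩
  invs (map row (reverse Z ++ z ∷ []))
    ≡⟨ trans (cong invs (map-++ row (reverse Z) (z ∷ []))) (invs-∷ʳ (map row (reverse Z)) (row z)) ⟩
  invs (map row (reverse Z)) + count (row z <ᵇ_) (map row (reverse Z))
    ≡⟨ cong₂ _+_ (invs-rows Z) (trans (count-map (row z <ᵇ_) row (reverse Z)) (count-+ (reverse Z) (λ {x} _ → split x))) ⟩
  (invT (reverse Z) + columnInvs Z) + (count q (reverse Z) + count (aboveᵇ z) (reverse Z))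
    ≡⟨ interchange (invT (reverse Z)) (columnInvs Z) (count q (reverse Z)) (count (aboveᵇ z) (reverse Z)) ⟩
  (invT (reverse Z) + count q (reverse Z)) + (columnInvs Z + count (aboveᵇ z) (reverse Z))
    ≡⟨ cong₂ _+_ (trans (sym (invT-∷ʳ (reverse Z) z)) (cong invT (sym (unfold-reverse z Z))))
                 (trans (cong (columnInvs Z +_) (count-reverse (aboveᵇ z) Z)) (+-comm (columnInvs Z) (count (aboveᵇ z) Z))) ⟩
  invT (reverse (z ∷ Z)) + columnInvs (z ∷ Z) ∎
  where
  open ≡-Reasoning
  q : Cell → Bool
  q x = (row z <ᵇ row x) ∧ not (col x ≡ᵇ col z)
  split : ∀ x → indicator (row z <ᵇ row x) ≡ indicator (q x) + indicator (aboveᵇ z x)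
  split x with row z <ᵇ row x | col x ≡ᵇ col z
  ... | true  | true  = refl
  ... | true  | false = refl
  ... | false | true  = refl
  ... | false | false = refl

-- The new entry has no entry above it in its column, and by `above-Z⁺` each cell counted by `gainᵇ`
-- acquires one smaller entry above it while no other cell does.
columnInvs-step : ∀ {n a σ} → (1≤a : 1 ≤ a) (a<n : a < n) (lt : val (evalWord n σ) a < val (evalWord n σ) (suc a)) (r : Red n σ) →
  columnInvs (cellsOf n (a ∷ σ)) ≡
    count (λ z → (row z ≡ᵇ suc a) ∧ (col z <ᵇ val (evalWord n σ) a)) (cellsOf n σ) + columnInvs (cellsOf n σ)
columnInvs-step {n} {a} {σ} 1≤a a<n lt r =
  trans (cong (_+ columnInvs (map (τrow a) Z)) above-new) (go [] Z refl)
  where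
  Z : List Cell
  Z = cellsOf n σ
  open Ascent a (evalWord n σ) Z (Unique-evalWord n σ) 1≤a
    (subst (a <_) (sym (length-evalWord n σ)) a<n) lt (cellsOf-↭ r)
  ordered : LowBeforeHigh
  ordered = Crossing<⇒LowBeforeHigh (Bal⇒Crossing< (cellsOf-Bal r))
  go : ∀ B Y → Z ≡ B ++ Y → columnInvs (map (τrow a) Y) ≡ count gainᵇ Y + columnInvs Y
  go B [] _ = refl
  go B (z ∷ Y) e = trans (cong₂ _+_ (above-Z⁺ ordered B z Y e) (go (B ++ z ∷ []) Y (trans e (sym (++-assoc B (z ∷ []) Y)))))
    (interchange (indicator (gainᵇ z)) (count (aboveᵇ z) Y) (count gainᵇ Y) (columnInvs Y))

-- The counted cells are the values after both positions that are below `val u (suc a)`. The cut of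
-- the upper row at the larger of the two values is harmless, and this larger value does not enter
-- the code of the smaller one.
gain-diagramFrom : ∀ a i u → suc a < length u → val u (suc a) < val u (suc (suc a)) →
  count (λ z → (row z ≡ᵇ suc (a + suc i)) ∧ (col z <ᵇ val u (suc a))) (diagramFrom (suc i) u) ≡ val (code u) (suc a)
gain-diagramFrom zero i (x ∷ []) (s≤s ()) lt
gain-diagramFrom zero i (x ∷ y ∷ u) _ x<y = begin
  count p (map (suc i ,_) (filter (_<? x) (y ∷ u)) ++ F ++ D)
    ≡⟨ trans (count-++ p (map (suc i ,_) (filter (_<? x) (y ∷ u))) (F ++ D)) (cong₂ _+_ first (count-++ p F D)) ⟩
  count p F + count p D
    ≡⟨ cong₂ _+_ second third ⟩
  count (_<ᵇ x) u + 0
    ≡⟨ +-identityʳ _ ⟩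
  count (_<ᵇ x) u
    ≡⟨ length-filter-<? x u ⟨
  length (filter (_<? x) u)
    ≡⟨ cong length (filter-reject (_<? x) {x = y} {xs = u} (<⇒≯ x<y)) ⟨
  length (filter (_<? x) (y ∷ u)) ∎
  where
  open ≡-Reasoning
  p : Cell → Bool
  p z = (row z ≡ᵇ suc (suc i)) ∧ (col z <ᵇ x)
  F D : List Cell
  F = map (suc (suc i) ,_) (filter (_<? y) u)
  D = diagramFrom (suc (suc (suc i))) u
  first : count p (map (suc i ,_) (filter (_<? x) (y ∷ u))) ≡ 0
  first = count-none p (map (suc i ,_) (filter (_<? x) (y ∷ u))) λ z∈ t → let (_ , _ , e) = ∈-map⁻ (suc i ,_) z∈ in
    1+n≢n (sym (trans (sym (cong row e)) (≡ᵇ⇒≡ _ (suc (suc i)) (proj₁ (Equivalence.to T-∧ t)))))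
  third : count p D ≡ 0
  third = count-none p D λ {z} z∈ t →
    <-irrefl (sym (≡ᵇ⇒≡ (row z) (suc (suc i)) (proj₁ (Equivalence.to T-∧ t)))) (diagramFrom-row (suc (suc i)) u z∈)
  below : ∀ u → count (_<ᵇ x) (filter (_<? y) u) ≡ count (_<ᵇ x) u
  below [] = refl
  below (v ∷ u) with v <ᵇ y in v<y
  ... | true  = cong (indicator (v <ᵇ x) +_) (below u)
  ... | false rewrite ¬T⇒false (λ t → subst T v<y (<⇒<ᵇ (<-trans (<ᵇ⇒< v x t) x<y))) = below u
  second : count p F ≡ count (_<ᵇ x) u
  second = trans (count-map p (suc (suc i) ,_) (filter (_<? y) u))
    (trans (count-cong (filter (_<? y) u) (λ {v} _ → cong (_∧ (v <ᵇ x)) (≡ᵇ-refl i))) (below u))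
gain-diagramFrom (suc a) i (x ∷ u) (s≤s p) lt = begin
  count q (map (suc i ,_) (filter (_<? x) u) ++ diagramFrom (suc (suc i)) u)
    ≡⟨ trans (count-++ q (map (suc i ,_) (filter (_<? x) u)) (diagramFrom (suc (suc i)) u)) (cong (_+ count q (diagramFrom (suc (suc i)) u)) first) ⟩
  count q (diagramFrom (suc (suc i)) u)
    ≡⟨ cong (λ k → count (λ z → (row z ≡ᵇ suc k) ∧ (col z <ᵇ val u (suc a))) (diagramFrom (suc (suc i)) u)) (+-suc a (suc i)) ⟨
  count (λ z → (row z ≡ᵇ suc (a + suc (suc i))) ∧ (col z <ᵇ val u (suc a))) (diagramFrom (suc (suc i)) u)
    ≡⟨ gain-diagramFrom a (suc i) u p lt ⟩
  val (code u) (suc a) ∎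
  where
  open ≡-Reasoning
  q : Cell → Bool
  q z = (row z ≡ᵇ suc (suc a + suc i)) ∧ (col z <ᵇ val u (suc a))
  first : count q (map (suc i ,_) (filter (_<? x) u)) ≡ 0
  first = count-none q (map (suc i ,_) (filter (_<? x) u)) λ z∈ t → let (_ , _ , e) = ∈-map⁻ (suc i ,_) z∈ in
    <⇒≢ (s≤s (≤-trans (m≤n+m (suc i) a) (n≤1+n _))) (trans (sym (cong row e)) (≡ᵇ⇒≡ _ (suc (suc a + suc i)) (proj₁ (Equivalence.to T-∧ t))))

sum-interval-suc : ∀ r c → sum (interval (suc r) c) ≡ c + sum (interval r c)
sum-interval-suc r zero    = refl
sum-interval-suc r (suc c) = begin
  suc r + sum (interval (suc (suc r)) c)  ≡⟨ cong (suc r +_) (sum-interval-suc (suc r) c) ⟩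
  suc r + (c + sum (interval (suc r) c))  ≡⟨ cong suc (x∙yz≈y∙xz r c _) ⟩
  suc c + (r + sum (interval (suc r) c))  ∎
  where open ≡-Reasoning

-- At an ascent the neighbouring code entries C, D become D + 1, C. The block of length D keeps its
-- letters and gets the starting letter of the lower block in front, here `a + r`; the block of
-- length C moves up by one in every letter, which adds C.
sum-blocksUp-swapAt : ∀ a r u → suc a < length u → val u (suc a) < val u (suc (suc a)) →
  sum (blocksUp r (code (swapAt (suc a) u))) ≡ (a + r) + (val (code u) (suc a) + sum (blocksUp r (code u)))
sum-blocksUp-swapAt zero r (x ∷ []) (s≤s ()) lt
sum-blocksUp-swapAt zero r (x ∷ y ∷ u) _ x<y
  rewrite cong length (filter-accept (_<? y) {x = x} {xs = u} x<y)
        | cong length (filter-reject (_<? x) {x = y} {xs = u} (<⇒≯ x<y)) = begin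
  sum ((S ++ interval (suc r) C) ++ interval r (suc D))
    ≡⟨ trans (sum-++ (S ++ interval (suc r) C) (interval r (suc D))) (cong (_+ sum (interval r (suc D))) (sum-++ S (interval (suc r) C))) ⟩
  (sum S + sum (interval (suc r) C)) + (r + sum (interval (suc r) D))
    ≡⟨ cong (λ k → (sum S + k) + (r + sum (interval (suc r) D))) (sum-interval-suc r C) ⟩
  (sum S + (C + sum (interval r C))) + (r + sum (interval (suc r) D))
    ≡⟨ rearrange (sum S) C (sum (interval r C)) r (sum (interval (suc r) D)) ⟩
  r + (C + ((sum S + sum (interval (suc r) D)) + sum (interval r C)))
    ≡⟨ cong (λ k → r + (C + k)) (trans (sum-++ (S ++ interval (suc r) D) (interval r C)) (cong (_+ sum (interval r C)) (sum-++ S (interval (suc r) D)))) ⟨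
  r + (C + sum ((S ++ interval (suc r) D) ++ interval r C)) ∎
  where
  open ≡-Reasoning
  C D : ℕ
  C = length (filter (_<? x) u)
  D = length (filter (_<? y) u)
  S : List ℕ
  S = blocksUp (suc (suc r)) (code u)
  rearrange : ∀ s c i r j → (s + (c + i)) + (r + j) ≡ r + (c + ((s + j) + i))
  rearrange = solve-∀
sum-blocksUp-swapAt (suc a) r (x ∷ u) (s≤s p) lt = begin
  sum (blocksUp (suc r) (code (swapAt (suc a) u)) ++ interval r (length (filter (_<? x) (swapAt (suc a) u))))
    ≡⟨ cong (λ k → sum (blocksUp (suc r) (code (swapAt (suc a) u)) ++ interval r k)) (↭-length (↭.filter-↭ (_<? x) (swapAt-↭ (suc a) u))) ⟩
  sum (blocksUp (suc r) (code (swapAt (suc a) u)) ++ I)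
    ≡⟨ trans (sum-++ (blocksUp (suc r) (code (swapAt (suc a) u))) I) (cong (_+ sum I) (sum-blocksUp-swapAt a (suc r) u p lt)) ⟩
  ((a + suc r) + (C + sum (blocksUp (suc r) (code u)))) + sum I
    ≡⟨ rearrange a r C (sum (blocksUp (suc r) (code u))) (sum I) ⟩
  (suc a + r) + (C + (sum (blocksUp (suc r) (code u)) + sum I))
    ≡⟨ cong (λ k → (suc a + r) + (C + k)) (sum-++ (blocksUp (suc r) (code u)) I) ⟨
  (suc a + r) + (C + sum (blocksUp (suc r) (code u) ++ I)) ∎
  where
  open ≡-Reasoning
  C : ℕ
  C = val (code u) (suc a)
  I : List ℕ
  I = interval r (length (filter (_<? x) u))
  rearrange : ∀ a r c s i → ((a + suc r) + (c + s)) + i ≡ (suc a + r) + (c + (s + i))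
  rearrange = solve-∀

length-blocksUp : ∀ r u → length (blocksUp r (code u)) ≡ invs u
length-blocksUp r [] = refl
length-blocksUp r (x ∷ u) = trans (length-++ (blocksUp (suc r) (code u)))
  (trans (cong₂ _+_ (length-blocksUp (suc r) u) (length-interval r _)) (+-comm (invs u) _))

-- A letter a adds a + C on the left, with C the code entry at its position; on the right a goes to
-- the sum of the word, and C to the columns.
sum-word : ∀ {n ρ} → Red n ρ → sum (blocksUp 1 (code (evalWord n ρ))) ≡ sum ρ + columnInvs (cellsOf n ρ)
sum-word {n} [] = cong sum (length≡0⇒[] (blocksUp 1 (code (range1 n))) (trans (length-blocksUp 1 (range1 n)) (invs-range1 n)))
sum-word {n} {suc a ∷ σ} (cons 1≤a a<n lt r) = begin
  sum (blocksUp 1 (code (swapAt (suc a) u)))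
    ≡⟨ sum-blocksUp-swapAt a 1 u a<u lt ⟩
  (a + 1) + (C + sum (blocksUp 1 (code u)))
    ≡⟨ cong₂ (λ k s → k + (C + s)) (+-comm a 1) (sum-word r) ⟩
  suc a + (C + (sum σ + columnInvs Z))
    ≡⟨ rearrange (suc a) C (sum σ) (columnInvs Z) ⟩
  (suc a + sum σ) + (C + columnInvs Z)
    ≡⟨ cong (λ k → (suc a + sum σ) + (k + columnInvs Z)) gains ⟨
  (suc a + sum σ) + (count p Z + columnInvs Z)
    ≡⟨ cong ((suc a + sum σ) +_) (columnInvs-step 1≤a a<n lt r) ⟨
  (suc a + sum σ) + columnInvs (cellsOf n (suc a ∷ σ)) ∎
  where
  open ≡-Reasoning
  u : List ℕ
  u = evalWord n σ
  Z : List Cell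
  Z = cellsOf n σ
  C : ℕ
  C = val (code u) (suc a)
  a<u : suc a < length u
  a<u = subst (suc a <_) (sym (length-evalWord n σ)) a<n
  p : Cell → Bool
  p z = (row z ≡ᵇ suc (suc a)) ∧ (col z <ᵇ val u (suc a))
  gains : count p Z ≡ C
  gains = trans (count-↭ p (cellsOf-↭ r)) (subst (λ k → count (λ z → (row z ≡ᵇ suc k) ∧ (col z <ᵇ val u (suc a))) (diagram u) ≡ C)
    (+-comm a 1) (gain-diagramFrom a 0 u a<u lt))
  rearrange : ∀ a c s f → a + (c + (s + f)) ≡ (a + s) + (c + f)
  rearrange = solve-∀

open import Data.Integer.Base as ℤ using (+_)
import Data.Integer.Properties as ℤ

pos-cancel : ∀ m k → (+ (m + k)) ℤ.- (+ k) ≡ + m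
pos-cancel m k = trans (ℤ.m-n≡m⊖n (m + k) k) (trans (ℤ.⊖-≥ (m≤n+m k m)) (cong +_ (m+n∸n≡m m k)))

invW≡invT-Φ : ∀ {n w π ρ} → IsReduced n w π → SuperYamanouchi π → IsReduced n w ρ → + invT (Φ n ρ) ≡ invW π ρ
invW≡invT-Φ {n} {w} {π} {ρ} redπ sy redρ = sym (begin
  (+ invs (permW π ρ)) ℤ.- ((+ sum π) ℤ.- (+ sum ρ))
    ≡⟨ cong₂ (λ a b → (+ a) ℤ.- ((+ b) ℤ.- (+ sum ρ))) perm-invs π-sum ⟩
  (+ (invT (Φ n ρ) + f)) ℤ.- ((+ (f + sum ρ)) ℤ.- (+ sum ρ))
    ≡⟨ cong (λ k → (+ (invT (Φ n ρ) + f)) ℤ.- k) (pos-cancel f (sum ρ)) ⟩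
  (+ (invT (Φ n ρ) + f)) ℤ.- (+ f)
    ≡⟨ pos-cancel (invT (Φ n ρ)) f ⟩
  + invT (Φ n ρ) ∎)
  where
  open ≡-Reasoning
  red : Red n ρ
  red = IsReduced⇒Red redρ
  f : ℕ
  f = columnInvs (cellsOf n ρ)
  perm-invs : invs (permW π ρ) ≡ invT (Φ n ρ) + f
  perm-invs = trans (cong invs (permW≡permT-Φ redπ sy redρ))
    (trans (invs-permT n (Φ n ρ) (λ z∈ → cellsOf-rows red (∈-resp-↭ (↭.↭-reverse (cellsOf n ρ)) z∈))) (invs-rows (cellsOf n ρ)))
  π-sum : sum π ≡ f + sum ρ
  π-sum with SuperYamanouchi⇒code redπ sy
  ... | ds , _ , π≡ , rev = begin
    sum π                                   ≡⟨ cong sum (trans π≡ (blocks≡blocksUp ds)) ⟩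
    sum (blocksUp 1 (reverse ds))           ≡⟨ cong (λ c → sum (blocksUp 1 c)) rev ⟩
    sum (blocksUp 1 (code w))               ≡⟨ cong (λ v → sum (blocksUp 1 (code v))) (proj₂ (proj₂ redρ)) ⟨
    sum (blocksUp 1 (code (evalWord n ρ)))  ≡⟨ sum-word red ⟩
    sum ρ + f                               ≡⟨ +-comm (sum ρ) f ⟩
    f + sum ρ                               ∎

-- The poset isomorphism

module _ {n : ℕ} {w π : List ℕ} (pw : IsPerm n w) (redπ : IsReduced n w π) (sy : SuperYamanouchi π) where

  private
    rank : ∀ {ρ} → IsReduced n w ρ → + invT (Φ n ρ) ≡ invW π ρ
    rank = invW≡invT-Φ redπ sy

    pos-suc : ∀ m → + suc m ≡ (+ m) ℤ.+ ℤ.1ℤ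
    pos-suc m = cong +_ (+-comm 1 m)

  CoverW⇒CoverT : ∀ {X Y} → CoverW π n w X Y → CoverT w (Φ n X) (Φ n Y)
  CoverW⇒CoverT {X} {Y} (rX , rY , i , move , up) = Φ-SBT rX , Φ-SBT rY , i , moved move ,
    ℤ.+-injective (trans (rank rY) (trans up (trans (cong (ℤ._+ ℤ.1ℤ) (sym (rank rX))) (sym (pos-suc _)))))
    where
    moved : Y ≡ cW i X ⊎ Y ≡ bW i X → Φ n Y ≡ cT i (Φ n X) ⊎ Φ n Y ≡ bT i (Φ n X)
    moved (inj₁ refl) = inj₁ (Φ-cW (IsReduced⇒Red rX) i)
    moved (inj₂ refl) = inj₂ (Φ-bW (IsReduced⇒Red rX) i)

  CoverT⇒CoverW : ∀ {X Y} → IsReduced n w X → IsReduced n w Y → CoverT w (Φ n X) (Φ n Y) → CoverW π n w X Y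
  CoverT⇒CoverW {X} {Y} rX rY (_ , _ , i , move , up) = rX , rY , i , moved move ,
    trans (sym (rank rY)) (trans (cong +_ up) (trans (pos-suc _) (cong (ℤ._+ ℤ.1ℤ) (rank rX))))
    where
    moved : Φ n Y ≡ cT i (Φ n X) ⊎ Φ n Y ≡ bT i (Φ n X) → Y ≡ cW i X ⊎ Y ≡ bW i X
    moved (inj₁ e) = inj₁ (Φ-injective n (trans e (sym (Φ-cW (IsReduced⇒Red rX) i))))
    moved (inj₂ e) = inj₂ (Φ-injective n (trans e (sym (Φ-bW (IsReduced⇒Red rX) i))))

  -- The intermediate tableaux of a chain are not given as images; surjectivity supplies a word for
  -- each. The end points are linked to `X` and `Y` by equations so that the chain can be matched
  -- on.
  Φ-reflects-order : ∀ {S R} → Star (CoverT w) S R → ∀ {X Y} → IsReduced n w X → IsReduced n w Y →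
    S ≡ Φ n X → R ≡ Φ n Y → Star (CoverW π n w) X Y
  Φ-reflects-order ε rX rY refl e = subst (Star (CoverW π n w) _) (Φ-injective n e) ε
  Φ-reflects-order (c@(_ , sbt , _) ◅ cs) rX rY refl e with Φ-surjective pw sbt
  ... | V , rV , refl = CoverT⇒CoverW rX rV c ◅ Φ-reflects-order cs rV rY refl e

  Φ-iso : IsPosetIso (IsReduced n w) (IsSBT w) (λ X Y → X ≤R[ π , n , w ] Y) (λ X Y → X ≤S[ w ] Y) (Φ n)
  Φ-iso = record
    { into  = Φ-SBT
    ; inj   = λ _ _ → Φ-injective n
    ; surj  = Φ-surjective pw
    -- Both orders are chains leading down from the larger element, hence the exchanged arguments.
    ; order = λ rX rY → mk⇔ (Star.gmap (Φ n) CoverW⇒CoverT) (λ c → Φ-reflects-order c rY rX refl refl)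
    }

  Φ-perm : ∀ ρ R → IsReduced n w ρ → IsSBT w R → (Φ n ρ ≡ R ⇔ permW π ρ ≡ permT n R)
  Φ-perm ρ R redρ sbt = mk⇔ (λ { refl → permW≡permT-Φ redπ sy redρ }) back
    where
    back : permW π ρ ≡ permT n R → Φ n ρ ≡ R
    back e with Φ-surjective pw sbt
    ... | ρ′ , redρ′ , refl = cong (Φ n) (map-row-Φ-injective n ρ ρ′ (permT-injective
      (↭-trans (proj₁ (Φ-SBT redρ)) (↭-sym (proj₁ sbt)))
      (λ z∈ → cellsOf-rows (IsReduced⇒Red redρ) (∈-resp-↭ (↭.↭-reverse (cellsOf n ρ)) z∈))
      (trans (sym (permW≡permT-Φ redπ sy redρ)) e)))

theorem3p21 : (n : ℕ) (w : List ℕ) → IsPerm n w →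
    (π : List ℕ) → IsReduced n w π → SuperYamanouchi π →
    Σ (List ℕ → List Cell) (λ Φ →
    IsPosetIso (IsReduced n w) (IsSBT w) (λ X Y → X ≤R[ π , n , w ] Y) (λ X Y → X ≤S[ w ] Y) Φ
    × (∀ ρ R → IsReduced n w ρ → IsSBT w R → (Φ ρ ≡ R ⇔ permW π ρ ≡ permT n R))
    × (∀ ρ → IsReduced n w ρ → + invT (Φ ρ) ≡ invW π ρ))
theorem3p21 n w pw π redπ sy =
  Φ n , Φ-iso pw redπ sy , Φ-perm pw redπ sy , λ ρ → invW≡invT-Φ redπ sy
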